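{- Let $q\in\mathbb{C}$ with $|q|<1$, $r\in\mathbb{N}$, $n\in\mathbb{Z}_{+}=\{0,1,2,\dots\}$, $x$ real with $x\neq0,-1,-2,\dots$, and let $f\in\mathbb{N}$ be odd. Then $$E_{n,q}^{(r)}(x)=\left(\frac{[2]_q}{[2]_{q^f}}\right)^r[f]_q^n\sum_{a_1,\dots,a_r=0}^{f-1}(-1)^{a_1+\cdots+a_r}E_{n,q^f}^{(r)}\!\left(\frac{a_1+\cdots+a_r+x}{f}\right),$$ and moreover $$E_{n,q}^{(r)}(x)=\frac{[2]_q^r}{(1-q)^n}\sum_{l=0}^{n}\binom{n}{l}(-q^x)^l\sum_{a_1,\dots,a_r=0}^{f-1}\frac{(-1)^{a_1+\cdots+a_r}q^{l(a_1+\cdots+a_r)}}{(1+q^{lf})^r}.$$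
   Context: For a complex number $q$ with $|q|<1$ and $x$ real, $[x]_q=\frac{1-q^x}{1-q}$ (so $[2]_q=1+q$, $[2]_{q^f}=1+q^f$, $[f]_q=\frac{1-q^f}{1-q}$). For $r\in\mathbb{N}$, the $q$-Euler polynomials of order $r$ are defined by the generating function $$[2]_q^r\sum_{m_1,\dots,m_r=0}^{\infty}(-1)^{m_1+\cdots+m_r}e^{[m_1+\cdots+m_r+x]_q t}=\sum_{n=0}^{\infty}E_{n,q}^{(r)}(x)\frac{t^n}{n!},$$ and $E_{n,q^f}^{(r)}$ denotes the same with $q$ replaced by $q^f$.
   Formalization: The generating series diverges as written, so each coefficient of t^n is taken as an Abel sum; q^x uses any fixed logarithm of q, with (q^f)^y meaning q^{fy} (principal powers can fail); for q=0 only x>0, where 0^x is defined. -}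

module Defs where

open import Level using (Level; _⊔_) renaming (suc to lsuc)
open import Algebra.Bundles using (CommutativeRing; RawRing)
open import Algebra.Apartness.Bundles using (HeytingField)
open import Data.Empty using (⊥-elim)
open import Data.Fin.Base using (toℕ)
open import Data.Integer.Base as ℤ using (ℤ; -[1+_]) renaming (+_ to pos)
import Data.Integer.Properties as ℤₚ
open import Data.Maybe.Base using (Maybe; just; nothing)
open import Data.Nat.Base as ℕ using (ℕ; zero; suc; NonZero; _!)
import Data.Nat.Properties as ℕₚ
open import Data.Nat.Divisibility using (_∣_)
open import Data.Product.Base using (Σ; ∃; _×_; _,_; proj₁; proj₂)
import Data.Sign.Base as Sign
open import Data.Sum.Base using (_⊎_; inj₁; inj₂)
open import Data.Unit.Polymorphic.Base using (⊤)
open import Data.Vec.Base as Vec using (Vec; []; _∷_)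
open import Relation.Binary.Core using (Rel)
open import Relation.Binary.Structures using (IsStrictPartialOrder)
open import Relation.Binary.PropositionalEquality.Core as ≡ using (_≡_)
open import Relation.Nullary.Negation.Core using (¬_)
open import Relation.Nullary.Decidable.Core using (yes; no)

Odd : ℕ → Set
Odd n = ¬ (2 ∣ n)

-- A ring solver with integer coefficients, for arbitrary commutative rings.
module IntegerSolver {c ℓ : Level} (R : CommutativeRing c ℓ) where
  open CommutativeRing R
  open import Algebra.Properties.Ring ring
  open import Algebra.Properties.Semiring.Mult semiring
    using (×1-homo-*; ×-homo-+) renaming (_×_ to _·_)
  open import Algebra.Properties.AbelianGroup +-abelianGroup using (⁻¹-∙-comm)
  open import Algebra.Solver.Ring.AlmostCommutativeRing
  open import Relation.Binary.Reasoning.Setoid setoid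

  ⟦_⟧ℤ : ℤ → Carrier
  ⟦ pos n ⟧ℤ    = n · 1#
  ⟦ -[1+ n ] ⟧ℤ = - (suc n · 1#)

  private
    N : ℕ → Carrier
    N n = n · 1#

    cancel₁ : ∀ x y → x + y - (x + 0#) ≈ y
    cancel₁ x y = begin
      x + y - (x + 0#)  ≈⟨ +-congˡ (-‿cong (+-identityʳ x)) ⟩
      x + y - x         ≈⟨ +-congʳ (+-comm x y) ⟩
      y + x - x         ≈⟨ +-assoc y x (- x) ⟩
      y + (x - x)       ≈⟨ +-congˡ (-‿inverseʳ x) ⟩
      y + 0#            ≈⟨ +-identityʳ y ⟩
      y                 ∎

    cancel₂ : ∀ x a b → a - b ≈ (x + a) - (x + b)
    cancel₂ x a b = sym (begin
      (x + a) - (x + b)      ≈⟨ +-congˡ (⁻¹-∙-comm x b) ⟨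
      (x + a) + (- x + - b)  ≈⟨ +-assoc (x + a) (- x) (- b) ⟨
      (x + a) + - x + - b    ≈⟨ +-congʳ (+-congʳ (+-comm x a)) ⟩
      (a + x) + - x + - b    ≈⟨ +-congʳ (+-assoc a x (- x)) ⟩
      a + (x - x) + - b      ≈⟨ +-congʳ (+-congˡ (-‿inverseʳ x)) ⟩
      a + 0# + - b           ≈⟨ +-congʳ (+-identityʳ a) ⟩
      a - b                  ∎)

    ⊖-homo : ∀ m n → ⟦ m ℤ.⊖ n ⟧ℤ ≈ N m - N n
    ⊖-homo zero    zero    = sym (-‿inverseʳ 0#)
    ⊖-homo zero    (suc n) = sym (+-identityˡ _)
    ⊖-homo (suc m) zero    = sym (trans (+-congˡ -0#≈0#) (+-identityʳ _))
    ⊖-homo (suc m) (suc n) = begin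
      ⟦ suc m ℤ.⊖ suc n ⟧ℤ  ≡⟨ ≡.cong ⟦_⟧ℤ (ℤₚ.[1+m]⊖[1+n]≡m⊖n m n) ⟩
      ⟦ m ℤ.⊖ n ⟧ℤ          ≈⟨ ⊖-homo m n ⟩
      N m - N n             ≈⟨ cancel₂ 1# (N m) (N n) ⟩
      N (suc m) - N (suc n) ∎

    +-homo : ∀ i j → ⟦ i ℤ.+ j ⟧ℤ ≈ ⟦ i ⟧ℤ + ⟦ j ⟧ℤ
    +-homo (pos m)  (pos n)  = ×-homo-+ 1# m n
    +-homo (pos m)  -[1+ n ] = ⊖-homo m (suc n)
    +-homo -[1+ m ] (pos n)  = trans (⊖-homo n (suc m)) (+-comm _ _)
    +-homo -[1+ m ] -[1+ n ] = begin
      - N (suc (suc (m ℕ.+ n)))    ≡⟨ ≡.cong (λ k → - N (suc k)) (≡.sym (ℕₚ.+-suc m n)) ⟩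
      - N (suc m ℕ.+ suc n)        ≈⟨ -‿cong (×-homo-+ 1# (suc m) (suc n)) ⟩
      - (N (suc m) + N (suc n))    ≈⟨ ⁻¹-∙-comm _ _ ⟨
      - N (suc m) + - N (suc n)    ∎

    +◃ : ∀ n → ⟦ Sign.+ ℤ.◃ n ⟧ℤ ≈ N n
    +◃ zero    = refl
    +◃ (suc n) = refl

    -◃ : ∀ n → ⟦ Sign.- ℤ.◃ n ⟧ℤ ≈ - N n
    -◃ zero    = sym -0#≈0#
    -◃ (suc n) = refl

    *-homo : ∀ i j → ⟦ i ℤ.* j ⟧ℤ ≈ ⟦ i ⟧ℤ * ⟦ j ⟧ℤ
    *-homo (pos m)  (pos n)  = trans (+◃ (m ℕ.* n)) (×1-homo-* m n)
    *-homo (pos m)  -[1+ n ] = begin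
      ⟦ Sign.- ℤ.◃ (m ℕ.* suc n) ⟧ℤ ≈⟨ -◃ (m ℕ.* suc n) ⟩
      - N (m ℕ.* suc n)             ≈⟨ -‿cong (×1-homo-* m (suc n)) ⟩
      - (N m * N (suc n))           ≈⟨ -‿distribʳ-* _ _ ⟩
      N m * - N (suc n)             ∎
    *-homo -[1+ m ] (pos n)  = begin
      ⟦ Sign.- ℤ.◃ (suc m ℕ.* n) ⟧ℤ ≈⟨ -◃ (suc m ℕ.* n) ⟩
      - N (suc m ℕ.* n)             ≈⟨ -‿cong (×1-homo-* (suc m) n) ⟩
      - (N (suc m) * N n)           ≈⟨ -‿distribˡ-* _ _ ⟩
      - N (suc m) * N n             ∎
    *-homo -[1+ m ] -[1+ n ] = begin
      N (suc m ℕ.* suc n)           ≈⟨ ×1-homo-* (suc m) (suc n) ⟩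
      N (suc m) * N (suc n)         ≈⟨ -‿involutive _ ⟨
      - - (N (suc m) * N (suc n))   ≈⟨ -‿cong (-‿distribˡ-* _ _) ⟩
      - (- N (suc m) * N (suc n))   ≈⟨ -‿distribʳ-* _ _ ⟩
      - N (suc m) * - N (suc n)     ∎

    neg-homo : ∀ i → ⟦ ℤ.- i ⟧ℤ ≈ - ⟦ i ⟧ℤ
    neg-homo (pos zero)    = sym -0#≈0#
    neg-homo (pos (suc n)) = refl
    neg-homo -[1+ n ]      = sym (-‿involutive _)

    morphism : ℤ.+-*-rawRing -Raw-AlmostCommutative⟶ fromCommutativeRing R
    morphism = record
      { ⟦_⟧    = ⟦_⟧ℤ
      ; +-homo = +-homo
      ; *-homo = *-homo
      ; -‿homo = neg-homo
      ; 0-homo = refl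
      ; 1-homo = +-identityʳ 1#
      }

    _≟ᶜ_ : ∀ i j → Maybe (⟦ i ⟧ℤ ≈ ⟦ j ⟧ℤ)
    i ≟ᶜ j with i ℤₚ.≟ j
    ... | yes i≡j = just (reflexive (≡.cong ⟦_⟧ℤ i≡j))
    ... | no  _   = nothing

  open import Algebra.Solver.Ring ℤ.+-*-rawRing (fromCommutativeRing R) morphism _≟ᶜ_ public
    using (solve; _:=_; _:+_; _:*_; _:-_; :-_; con; Polynomial)

module Sequences {c ℓ₁ ℓ₂ : Level} (F : HeytingField c ℓ₁ ℓ₂)
  (_<_ : Rel (HeytingField.Carrier F) ℓ₂) where
  open HeytingField F

  commutativeRing : CommutativeRing c ℓ₁
  commutativeRing = record { isCommutativeRing = isCommutativeRing }

  open CommutativeRing commutativeRing public using (rawRing; ring; semiring)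
  open import Algebra.Definitions.RawSemiring (RawRing.rawSemiring rawRing) public
    using (_^_; sum) renaming (_×_ to _·_)

  fromℕ : ℕ → Carrier
  fromℕ n = n · 1#

  Cauchy : (ℕ → Carrier) → Set (c ⊔ ℓ₂)
  Cauchy s = ∀ ε → 0# < ε →
    ∃ λ N → ∀ m n → N ℕ.≤ m → N ℕ.≤ n → (s m - s n) < ε

  _⟶_ : (ℕ → Carrier) → Carrier → Set (c ⊔ ℓ₂)
  s ⟶ x = ∀ ε → 0# < ε →
    ∃ λ N → ∀ n → N ℕ.≤ n → (s n - x) < ε × (x - s n) < ε

-- The real numbers, axiomatised as a Cauchy-complete Archimedean ordered
-- field. The axioms are meaningful constructively, and classically (with #
-- read as ≉) they characterise ℝ up to isomorphism.
record RealNumbers (c ℓ₁ ℓ₂ : Level) : Set (lsuc (c ⊔ ℓ₁ ⊔ ℓ₂)) where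
  infix 4 _<_
  field
    heytingField : HeytingField c ℓ₁ ℓ₂

  open HeytingField heytingField public

  field
    _<_                  : Rel Carrier ℓ₂
    isStrictPartialOrder : IsStrictPartialOrder _≈_ _<_
    #⇒<⊎>                : ∀ {x y} → x # y → x < y ⊎ y < x
    <⇒#                  : ∀ {x y} → x < y → x # y
    +-monoˡ-<            : ∀ z {x y} → x < y → x + z < y + z
    *-pos                : ∀ {x y} → 0# < x → 0# < y → 0# < x * y

  open Sequences heytingField _<_ public

  field
    archimedean : ∀ x → ∃ λ n → x < fromℕ n
    complete    : ∀ s → Cauchy s → ∃ λ x → s ⟶ x

module OrderedField {c ℓ₁ ℓ₂ : Level} (R : RealNumbers c ℓ₁ ℓ₂) where
  open RealNumbers R
  open IsStrictPartialOrder isStrictPartialOrder public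
    using (<-respʳ-≈; <-respˡ-≈) renaming (irrefl to <-irrefl; trans to <-trans)
  open import Algebra.Apartness.Properties.HeytingCommutativeRing heytingCommutativeRing public
    using (1#0; x-0≈x; invertibleˡ⇒#; #-congʳ; #-congˡ)
  open import Algebra.Properties.Semiring.Mult semiring public
    using (×1-homo-*; ×-homo-+)
  open IntegerSolver commutativeRing public

  <-resp : ∀ {x x′ y y′} → x ≈ x′ → y ≈ y′ → x < y → x′ < y′
  <-resp p q x<y = <-respˡ-≈ p (<-respʳ-≈ q x<y)

  <-cotrans : ∀ {x y} → x < y → ∀ z → x < z ⊎ z < y
  <-cotrans x<y z with #-cotrans (<⇒# x<y) z
  ... | inj₁ x#z with #⇒<⊎> x#z
  ...   | inj₁ x<z = inj₁ x<z
  ...   | inj₂ z<x = inj₂ (<-trans z<x x<y)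
  <-cotrans x<y z | inj₂ z#y with #⇒<⊎> z#y
  ...   | inj₁ z<y = inj₂ z<y
  ...   | inj₂ y<z = inj₁ (<-trans x<y y<z)

  x<y⇒0<y-x : ∀ {x y} → x < y → 0# < y - x
  x<y⇒0<y-x {x} x<y = <-respˡ-≈ (-‿inverseʳ x) (+-monoˡ-< (- x) x<y)

  0<y-x⇒x<y : ∀ {x y} → 0# < y - x → x < y
  0<y-x⇒x<y {x} {y} p = <-resp (+-identityˡ x)
    (solve 2 (λ x y → (y :- x) :+ x := y) refl x y) (+-monoˡ-< x p)

  +-pos : ∀ {x y} → 0# < x → 0# < y → 0# < x + y
  +-pos {x} {y} 0<x 0<y = <-trans 0<y (<-respˡ-≈ (+-identityˡ y) (+-monoˡ-< y 0<x))

  +-mono-< : ∀ {w x y z} → w < x → y < z → w + y < x + z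
  +-mono-< {w} {x} {y} {z} p q = 0<y-x⇒x<y (<-respʳ-≈
    (solve 4 (λ w x y z → (x :- w) :+ (z :- y) := (x :+ z) :- (w :+ y)) refl w x y z)
    (+-pos (x<y⇒0<y-x p) (x<y⇒0<y-x q)))

  *-monoˡ-<-pos : ∀ {x y z} → 0# < z → x < y → x * z < y * z
  *-monoˡ-<-pos {x} {y} {z} 0<z x<y = 0<y-x⇒x<y (<-respʳ-≈
    (solve 3 (λ x y z → (y :- x) :* z := y :* z :- x :* z) refl x y z)
    (*-pos (x<y⇒0<y-x x<y) 0<z))

  x<0⇒0<-x : ∀ {x} → x < 0# → 0# < - x
  x<0⇒0<-x {x} p = <-respʳ-≈ (+-identityˡ (- x)) (x<y⇒0<y-x p)

  *-neg : ∀ {x y} → x < 0# → y < 0# → 0# < x * y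
  *-neg {x} {y} p q = <-respʳ-≈ (solve 2 (λ x y → :- x :* :- y := x :* y) refl x y)
    (*-pos (x<0⇒0<-x p) (x<0⇒0<-x q))

  0<1 : 0# < 1#
  0<1 with #⇒<⊎> 1#0
  ... | inj₂ p = p
  ... | inj₁ q = <-respʳ-≈ (*-identityˡ 1#) (*-neg q q)

  x#0⇒0<x² : ∀ {x} → x # 0# → 0# < x * x
  x#0⇒0<x² x#0 with #⇒<⊎> x#0
  ... | inj₁ p = *-neg p p
  ... | inj₂ p = *-pos p p

  _⁻¹[_] : ∀ x → x # 0# → Carrier
  x ⁻¹[ p ] = proj₁ (#⇒invertible p)

  *-inverseʳ : ∀ {x} (p : x # 0#) → x * x ⁻¹[ p ] ≈ 1#
  *-inverseʳ {x} p = trans (*-congʳ (sym (x-0≈x x))) (proj₂ (proj₂ (#⇒invertible p)))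

  0<x⇒x#0 : ∀ {x} → 0# < x → x # 0#
  0<x⇒x#0 p = #-sym (<⇒# p)

  unitˡ⇒#0 : ∀ {x y} → x * y ≈ 1# → x # 0#
  unitˡ⇒#0 {x} {y} p = invertibleˡ⇒#
    (y , trans (*-congˡ (x-0≈x x)) (trans (*-comm y x) p))

  0<xy⇒0<x⇒0<y : ∀ {x y} → 0# < x * y → 0# < x → 0# < y
  0<xy⇒0<x⇒0<y {x} {y} 0<xy 0<x
    with #⇒<⊎> (unitˡ⇒#0 {y} {x * xy⁻¹} (trans
           (solve 3 (λ x y i → y :* (x :* i) := x :* y :* i) refl x y xy⁻¹)
           (*-inverseʳ xy#0)))
    where
    xy#0 = 0<x⇒x#0 0<xy
    xy⁻¹ = (x * y) ⁻¹[ xy#0 ]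
  ... | inj₂ 0<y = 0<y
  ... | inj₁ y<0 = ⊥-elim (<-irrefl refl (<-respʳ-≈
    (solve 2 (λ x y → x :* y :+ x :* :- y := con (pos 0)) refl x y)
    (+-pos 0<xy (*-pos 0<x (x<0⇒0<-x y<0)))))

  ⁻¹-pos : ∀ {x} (0<x : 0# < x) → 0# < x ⁻¹[ 0<x⇒x#0 0<x ]
  ⁻¹-pos 0<x = 0<xy⇒0<x⇒0<y
    (<-respʳ-≈ (sym (*-inverseʳ (0<x⇒x#0 0<x))) 0<1) 0<x

  *-cancelʳ-< : ∀ {x y z} → 0# < z → x * z < y * z → x < y
  *-cancelʳ-< {x} {y} {z} 0<z p = 0<y-x⇒x<y (0<xy⇒0<x⇒0<y
    (<-respʳ-≈ (solve 3 (λ x y z → y :* z :- x :* z := z :* (y :- x)) refl x y z)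
      (x<y⇒0<y-x p)) 0<z)

  x²≮0 : ∀ x → ¬ (x * x < 0#)
  x²≮0 x p = <-irrefl refl (<-trans (x#0⇒0<x² x#0) p)
    where
    x²#0 = <⇒# p
    x#0 = unitˡ⇒#0 (trans (sym (*-assoc x x _)) (*-inverseʳ x²#0))

  +-pos-nonneg : ∀ {x y} → 0# < x → ¬ (y < 0#) → 0# < x + y
  +-pos-nonneg {x} {y} 0<x y≮0 with <-cotrans 0<x (x + y)
  ... | inj₁ p = p
  ... | inj₂ q = ⊥-elim (y≮0 (<-resp
    (solve 2 (λ x y → x :+ y :+ :- x := y) refl x y) (-‿inverseʳ x) (+-monoˡ-< (- x) q)))

  +-nonneg : ∀ {x y} → ¬ (x < 0#) → ¬ (y < 0#) → ¬ (x + y < 0#)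
  +-nonneg {x} {y} x≮0 y≮0 p with <-cotrans p y
  ... | inj₂ y<0 = y≮0 y<0
  ... | inj₁ x+y<y = x≮0 (<-resp
    (solve 2 (λ x y → x :+ y :+ :- y := x) refl x y) (-‿inverseʳ y) (+-monoˡ-< (- y) x+y<y))

  *-nonneg-pos : ∀ {x y} → ¬ (x < 0#) → 0# < y → ¬ (x * y < 0#)
  *-nonneg-pos {x} {y} x≮0 0<y xy<0 =
    x≮0 (*-cancelʳ-< 0<y (<-respʳ-≈ (sym (zeroˡ y)) xy<0))

  x²<1⇒0<1+x : ∀ {x} → x * x < 1# → 0# < 1# + x
  x²<1⇒0<1+x {x} p with <-cotrans 0<1 (1# + x)
  ... | inj₁ q = q
  ... | inj₂ 1+x<1 = 0<xy⇒0<x⇒0<y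
    (<-respʳ-≈ (trans (+-congʳ (sym (*-identityˡ 1#)))
        (solve 2 (λ e x → e :* e :- x :* x := (e :- x) :* (e :+ x)) refl 1# x))
      (x<y⇒0<y-x p))
    (+-pos 0<1 (<-respʳ-≈ (solve 2 (λ e x → e :- (e :+ x) := :- x) refl 1# x)
      (x<y⇒0<y-x 1+x<1)))

  fromℕ-pos : ∀ n → 0# < fromℕ (suc n)
  fromℕ-pos zero    = <-respʳ-≈ (sym (+-identityʳ 1#)) 0<1
  fromℕ-pos (suc n) = +-pos 0<1 (fromℕ-pos n)

  recip : ∀ n → .{{NonZero n}} → Carrier
  recip (suc n) = fromℕ (suc n) ⁻¹[ 0<x⇒x#0 (fromℕ-pos n) ]

  recip-pos : ∀ n → .{{_ : NonZero n}} → 0# < recip n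
  recip-pos (suc n) = ⁻¹-pos (fromℕ-pos n)

  recip-inverse : ∀ n → .{{_ : NonZero n}} → fromℕ n * recip n ≈ 1#
  recip-inverse (suc n) = *-inverseʳ (0<x⇒x#0 (fromℕ-pos n))

  recip-! : ∀ n → recip (suc n !) {{ℕₚ._!≢0 (suc n)}} * fromℕ (suc n) ≈ recip (n !) {{ℕₚ._!≢0 n}}
  recip-! n = begin
    a * s              ≈⟨ *-identityʳ _ ⟨
    a * s * 1#         ≈⟨ *-congˡ (recip-inverse (n !)) ⟨
    a * s * (m * b)    ≈⟨ solve 4 (λ a s m b → a :* s :* (m :* b) := s :* m :* a :* b) refl a s m b ⟩
    s * m * a * b      ≈⟨ *-congʳ (*-congʳ (×1-homo-* (suc n) (n !))) ⟨
    fromℕ (suc n !) * a * b ≈⟨ *-congʳ (recip-inverse (suc n !)) ⟩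
    1# * b             ≈⟨ *-identityˡ b ⟩
    b                  ∎
    where
    open import Relation.Binary.Reasoning.Setoid (CommutativeRing.setoid commutativeRing)
    instance
      _ = ℕₚ._!≢0 n
      _ = ℕₚ._!≢0 (suc n)
    a = recip (suc n !)
    b = recip (n !)
    s = fromℕ (suc n)
    m = fromℕ (n !)

  <-fromℕ-mono : ∀ {x m n} → m ℕ.≤ n → x < fromℕ m → x < fromℕ n
  <-fromℕ-mono {x} {m} {n} m≤n x<m = ≡.subst (λ k → x < fromℕ k) (ℕₚ.m∸n+n≡m m≤n) (go (n ℕ.∸ m))
    where
    go : ∀ k → x < fromℕ (k ℕ.+ m)
    go zero    = x<m
    go (suc k) = <-trans (go k) (0<y-x⇒x<y
      (<-respʳ-≈ (solve 2 (λ e y → e := e :+ y :- y) refl 1# (fromℕ (k ℕ.+ m))) 0<1))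

  0<x+x⇒0<x : ∀ {x} → 0# < x + x → 0# < x
  0<x+x⇒0<x {x} p = 0<xy⇒0<x⇒0<y (<-respʳ-≈
    (sym (trans (distribʳ x 1# 1#) (+-cong (*-identityˡ x) (*-identityˡ x)))) p) (+-pos 0<1 0<1)

  Bounded : Carrier → Carrier → Set ℓ₂
  Bounded B x = x < B × - x < B

  Bounded-* : ∀ {B C x y} → Bounded B x → Bounded C y → Bounded (B * C) (x * y)
  Bounded-* {B} {C} {x} {y} (p , p′) (q , q′) = upper x p p′ , <-respˡ-≈
    (solve 2 (λ x y → :- x :* y := :- (x :* y)) refl x y)
    (upper (- x) p′ (<-respˡ-≈ (solve 1 (λ x → x := :- :- x) refl x) p))
    where
    upper : ∀ x → x < B → - x < B → x * y < B * C
    upper x p p′ = 0<y-x⇒x<y (0<x+x⇒0<x (<-respʳ-≈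
      (solve 4 (λ B C x y →
          (B :- x) :* (C :- :- y) :+ (B :- :- x) :* (C :- y)
          := (B :* C :- x :* y) :+ (B :* C :- x :* y)) refl B C x y)
      (+-pos (*-pos (x<y⇒0<y-x p) (x<y⇒0<y-x q′)) (*-pos (x<y⇒0<y-x p′) (x<y⇒0<y-x q)))))

  Bounded-+ : ∀ {B C x y} → Bounded B x → Bounded C y → Bounded (B + C) (x + y)
  Bounded-+ {B} {C} {x} {y} (p , p′) (q , q′) = +-mono-< p q , <-respˡ-≈
    (solve 2 (λ x y → :- x :+ :- y := :- (x :+ y)) refl x y) (+-mono-< p′ q′)

  Bounded-neg : ∀ {B x} → Bounded B x → Bounded B (- x)
  Bounded-neg {B} {x} (p , p′) = p′ , <-respˡ-≈ (solve 1 (λ x → x := :- :- x) refl x) p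

  Bounded-resp : ∀ {B C x y} → B ≈ C → x ≈ y → Bounded B x → Bounded C y
  Bounded-resp e e′ (p , p′) = <-resp e′ e p , <-resp (-‿cong e′) e p′

  bound : ∀ x → ∃ λ n → Bounded (fromℕ n) x
  bound x with archimedean x | archimedean (- x)
  ... | m , p | n , q = m ℕ.+ n , <-fromℕ-mono (ℕₚ.m≤m+n m n) p , <-fromℕ-mono (ℕₚ.m≤n+m n m) q

  -- Ratio test for increments dominated by a multiple of M ^ k / k !.
  exponential⇒cauchy : ∀ (s t : ℕ → Carrier) M .{{_ : NonZero M}} →
    (∀ k → 0# < t k) →
    (∀ k → t (suc k) * fromℕ (suc k) ≈ t k * fromℕ M) →
    (∀ k → Bounded (t k) (s (suc k) - s k)) →
    Cauchy s
  exponential⇒cauchy s t M@(suc M′) 0<t ratio incr ε 0<ε = N₀ , close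
    where
    2M = M ℕ.+ M
    0<M = fromℕ-pos M′

    halves : ∀ k → 2M ℕ.≤ k → t (suc k) + t (suc k) < t k
    halves k 2M≤k = *-cancelʳ-< 0<M (<-resp
      (trans (*-congʳ (×-homo-+ 1# M M))
        (solve 2 (λ m t → (m :+ m) :* t := (t :+ t) :* m) refl (fromℕ M) (t (suc k))))
      (trans (*-comm _ _) (ratio k))
      (*-monoˡ-<-pos (0<t (suc k)) (<-fromℕ-mono (ℕ.s≤s 2M≤k)
        (0<y-x⇒x<y (<-respʳ-≈ (solve 2 (λ e y → e := e :+ y :- y) refl 1# (fromℕ 2M)) 0<1)))))

    t₀ = t 2M

    decreasing : ∀ j → t (j ℕ.+ 2M) < t₀ + t₀
    decreasing zero    = <-respˡ-≈ (+-identityˡ t₀) (+-monoˡ-< t₀ (0<t 2M))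
    decreasing (suc j) = <-trans
      (<-trans (<-respˡ-≈ (+-identityˡ _) (+-monoˡ-< (t (suc (j ℕ.+ 2M))) (0<t (suc (j ℕ.+ 2M)))))
        (halves (j ℕ.+ 2M) (ℕₚ.m≤n+m 2M j)))
      (decreasing j)

    ε#0 = 0<x⇒x#0 0<ε
    4×_ : Carrier → Carrier
    4× x = (x + x) + (x + x)
    bnd = 4× ((t₀ + t₀) * fromℕ M)
    P  = proj₁ (archimedean (bnd * ε ⁻¹[ ε#0 ]))
    N₀ = suc (P ℕ.+ 2M)

    bnd<P*ε : ∀ n → P ℕ.≤ n → bnd < fromℕ n * ε
    bnd<P*ε n P≤n = <-respˡ-≈
      (trans (*-assoc bnd _ ε) (trans (*-congˡ (trans (*-comm _ ε) (*-inverseʳ ε#0))) (*-identityʳ bnd)))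
      (*-monoˡ-<-pos 0<ε (<-fromℕ-mono P≤n (proj₂ (archimedean (bnd * ε ⁻¹[ ε#0 ])))))

    small : ∀ n → N₀ ℕ.≤ n → 4× t n < ε
    small (suc k) (ℕ.s≤s P+2M≤k) = *-cancelʳ-< (fromℕ-pos k) (<-trans
      (<-resp (sym (4×-* (trans (ratio k) (*-congʳ (reflexive (≡.cong t (≡.sym j-eq))))))) refl
        (4×-mono (*-monoˡ-<-pos 0<M (decreasing j))))
      (<-respʳ-≈ (*-comm _ ε)
        (bnd<P*ε (suc k) (ℕₚ.m≤n⇒m≤1+n (ℕₚ.≤-trans (ℕₚ.m≤m+n P 2M) P+2M≤k)))))
      where
      j = k ℕ.∸ 2M
      j-eq : j ℕ.+ 2M ≡ k
      j-eq = ℕₚ.m∸n+n≡m (ℕₚ.≤-trans (ℕₚ.m≤n+m 2M P) P+2M≤k)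
      4×-mono : ∀ {x y} → x < y → 4× x < 4× y
      4×-mono p = +-mono-< (+-mono-< p p) (+-mono-< p p)
      4×-* : ∀ {x y z} → x * y ≈ z → 4× x * y ≈ 4× z
      4×-* {x} {y} {z} e = trans
        (solve 2 (λ x y → ((x :+ x) :+ (x :+ x)) :* y
          := (x :* y :+ x :* y) :+ (x :* y :+ x :* y)) refl x y)
        (+-cong (+-cong e e) (+-cong e e))

    tail : ∀ (d : ℕ → Carrier) n → N₀ ℕ.≤ n → d 0 ≈ 0# →
      (∀ j → d (suc j) - d j < t (j ℕ.+ n)) → ∀ j →
      d j < 4× t n - (t (j ℕ.+ n) + t (j ℕ.+ n))
    tail d n N₀≤n d0 step zero = <-resp (sym d0)
      (solve 1 (λ x → x :+ x := (x :+ x) :+ (x :+ x) :- (x :+ x)) refl (t n))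
      (+-pos (0<t n) (0<t n))
    tail d n N₀≤n d0 step (suc j) = <-trans
      (<-respˡ-≈ (solve 2 (λ x y → y :- x :+ x := y) refl (d j) (d (suc j)))
        (+-mono-< (step j) (tail d n N₀≤n d0 step j)))
      (0<y-x⇒x<y (<-respʳ-≈
        (solve 3 (λ T u v → u :- (v :+ v)
            := T :- (v :+ v) :- (u :+ (T :- (u :+ u)))) refl (4× t n) (t (j ℕ.+ n)) (t (suc (j ℕ.+ n))))
        (x<y⇒0<y-x (halves (j ℕ.+ n) 2M≤j+n))))
      where
      2M≤j+n : 2M ℕ.≤ j ℕ.+ n
      2M≤j+n = ℕₚ.≤-trans (ℕₚ.m≤n+m 2M (suc P)) (ℕₚ.≤-trans N₀≤n (ℕₚ.m≤n+m n j))

    tail′ : ∀ d n → N₀ ℕ.≤ n → d 0 ≈ 0# →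
      (∀ j → d (suc j) - d j < t (j ℕ.+ n)) → ∀ j → d j < ε
    tail′ d n N₀≤n d0 step j = <-trans (tail d n N₀≤n d0 step j) (<-trans
      (0<y-x⇒x<y (<-respʳ-≈
        (solve 2 (λ T u → u :+ u := T :- (T :- (u :+ u))) refl (4× t n) (t (j ℕ.+ n)))
        (+-pos (0<t (j ℕ.+ n)) (0<t (j ℕ.+ n)))))
      (small n N₀≤n))

    close : ∀ m n → N₀ ℕ.≤ m → N₀ ℕ.≤ n → s m - s n < ε
    close m n N₀≤m N₀≤n with ℕₚ.≤-total m n
    ... | inj₂ n≤m = ≡.subst (λ k → s k - s n < ε) (ℕₚ.m∸n+n≡m n≤m)
      (tail′ (λ j → s (j ℕ.+ n) - s n) n N₀≤n (-‿inverseʳ _)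
        (λ j → <-respˡ-≈ (solve 3 (λ x y z → y :- x := y :- z :- (x :- z)) refl
            (s (j ℕ.+ n)) (s (suc j ℕ.+ n)) (s n))
          (proj₁ (incr (j ℕ.+ n))))
        (m ℕ.∸ n))
    ... | inj₁ m≤n = ≡.subst (λ k → s m - s k < ε) (ℕₚ.m∸n+n≡m m≤n)
      (tail′ (λ j → s m - s (j ℕ.+ m)) m N₀≤m (-‿inverseʳ _)
        (λ j → <-respˡ-≈ (solve 3 (λ x y z → :- (y :- x) := z :- y :- (z :- x)) refl
            (s (j ℕ.+ m)) (s (suc j ℕ.+ m)) (s m))
          (proj₂ (incr (j ℕ.+ m))))
        (n ℕ.∸ m))

module Complex {c ℓ₁ ℓ₂ : Level} (R : RealNumbers c ℓ₁ ℓ₂) where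
  open RealNumbers R
  open OrderedField R

  infix  8 -ᶜ_
  infixl 7 _*ᶜ_ _∙ᶜ_ _/ᶜ_
  infixl 6 _+ᶜ_ _-ᶜ_
  infix  4 _≈ᶜ_ ∣_∣<_

  record ℂ : Set c where
    constructor _+i_
    field
      re im : Carrier
  open ℂ public

  _≈ᶜ_ : Rel ℂ ℓ₁
  z ≈ᶜ w = re z ≈ re w × im z ≈ im w

  ofℝ : Carrier → ℂ
  ofℝ x = x +i 0#

  0ᶜ 1ᶜ : ℂ
  0ᶜ = ofℝ 0#
  1ᶜ = ofℝ 1#

  _+ᶜ_ _-ᶜ_ _*ᶜ_ : ℂ → ℂ → ℂ
  z +ᶜ w = (re z + re w) +i (im z + im w)
  z -ᶜ w = (re z - re w) +i (im z - im w)
  z *ᶜ w = (re z * re w - im z * im w) +i (re z * im w + im z * re w)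

  -ᶜ_ : ℂ → ℂ
  -ᶜ z = (- re z) +i (- im z)

  _∙ᶜ_ : Carrier → ℂ → ℂ
  x ∙ᶜ z = (x * re z) +i (x * im z)

  ℂ-rawRing : RawRing c ℓ₁
  ℂ-rawRing = record
    { Carrier = ℂ ; _≈_ = _≈ᶜ_ ; _+_ = _+ᶜ_ ; _*_ = _*ᶜ_ ; -_ = -ᶜ_ ; 0# = 0ᶜ ; 1# = 1ᶜ }

  open import Algebra.Definitions.RawSemiring (RawRing.rawSemiring ℂ-rawRing) public
    using () renaming (_^_ to _^ᶜ_)

  fromℕᶜ : ℕ → ℂ
  fromℕᶜ n = ofℝ (fromℕ n)

  _/ᶜ_ : ℂ → (n : ℕ) → .{{NonZero n}} → ℂ
  z /ᶜ n = recip n ∙ᶜ z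

  normSq : ℂ → Carrier
  normSq z = re z * re z + im z * im z

  -- |z| < b, i.e. √(x² + y²) < b for z = x + iy, with the square root cleared.
  ∣_∣<_ : ℂ → Carrier → Set ℓ₂
  ∣ z ∣< b = 0# < b × normSq z < b * b

  _#ᶜ0 : ℂ → Set ℓ₂
  z #ᶜ0 = normSq z # 0#

  _⁻¹ᶜ[_] : ∀ z → z #ᶜ0 → ℂ
  z ⁻¹ᶜ[ p ] = normSq z ⁻¹[ p ] ∙ᶜ (re z +i (- im z))

  _⟶ᶜ_ : (ℕ → ℂ) → ℂ → Set (c ⊔ ℓ₂)
  s ⟶ᶜ z = ∀ ε → 0# < ε → ∃ λ N → ∀ n → N ℕ.≤ n → ∣ s n -ᶜ z ∣< ε

  -- ∑< n a is a 0 + ⋯ + a (n - 1).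
  ∑< : ℕ → (ℕ → ℂ) → ℂ
  ∑< zero    a = 0ᶜ
  ∑< (suc n) a = ∑< n a +ᶜ a n

  expTerm : ℂ → ℕ → ℂ
  expTerm z k = (z ^ᶜ k /ᶜ (k !)) {{ℕₚ._!≢0 k}}

  expSum : ℂ → ℕ → ℂ
  expSum z n = ∑< n (expTerm z)

  module _ (z : ℂ) where
    private
      M : ℕ
      M = suc (proj₁ (bound (re z)) ℕ.+ proj₁ (bound (im z)))

      m : Carrier
      m = fromℕ M

      weaken : ∀ {x k} → k ℕ.≤ M → Bounded (fromℕ k) x → Bounded m x
      weaken k≤M (p , p′) = <-fromℕ-mono k≤M p , <-fromℕ-mono k≤M p′

      re-bound : Bounded m (re z)
      re-bound = weaken (ℕₚ.m≤n⇒m≤1+n (ℕₚ.m≤m+n (proj₁ (bound (re z))) _)) (proj₂ (bound (re z)))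

      im-bound : Bounded m (im z)
      im-bound = weaken (ℕₚ.m≤n⇒m≤1+n (ℕₚ.m≤n+m _ (proj₁ (bound (re z))))) (proj₂ (bound (im z)))

      2m = fromℕ (M ℕ.+ M)

      B : ℕ → Carrier
      B k = 2m ^ k * (1# + 1#)

      B-step : ∀ k → m * B k + m * B k ≈ B (suc k)
      B-step k = trans
        (solve 3 (λ m b e → m :* b :+ m :* b := (m :+ m) :* b) refl m (B k) 1#)
        (trans (*-congʳ (sym (×-homo-+ 1# M M))) (sym (*-assoc 2m (2m ^ k) _)))

      pow-bound : ∀ k → Bounded (B k) (re (z ^ᶜ k)) × Bounded (B k) (im (z ^ᶜ k))
      pow-bound zero =
        ( <-respʳ-≈ (sym (*-identityˡ _)) (<-respˡ-≈ (+-identityˡ 1#) (+-monoˡ-< 1# 0<1))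
        , <-respʳ-≈ (sym (*-identityˡ _)) (<-trans -1<0 (+-pos 0<1 0<1)) )
        , ( <-respʳ-≈ (sym (*-identityˡ _)) (+-pos 0<1 0<1)
          , <-resp (solve 0 (con (pos 0) := :- con (pos 0)) refl) (sym (*-identityˡ _)) (+-pos 0<1 0<1) )
        where
        -1<0 : - 1# < 0#
        -1<0 = 0<y-x⇒x<y (<-respʳ-≈ (solve 1 (λ e → e := con (pos 0) :- :- e) refl 1#) 0<1)
      pow-bound (suc k) with pow-bound k
      ... | p , q =
        Bounded-resp (B-step k) refl
          (Bounded-+ (Bounded-* re-bound p) (Bounded-neg (Bounded-* im-bound q)))
        , Bounded-resp (B-step k) refl
          (Bounded-+ (Bounded-* re-bound q) (Bounded-* im-bound p))

      r : ℕ → Carrier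
      r k = recip (k !) {{ℕₚ._!≢0 k}}

      t : ℕ → Carrier
      t k = r k * B k

      0<B : ∀ k → 0# < B k
      0<B zero    = <-respʳ-≈ (sym (*-identityˡ _)) (+-pos 0<1 0<1)
      0<B (suc k) = <-respʳ-≈ (B-step k) (+-pos (*-pos 0<m (0<B k)) (*-pos 0<m (0<B k)))
        where 0<m = fromℕ-pos (proj₁ (bound (re z)) ℕ.+ proj₁ (bound (im z)))

      0<t : ∀ k → 0# < t k
      0<t k = *-pos (recip-pos (k !) {{ℕₚ._!≢0 k}}) (0<B k)

      ratio : ∀ k → t (suc k) * fromℕ (suc k) ≈ t k * 2m
      ratio k = trans
        (solve 5 (λ r x b n e → r :* (x :* b :* e) :* n := (r :* n) :* (b :* e) :* x) refl
          (r (suc k)) 2m (2m ^ k) (fromℕ (suc k)) (1# + 1#))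
        (*-congʳ (*-congʳ (recip-! k)))

      scaled : ∀ k {x} y → Bounded (B k) x → Bounded (t k) (y + r k * x - y)
      scaled k {x} y (p , p′) =
        <-resp (solve 3 (λ r x y → x :* r := y :+ r :* x :- y) refl (r k) x y) (*-comm _ _)
          (*-monoˡ-<-pos (recip-pos (k !) {{ℕₚ._!≢0 k}}) p)
        , <-resp (solve 3 (λ r x y → :- x :* r := :- (y :+ r :* x :- y)) refl (r k) x y) (*-comm _ _)
          (*-monoˡ-<-pos (recip-pos (k !) {{ℕₚ._!≢0 k}}) p′)

    expSum-re-cauchy : Cauchy (λ n → re (expSum z n))
    expSum-re-cauchy = exponential⇒cauchy _ t (M ℕ.+ M) 0<t ratio
      (λ k → scaled k _ (proj₁ (pow-bound k)))

    expSum-im-cauchy : Cauchy (λ n → im (expSum z n))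
    expSum-im-cauchy = exponential⇒cauchy _ t (M ℕ.+ M) 0<t ratio
      (λ k → scaled k _ (proj₂ (pow-bound k)))

  exp : ℂ → ℂ
  exp z = proj₁ (complete _ (expSum-re-cauchy z)) +i proj₁ (complete _ (expSum-im-cauchy z))

  ∣z∣<1⇒1+z#0 : ∀ {z} → ∣ z ∣< 1# → (1ᶜ +ᶜ z) #ᶜ0
  ∣z∣<1⇒1+z#0 {z} (_ , p) = 0<x⇒x#0 (+-pos-nonneg (*-pos 0<1+re 0<1+re) (x²≮0 (0# + im z)))
    where
    re²<1 : re z * re z < 1#
    re²<1 with <-cotrans (<-respʳ-≈ (*-identityˡ 1#) p) (re z * re z)
    ... | inj₂ q = q
    ... | inj₁ q = ⊥-elim (x²≮0 (im z) (<-resp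
      (solve 2 (λ x y → x :+ y :+ :- x := y) refl (re z * re z) (im z * im z))
      (-‿inverseʳ _) (+-monoˡ-< (- (re z * re z)) q)))
    0<1+re = x²<1⇒0<1+x re²<1

  ∣z∣<1⇒1-z#0 : ∀ {z} → ∣ z ∣< 1# → (1ᶜ -ᶜ z) #ᶜ0
  ∣z∣<1⇒1-z#0 {z} (_ , p) = ∣z∣<1⇒1+z#0 { -ᶜ z} (0<1 , <-respˡ-≈
    (solve 2 (λ x y → x :* x :+ y :* y := :- x :* :- x :+ :- y :* :- y) refl (re z) (im z)) p)

  ∣z^n∣<1 : ∀ {z} → ∣ z ∣< 1# → ∀ n → .{{NonZero n}} → ∣ z ^ᶜ n ∣< 1#
  ∣z^n∣<1 {z} (_ , p) (suc n) = 0<1 , <-respʳ-≈ (sym (*-identityˡ 1#)) (go n)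
    where
    N = normSq z
    N<1 : N < 1#
    N<1 = <-respʳ-≈ (*-identityˡ 1#) p
    normSq-* : ∀ w → normSq (z *ᶜ w) ≈ N * normSq w
    normSq-* w = solve 4 (λ a b x y →
      (a :* x :- b :* y) :* (a :* x :- b :* y) :+ (a :* y :+ b :* x) :* (a :* y :+ b :* x)
      := (a :* a :+ b :* b) :* (x :* x :+ y :* y)) refl (re z) (im z) (re w) (im w)
    go : ∀ n → normSq (z ^ᶜ suc n) < 1#
    go zero = <-respˡ-≈ (sym (trans (normSq-* 1ᶜ) (trans
      (*-congˡ (trans (+-cong (*-identityˡ 1#) (zeroˡ 0#)) (+-identityʳ 1#))) (*-identityʳ N)))) N<1
    go (suc n) = <-respˡ-≈ (sym (normSq-* (z ^ᶜ suc n))) (0<y-x⇒x<y (<-respʳ-≈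
      (trans (+-congˡ (*-distribˡ-- N 1# W))
        (trans (+-congˡ (+-congʳ (*-identityʳ N)))
          (solve 3 (λ e N V → e :- N :+ (N :- V) := e :- V) refl 1# N (N * W))))
      (+-pos-nonneg (x<y⇒0<y-x N<1) (*-nonneg-pos
        (+-nonneg (x²≮0 (re z)) (x²≮0 (im z))) (x<y⇒0<y-x (go n))))))
      where
      W = normSq (z ^ᶜ suc n)
      *-distribˡ-- : ∀ x y z → x * (y - z) ≈ x * y - x * z
      *-distribˡ-- = solve 3 (λ x y z → x :* (y :- z) := x :* y :- x :* z) refl

  1+z^n#0 : ∀ {z} → ∣ z ∣< 1# → ∀ n → (1ᶜ +ᶜ z ^ᶜ n) #ᶜ0
  1+z^n#0 h zero    = 0<x⇒x#0 (+-pos-nonneg (*-pos (+-pos 0<1 0<1) (+-pos 0<1 0<1)) (x²≮0 _))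
  1+z^n#0 h (suc n) = ∣z∣<1⇒1+z#0 (∣z^n∣<1 h (suc n))

module QEuler {c ℓ₁ ℓ₂ : Level} (R : RealNumbers c ℓ₁ ℓ₂) where
  open RealNumbers R
  open OrderedField R
  open Complex R

  -- ∑ᵗ r N a sums a over all r-tuples of naturals below N.
  ∑ᵗ : ∀ r → ℕ → (Vec ℕ r → ℂ) → ℂ
  ∑ᵗ zero    N a = a []
  ∑ᵗ (suc r) N a = ∑< N λ m → ∑ᵗ r N λ ms → a (m ∷ ms)

  sign : ℕ → ℂ
  sign k = (-ᶜ 1ᶜ) ^ᶜ k

  -- A determination of the real powers of q: q^y = exp (y w) for a chosen
  -- logarithm w of q, or, for q = 0, 0^y = 0 for y > 0 only.
  data Branch : Set c where
    logarithm : ℂ → Branch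
    vanishing : Branch

  _isBranchOf_ : Branch → ℂ → Set ℓ₁
  logarithm w isBranchOf q = exp w ≈ᶜ q
  vanishing   isBranchOf q = q ≈ᶜ 0ᶜ

  pow : Branch → Carrier → ℂ
  pow (logarithm w) y = exp (y ∙ᶜ w)
  pow vanishing     y = 0ᶜ

  Admissible : Branch → Carrier → Set ℓ₂
  Admissible (logarithm w) y = ⊤
  Admissible vanishing     y = 0# < y

  -- The determination (q^f)^y = q^(f y) of the powers of q^f; the principal
  -- logarithm of q^f need not be compatible with that of q.
  branch^ : ℕ → Branch → Branch
  branch^ f (logarithm w) = logarithm (fromℕ f ∙ᶜ w)
  branch^ f vanishing     = vanishing

  -- Convergence of an r-fold series along the cubes m₁, …, m_r < N.
  HasSum : ∀ {r} → (Vec ℕ r → ℂ) → ℂ → Set (c ⊔ ℓ₂)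
  HasSum {r} a S = (λ N → ∑ᵗ r N a) ⟶ᶜ S

  -- S = lim_{s → 1⁻} ∑ s^(m₁ + ⋯ + m_r) a(m₁, …, m_r).
  HasAbelSum : ∀ {r} → (Vec ℕ r → ℂ) → ℂ → Set (c ⊔ ℓ₂)
  HasAbelSum a S = ∀ ε → 0# < ε → ∃ λ δ → 0# < δ ×
    (∀ s → 0# < s → s < 1# → 1# - δ < s →
      ∃ λ V → HasSum (λ m → (s ^ Vec.sum m) ∙ᶜ a m) V × ∣ V -ᶜ S ∣< ε)

  module _ (q : ℂ) (∣q∣<1 : ∣ q ∣< 1#) where
    1/[1-q] : ℂ
    1/[1-q] = (1ᶜ -ᶜ q) ⁻¹ᶜ[ ∣z∣<1⇒1-z#0 ∣q∣<1 ]

    1/[1+q^_] : ℕ → ℂ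
    1/[1+q^ k ] = (1ᶜ +ᶜ q ^ᶜ k) ⁻¹ᶜ[ 1+z^n#0 ∣q∣<1 k ]

    bracketℝ : Branch → Carrier → ℂ
    bracketℝ b y = (1ᶜ -ᶜ pow b y) *ᶜ 1/[1-q]

    bracketℕ : ℕ → ℂ
    bracketℕ k = (1ᶜ -ᶜ q ^ᶜ k) *ᶜ 1/[1-q]

    [2] 1/[2] : ℂ
    [2]   = 1ᶜ +ᶜ q
    1/[2] = (1ᶜ +ᶜ q) ⁻¹ᶜ[ ∣z∣<1⇒1+z#0 ∣q∣<1 ]

    -- E n x is the n-th q-Euler polynomial of order r at x. The generating
    -- function is an identity of formal power series in t, compared
    -- coefficientwise (expTerm u n is the coefficient of tⁿ in e^{ut}). The
    -- terms of its multiple series do not tend to 0, so the alternating sum is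
    -- taken in the sense of Abel.
    IsQEuler : Branch → ℕ → (ℕ → Carrier → ℂ) → Set (c ⊔ ℓ₁ ⊔ ℓ₂)
    IsQEuler b r E = ∀ x → Admissible b x → ∀ n → ∃ λ S →
      HasAbelSum {r} (λ m → sign (Vec.sum m) *ᶜ
        expTerm (bracketℝ b (fromℕ (Vec.sum m) + x)) n) S
      × [2] ^ᶜ r *ᶜ S ≈ᶜ (E n x /ᶜ (n !)) {{ℕₚ._!≢0 n}}

-- By the binomial theorem, the n-th coefficient of the generating function is a
-- combination over l ≤ n, with weights C(n,l) (-q^x)ˡ, of the r-fold series
-- ∑ (-qˡ)^(m₁ + ⋯ + m_r). Such a series is the r-th power of a geometric series,
-- so its Abel sum is (1 + qˡ)^(-r), and this determines E n x. As f is odd,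
-- (1 + z^f) / (1 + z) = ∑_{a < f} (-z)^a; taking z = qˡ turns (1 + qˡ)^(-r) into
-- the sum over a₁, …, a_r < f, which gives the second identity, and the first one
-- after collecting the powers of q^f. The rule q^(m + x) = q^m q^x rests on
-- exp (z + w) = exp z exp w.
module Submission where

open import Defs
open import Level using (Level; _⊔_) renaming (suc to lsuc)
open import Algebra.Bundles using (CommutativeRing)
open import Data.Empty using (⊥-elim)
open import Data.Fin.Base using (toℕ)
open import Data.Integer.Base using () renaming (+_ to pos)
open import Data.Nat.Base as ℕ using (ℕ; zero; suc; NonZero; _!) renaming (_*_ to _*ℕ_)
open import Data.Nat.Combinatorics using (_C_)
open import Data.Nat.Divisibility using (_∣0; ∣m∣n⇒∣m+n; ∣-refl)
import Data.Nat.Properties as ℕₚ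
open import Data.Product.Base using (Σ; ∃; _×_; _,_; proj₁; proj₂)
open import Data.Sum.Base using (inj₁; inj₂; [_,_]′)
open import Data.Vec.Base as Vec using (Vec; []; _∷_)
open import Relation.Binary.PropositionalEquality.Core as ≡ using (_≡_)
open import Relation.Nullary.Negation.Core using (¬_)

-- The weight l = 0 is the analytic obstacle: q^0 = 1 lies on the unit circle, and for r = 1 its
-- series is Grandi's 1 - 1 + 1 - .... Only after damping by s < 1 do all the numbers s q^l lie
-- inside the unit disc. Two limits therefore occur, along cubes and as s tends to 1 from the left,
-- and one calculus of limits along a filter serves both. `IsQEuler` is a relation asserting that
-- certain Abel sums exist. Uniqueness of limits pins its solutions to a closed form, and both
-- identities become algebra between closed forms. The exponential is known only as a limit supplied
-- by completeness. Its functional equation comes from Cauchy products: the triangular sums of the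
-- two series are exactly the partial sums at z + w, and the part of the square of terms outside the
-- triangle is controlled by a real exponential series at a natural number. The order is
-- constructive: case distinctions go through cotransitivity, equality of limits through tightness
-- of apartness, and a reciprocal carries a proof that its argument is apart from 0.

-- Finite sums, geometric sums and Cauchy products over a commutative ring

module FiniteSums {c ℓ : Level} (K : CommutativeRing c ℓ) where
  open CommutativeRing K
  open IntegerSolver K
  open import Algebra.Properties.Ring ring
  open import Algebra.Properties.Semiring.Exp semiring
  open import Algebra.Properties.CommutativeSemiring.Exp commutativeSemiring using (^-distrib-*)
  open import Algebra.Properties.Semiring.Mult semiring renaming (_×_ to _·_)
  open import Algebra.Properties.Semiring.Sum semiring
  import Algebra.Properties.CommutativeSemiring.Binomial commutativeSemiring as Binomial
  open import Relation.Binary.Reasoning.Setoid setoid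

  -- Peels off the first term, unlike `∑<`, to match the recursion of `sum` and the rows of
  -- `triangle`; `∑-last` gives access to the other end.
  ∑ : ℕ → (ℕ → Carrier) → Carrier
  ∑ zero    a = 0#
  ∑ (suc n) a = a 0 + ∑ n λ i → a (suc i)

  ∑≡sum : ∀ n a → ∑ n a ≡ sum {n} (λ i → a (toℕ i))
  ∑≡sum zero    a = ≡.refl
  ∑≡sum (suc n) a = ≡.cong (a 0 +_) (∑≡sum n λ i → a (suc i))

  ∑-cong : ∀ n {a b} → (∀ i → a i ≈ b i) → ∑ n a ≈ ∑ n b
  ∑-cong zero    a≈b = refl
  ∑-cong (suc n) a≈b = +-cong (a≈b 0) (∑-cong n λ i → a≈b (suc i))

  ∑-last : ∀ n a → ∑ (suc n) a ≈ ∑ n a + a n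
  ∑-last zero    a = +-comm (a 0) 0#
  ∑-last (suc n) a = trans (+-congˡ (∑-last n λ i → a (suc i))) (sym (+-assoc _ _ _))

  *-distribˡ-∑ : ∀ n x a → x * ∑ n a ≈ ∑ n (λ i → x * a i)
  *-distribˡ-∑ zero    x a = zeroʳ x
  *-distribˡ-∑ (suc n) x a = trans (distribˡ _ _ _) (+-congˡ (*-distribˡ-∑ n x _))

  *-distribʳ-∑ : ∀ n x a → ∑ n a * x ≈ ∑ n (λ i → a i * x)
  *-distribʳ-∑ n x a =
    trans (*-comm _ x) (trans (*-distribˡ-∑ n x a) (∑-cong n λ i → *-comm x (a i)))

  ∑-swap : ∀ m n (a : ℕ → ℕ → Carrier) → ∑ m (λ i → ∑ n (a i)) ≈ ∑ n (λ j → ∑ m λ i → a i j)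
  ∑-swap m n a = begin
    ∑ m (λ i → ∑ n (a i))
      ≈⟨ trans (∑-cong m λ i → reflexive (∑≡sum n (a i))) (reflexive (∑≡sum m _)) ⟩
    sum {m} (λ i → sum {n} λ j → a (toℕ i) (toℕ j))
      ≈⟨ ∑-comm {m} {n} (λ i j → a (toℕ i) (toℕ j)) ⟩
    sum {n} (λ j → sum {m} λ i → a (toℕ i) (toℕ j))
      ≈⟨ trans (∑-cong n λ j → reflexive (∑≡sum m λ i → a i j)) (reflexive (∑≡sum n _)) ⟨
    ∑ n (λ j → ∑ m λ i → a i j) ∎

  ∑-geometric : ∀ z n → (1# - z) * ∑ n (z ^_) ≈ 1# - z ^ n
  ∑-geometric z zero    = trans (zeroʳ _) (sym (-‿inverseʳ 1#))
  ∑-geometric z (suc n) = begin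
    (1# - z) * ∑ (suc n) (z ^_)             ≈⟨ *-congˡ (∑-last n _) ⟩
    (1# - z) * (∑ n (z ^_) + z ^ n)         ≈⟨ distribˡ _ _ _ ⟩
    (1# - z) * ∑ n (z ^_) + (1# - z) * z ^ n ≈⟨ +-cong (∑-geometric z n) ([y-z]x≈yx-zx _ _ _) ⟩
    1# - z ^ n + (1# * z ^ n - z * z ^ n)   ≈⟨ +-congˡ (+-congʳ (*-identityˡ _)) ⟩
    1# - z ^ n + (z ^ n - z * z ^ n)
      ≈⟨ solve 3 (λ e u v → e :- u :+ (u :- v) := e :- v) refl 1# (z ^ n) (z * z ^ n) ⟩
    1# - z * z ^ n                          ∎

  1^n≈1 : ∀ n → 1# ^ n ≈ 1#
  1^n≈1 zero    = refl
  1^n≈1 (suc n) = trans (*-identityˡ _) (1^n≈1 n)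

  ^-neg : ∀ x n → (- x) ^ n ≈ (- 1#) ^ n * x ^ n
  ^-neg x n = trans (^-congˡ n (sym (-1*x≈-x x))) (^-distrib-* (- 1#) x n)

  -1^odd : ∀ n → Odd n → (- 1#) ^ n ≈ - 1#
  -1^odd zero          odd = ⊥-elim (odd (2 ∣0))
  -1^odd (suc zero)    odd = *-identityʳ _
  -1^odd (suc (suc n)) odd = begin
    - 1# * (- 1# * (- 1#) ^ n) ≈⟨ *-congˡ (-1*x≈-x _) ⟩
    - 1# * - ((- 1#) ^ n)      ≈⟨ -1*x≈-x _ ⟩
    - - ((- 1#) ^ n)           ≈⟨ -‿involutive _ ⟩
    (- 1#) ^ n                 ≈⟨ -1^odd n (λ 2∣n → odd (∣m∣n⇒∣m+n ∣-refl 2∣n)) ⟩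
    - 1#                       ∎

  -- The geometric sum at `- z`: for odd n the sign of `(- z) ^ n` turns the minus in
  -- `1# - (- z) ^ n` into a plus.
  ∑-alternating : ∀ z n → Odd n → (1# + z) * ∑ n ((- z) ^_) ≈ 1# + z ^ n
  ∑-alternating z n odd = begin
    (1# + z) * ∑ n ((- z) ^_)   ≈⟨ *-congʳ (+-congˡ (-‿involutive z)) ⟨
    (1# - - z) * ∑ n ((- z) ^_) ≈⟨ ∑-geometric (- z) n ⟩
    1# - (- z) ^ n              ≈⟨ +-congˡ (-‿cong (trans (^-neg z n) (*-congʳ (-1^odd n odd)))) ⟩
    1# - - 1# * z ^ n           ≈⟨ +-congˡ (-‿cong (-1*x≈-x _)) ⟩
    1# - - (z ^ n)              ≈⟨ +-congˡ (-‿involutive _) ⟩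
    1# + z ^ n                  ∎

  binomial-1+ : ∀ x n → (1# + x) ^ n ≈ ∑ (suc n) (λ l → ((n C l) · 1#) * x ^ l)
  binomial-1+ x n = trans (^-congˡ n (+-comm 1# x)) (trans (Binomial.theorem n x 1#)
    (trans (sum-cong-≋ {suc n} λ l → begin
      (n C toℕ l) · (x ^ toℕ l * 1# ^ (n ℕ.∸ toℕ l)) ≈⟨ ×-congʳ (n C toℕ l) (*-congˡ (1^n≈1 (n ℕ.∸ toℕ l))) ⟩
      (n C toℕ l) · (x ^ toℕ l * 1#)   ≈⟨ ×-congʳ (n C toℕ l) (*-comm _ _) ⟩
      (n C toℕ l) · (1# * x ^ toℕ l)   ≈⟨ ×-assoc-* (n C toℕ l) _ _ ⟨
      ((n C toℕ l) · 1#) * x ^ toℕ l   ∎)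
    (sym (reflexive (∑≡sum (suc n) λ l → ((n C l) · 1#) * x ^ l)))))

  ∑ʳ : ∀ r → ℕ → (Vec ℕ r → Carrier) → Carrier
  ∑ʳ zero    N a = a []
  ∑ʳ (suc r) N a = ∑ N λ m → ∑ʳ r N λ ms → a (m ∷ ms)

  ∑ʳ-cong : ∀ r N {a b} → (∀ m → a m ≈ b m) → ∑ʳ r N a ≈ ∑ʳ r N b
  ∑ʳ-cong zero    N a≈b = a≈b []
  ∑ʳ-cong (suc r) N a≈b = ∑-cong N λ m → ∑ʳ-cong r N λ ms → a≈b (m ∷ ms)

  *-distribˡ-∑ʳ : ∀ r N x a → x * ∑ʳ r N a ≈ ∑ʳ r N (λ m → x * a m)
  *-distribˡ-∑ʳ zero    N x a = refl
  *-distribˡ-∑ʳ (suc r) N x a =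
    trans (*-distribˡ-∑ N x _) (∑-cong N λ m → *-distribˡ-∑ʳ r N x _)

  ∑ʳ-swap : ∀ r N n (a : ℕ → Vec ℕ r → Carrier) →
    ∑ʳ r N (λ m → ∑ n λ l → a l m) ≈ ∑ n (λ l → ∑ʳ r N (a l))
  ∑ʳ-swap zero    N n a = refl
  ∑ʳ-swap (suc r) N n a =
    trans (∑-cong N λ m → ∑ʳ-swap r N n λ l ms → a l (m ∷ ms)) (∑-swap N n _)

  -- The exponent is additive in the coordinates, so the sum over a cube factors into r equal
  -- geometric sums.
  ∑ʳ-power : ∀ r N z → ∑ʳ r N (λ m → z ^ Vec.sum m) ≈ ∑ N (z ^_) ^ r
  ∑ʳ-power zero    N z = refl
  ∑ʳ-power (suc r) N z = begin
    ∑ N (λ m → ∑ʳ r N λ ms → z ^ (m ℕ.+ Vec.sum ms))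
      ≈⟨ ∑-cong N (λ m → ∑ʳ-cong r N λ ms → ^-homo-* z m (Vec.sum ms)) ⟩
    ∑ N (λ m → ∑ʳ r N λ ms → z ^ m * z ^ Vec.sum ms)
      ≈⟨ ∑-cong N (λ m → *-distribˡ-∑ʳ r N (z ^ m) _) ⟨
    ∑ N (λ m → z ^ m * ∑ʳ r N (λ ms → z ^ Vec.sum ms))
      ≈⟨ *-distribʳ-∑ N _ _ ⟨
    ∑ N (z ^_) * ∑ʳ r N (λ ms → z ^ Vec.sum ms)
      ≈⟨ *-congˡ (∑ʳ-power r N z) ⟩
    ∑ N (z ^_) * ∑ N (z ^_) ^ r ∎

  ∑ʳ-powers : ∀ r N n (c z : ℕ → Carrier) →
    ∑ʳ r N (λ m → ∑ n λ l → c l * z l ^ Vec.sum m) ≈ ∑ n (λ l → c l * ∑ N (z l ^_) ^ r)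
  ∑ʳ-powers r N n c z = trans (∑ʳ-swap r N n _) (∑-cong n λ l →
    trans (sym (*-distribˡ-∑ʳ r N (c l) _)) (*-congˡ (∑ʳ-power r N (z l))))

  -- The k-th coefficient of the Cauchy product of two series.
  conv : (a b : ℕ → Carrier) → ℕ → Carrier
  conv a b zero    = a 0 * b 0
  conv a b (suc k) = a 0 * b (suc k) + conv (λ i → a (suc i)) b k

  conv-cong : ∀ {a a′ b b′} → (∀ i → a i ≈ a′ i) → (∀ i → b i ≈ b′ i) →
    ∀ k → conv a b k ≈ conv a′ b′ k
  conv-cong p q zero    = *-cong (p 0) (q 0)
  conv-cong p q (suc k) = +-cong (*-cong (p 0) (q (suc k))) (conv-cong (λ i → p (suc i)) q k)

  conv-last : ∀ a b k → conv a b (suc k) ≈ conv a (λ j → b (suc j)) k + a (suc k) * b 0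
  conv-last a b zero    = refl
  conv-last a b (suc k) =
    trans (+-congˡ (conv-last (λ i → a (suc i)) b k)) (sym (+-assoc _ _ _))

  conv-scaleˡ : ∀ x a b k → conv (λ i → x * a i) b k ≈ x * conv a b k
  conv-scaleˡ x a b zero    = *-assoc _ _ _
  conv-scaleˡ x a b (suc k) = trans (+-cong (*-assoc _ _ _) (conv-scaleˡ x _ b k)) (sym (distribˡ _ _ _))

  conv-scaleʳ : ∀ x a b k → conv a (λ i → x * b i) k ≈ x * conv a b k
  conv-scaleʳ x a b zero    = solve 3 (λ x a b → a :* (x :* b) := x :* (a :* b)) refl x (a 0) (b 0)
  conv-scaleʳ x a b (suc k) = trans
    (+-cong (solve 3 (λ x a b → a :* (x :* b) := x :* (a :* b)) refl x (a 0) (b (suc k))) (conv-scaleʳ x _ b k))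
    (sym (distribˡ _ _ _))

  conv-addˡ : ∀ a a′ b k → conv (λ i → a i + a′ i) b k ≈ conv a b k + conv a′ b k
  conv-addˡ a a′ b zero    = distribʳ _ _ _
  conv-addˡ a a′ b (suc k) = trans (+-cong (distribʳ _ _ _) (conv-addˡ _ _ b k))
    (solve 4 (λ w x y z → (w :+ x) :+ (y :+ z) := (w :+ y) :+ (x :+ z)) refl
      (a 0 * b (suc k)) (a′ 0 * b (suc k)) (conv (λ i → a (suc i)) b k) (conv (λ i → a′ (suc i)) b k))

  private
    N : ℕ → Carrier
    N n = n · 1#

  -- On the terms with i + j = k the factor k splits as i + j; this is the product rule for t d/dt
  -- on power series.
  conv-leibniz : ∀ a b k →
    N k * conv a b k ≈ conv (λ i → N i * a i) b k + conv a (λ j → N j * b j) k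
  conv-leibniz a b zero    = solve 2
    (λ a b → con (pos 0) :* (a :* b) := con (pos 0) :* a :* b :+ a :* (con (pos 0) :* b)) refl (a 0) (b 0)
  conv-leibniz a b (suc k) = begin
    (1# + N k) * (x * y + t)
      ≈⟨ *-distrib-suc ⟩
    (1# + N k) * (x * y) + t + N k * t
      ≈⟨ +-congˡ (conv-leibniz a′ b k) ⟩
    (1# + N k) * (x * y) + t + (u + v)
      ≈⟨ solve 6 (λ n x y t u v → n :* (x :* y) :+ t :+ (u :+ v) :=
           con (pos 0) :* x :* y :+ (t :+ u) :+ (x :* (n :* y) :+ v)) refl (1# + N k) x y t u v ⟩
    0# * x * y + (t + u) + (x * ((1# + N k) * y) + v)
      ≈⟨ +-congʳ (+-congˡ (trans (conv-cong (λ i → trans (distribʳ (a′ i) 1# (N i)) (+-congʳ (*-identityˡ _)))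
           (λ _ → refl) k) (conv-addˡ a′ _ b k))) ⟨
    0# * x * y + conv (λ i → N (suc i) * a′ i) b k + (x * ((1# + N k) * y) + v) ∎
    where
    a′ : ℕ → Carrier
    a′ i = a (suc i)
    x = a 0
    y = b (suc k)
    t = conv a′ b k
    u = conv (λ i → N i * a′ i) b k
    v = conv a′ (λ j → N j * b j) k
    *-distrib-suc : (1# + N k) * (x * y + t) ≈ (1# + N k) * (x * y) + t + N k * t
    *-distrib-suc = trans (distribˡ _ _ _) (trans (+-congˡ (trans (distribʳ t 1# (N k)) (+-congʳ (*-identityˡ t))))
      (sym (+-assoc _ _ _)))

  -- The sum of a i · b j over i + j < n, arranged by rows.
  triangle : (a b : ℕ → Carrier) → ℕ → Carrier
  triangle a b zero    = 0#
  triangle a b (suc n) = a 0 * ∑ (suc n) b + triangle (λ i → a (suc i)) b n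

  -- The terms gained in passing from i + j < n to i + j < suc n are those on the antidiagonal i + j
  -- = n.
  triangle-suc : ∀ a b n → triangle a b (suc n) ≈ triangle a b n + conv a b n
  triangle-suc a b zero    = solve 2 (λ a b → a :* (b :+ con (pos 0)) :+ con (pos 0) := con (pos 0) :+ a :* b)
    refl (a 0) (b 0)
  triangle-suc a b (suc n) = trans
    (+-cong (*-congˡ (∑-last (suc n) b)) (triangle-suc (λ i → a (suc i)) b n))
    (solve 5 (λ x s y t u → x :* (s :+ y) :+ (t :+ u) := x :* s :+ t :+ (x :* y :+ u)) refl
      (a 0) (∑ (suc n) b) (b (suc n)) (triangle (λ i → a (suc i)) b n) (conv (λ i → a (suc i)) b n))

  triangle≈∑conv : ∀ a b n → triangle a b n ≈ ∑ n (conv a b)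
  triangle≈∑conv a b zero    = refl
  triangle≈∑conv a b (suc n) = trans (triangle-suc a b n)
    (trans (+-congʳ (triangle≈∑conv a b n)) (sym (∑-last n _)))

  -- Splits off the row i = 0, of which the triangle takes the first suc n terms; the rest has the
  -- same shape, with one row fewer and the same number m of columns.
  rectangle-triangle-suc : ∀ a b n m →
    ∑ (suc n) a * ∑ m b - triangle a b (suc n) ≈
    a 0 * (∑ m b - ∑ (suc n) b) + (∑ n (λ i → a (suc i)) * ∑ m b - triangle (λ i → a (suc i)) b n)
  rectangle-triangle-suc a b n m = solve 5
    (λ x y s s′ t → (x :+ y) :* s :- (x :* s′ :+ t) := x :* (s :- s′) :+ (y :* s :- t)) refl
    (a 0) (∑ n λ i → a (suc i)) (∑ m b) (∑ (suc n) b) (triangle (λ i → a (suc i)) b n)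

  -- Sequences of the shape k ↦ zᵏ / k!.
  record ExponentialOf (z : Carrier) (a : ℕ → Carrier) : Set ℓ where
    field
      head : a 0 ≈ 1#
      step : ∀ k → N (suc k) * a (suc k) ≈ z * a k

  -- Division by positive integers is a parameter, since an arbitrary commutative ring does not
  -- provide it; the recursion in `ExponentialOf` determines a sequence only when such division is
  -- possible.
  module _ (inv : ℕ → Carrier) (inv-inverse : ∀ k → N (suc k) * inv k ≈ 1#) where

    -- The derivation a k ↦ k · a k turns conv into a sequence satisfying the
    -- recursion of (z + w)ᵏ / k!.
    conv-exponential : ∀ {z w a b d} → ExponentialOf z a → ExponentialOf w b →
      ExponentialOf (z + w) d → ∀ k → conv a b k ≈ d k
    conv-exponential {z} {w} {a} {b} {d} A B D = go
      where
      module A = ExponentialOf A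
      module B = ExponentialOf B
      module D = ExponentialOf D
      scaled : ∀ k → N (suc k) * conv a b (suc k) ≈ (z + w) * conv a b k
      scaled k = begin
        N (suc k) * conv a b (suc k)
          ≈⟨ conv-leibniz a b (suc k) ⟩
        0# * a 0 * b (suc k) + conv (λ i → N (suc i) * a (suc i)) b k + conv a (λ j → N j * b j) (suc k)
          -- The terms with i = 0 and with j = 0 carry the factor 0, so all others have a positive
          -- index to which the recursion of a or of b applies.
          ≈⟨ +-congˡ (conv-last a _ k) ⟩
        0# * a 0 * b (suc k) + conv (λ i → N (suc i) * a (suc i)) b k +
          (conv a (λ j → N (suc j) * b (suc j)) k + a (suc k) * (0# * b 0))
          ≈⟨ +-cong (+-congˡ (trans (conv-cong A.step (λ _ → refl) k) (conv-scaleˡ z a b k)))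
               (+-congʳ (trans (conv-cong (λ _ → refl) B.step k) (conv-scaleʳ w a b k))) ⟩
        0# * a 0 * b (suc k) + z * t + (w * t + a (suc k) * (0# * b 0))
          ≈⟨ solve 7 (λ p q r s z w t → con (pos 0) :* p :* q :+ z :* t :+ (w :* t :+ r :* (con (pos 0) :* s))
               := (z :+ w) :* t) refl (a 0) (b (suc k)) (a (suc k)) (b 0) z w t ⟩
        (z + w) * t ∎
        where t = conv a b k
      cancel : ∀ k {x y} → N (suc k) * x ≈ N (suc k) * y → x ≈ y
      cancel k {x} {y} e = trans (expand x) (trans (*-congˡ e) (sym (expand y)))
        where
        expand : ∀ x → x ≈ inv k * (N (suc k) * x)
        expand x = begin
          x                        ≈⟨ *-identityˡ x ⟨
          1# * x                   ≈⟨ *-congʳ (inv-inverse k) ⟨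
          N (suc k) * inv k * x    ≈⟨ *-congʳ (*-comm _ _) ⟩
          inv k * N (suc k) * x    ≈⟨ *-assoc _ _ _ ⟩
          inv k * (N (suc k) * x)  ∎
      go : ∀ k → conv a b k ≈ d k
      go zero    = trans (*-cong A.head B.head) (trans (*-identityˡ 1#) (sym D.head))
      go (suc k) = cancel k (trans (scaled k) (trans (*-congˡ (go k)) (sym (D.step k))))

    triangle-exponential : ∀ {z w a b d} → ExponentialOf z a → ExponentialOf w b →
      ExponentialOf (z + w) d → ∀ n → triangle a b n ≈ ∑ n d
    triangle-exponential A B D n =
      trans (triangle≈∑conv _ _ n) (∑-cong n (conv-exponential A B D))

-- Algebra of the closed form

module QAlgebra {c ℓ : Level} (K : CommutativeRing c ℓ) where
  open CommutativeRing K
  open IntegerSolver K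
  open FiniteSums K
  open import Algebra.Properties.Ring ring
  open import Algebra.Properties.Semiring.Exp semiring
  open import Algebra.Properties.CommutativeSemiring.Exp commutativeSemiring using (^-distrib-*)
  open import Algebra.Properties.Semiring.Mult semiring renaming (_×_ to _·_)
  open import Relation.Binary.Reasoning.Setoid setoid

  inverse-unique : ∀ {x y u v} → x ≈ y → x * u ≈ 1# → y * v ≈ 1# → u ≈ v
  inverse-unique {x} {y} {u} {v} x≈y xu≈1 yv≈1 = begin
    u            ≈⟨ *-identityʳ u ⟨
    u * 1#       ≈⟨ *-congˡ yv≈1 ⟨
    u * (y * v)  ≈⟨ *-congˡ (*-congʳ x≈y) ⟨
    u * (x * v)  ≈⟨ solve 3 (λ x u v → u :* (x :* v) := (x :* u) :* v) refl x u v ⟩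
    (x * u) * v  ≈⟨ *-congʳ xu≈1 ⟩
    1# * v       ≈⟨ *-identityˡ v ⟩
    v            ∎

  ∑-geometric-inverse : ∀ {x v} → (1# + x) * v ≈ 1# → ∀ n → v * (1# - (- x) ^ n) ≈ ∑ n ((- x) ^_)
  ∑-geometric-inverse {x} {v} inv n = begin
    v * (1# - (- x) ^ n)               ≈⟨ *-congˡ (∑-geometric (- x) n) ⟨
    v * ((1# - - x) * ∑ n ((- x) ^_))  ≈⟨ *-congˡ (*-congʳ (+-congˡ (-‿involutive x))) ⟩
    v * ((1# + x) * ∑ n ((- x) ^_))
      ≈⟨ solve 3 (λ v y s → v :* (y :* s) := (y :* v) :* s) refl v (1# + x) (∑ n ((- x) ^_)) ⟩
    ((1# + x) * v) * ∑ n ((- x) ^_)    ≈⟨ *-congʳ inv ⟩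
    1# * ∑ n ((- x) ^_)                ≈⟨ *-identityˡ _ ⟩
    ∑ n ((- x) ^_)                     ∎

  ^-*-swap : ∀ x k l → (x ^ k) ^ l ≈ x ^ (l ℕ.* k)
  ^-*-swap x k l = trans (^-assocʳ x k l) (^-congʳ x (ℕₚ.*-comm k l))

  -- 𝐜 n p l = C(n,l) (-p)ˡ, for p = q^x.
  𝐜 : ℕ → Carrier → ℕ → Carrier
  𝐜 n p l = ((n C l) · 1#) * (- p) ^ l

  𝐜-scale : ∀ n y p l → 𝐜 n (y * p) l ≈ y ^ l * 𝐜 n p l
  𝐜-scale n y p l = begin
    N * (- (y * p)) ^ l      ≈⟨ *-congˡ (^-congˡ l (-‿distribʳ-* y p)) ⟩
    N * (y * - p) ^ l        ≈⟨ *-congˡ (^-distrib-* y (- p) l) ⟩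
    N * (y ^ l * (- p) ^ l)  ≈⟨ solve 3 (λ n y p → n :* (y :* p) := y :* (n :* p)) refl N (y ^ l) ((- p) ^ l) ⟩
    y ^ l * (N * (- p) ^ l)  ∎
    where
    N : Carrier
    N = (n C l) · 1#

  -- After the binomial expansion, (q^k)^l is read as (q^l)^k and absorbs the sign (-1)^k. As a
  -- function of k the term is then a combination of pure powers, which is the shape that sums to
  -- geometric series.
  alternating-bracket : ∀ ρ i q p n k → (- 1#) ^ k * (ρ * ((1# - q ^ k * p) * i) ^ n) ≈
    ∑ (suc n) (λ l → (ρ * i ^ n * 𝐜 n p l) * (- (q ^ l)) ^ k)
  alternating-bracket ρ i q p n k = begin
    s * (ρ * ((1# - y * p) * i) ^ n)
      ≈⟨ *-congˡ (*-congˡ (trans (^-distrib-* _ i n) (*-congʳ (binomial-1+ (- (y * p)) n)))) ⟩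
    s * (ρ * (∑ (suc n) (𝐜 n (y * p)) * i ^ n))
      ≈⟨ solve 4 (λ s ρ t j → s :* (ρ :* (t :* j)) := (s :* (ρ :* j)) :* t) refl s ρ _ (i ^ n) ⟩
    (s * (ρ * i ^ n)) * ∑ (suc n) (𝐜 n (y * p))
      ≈⟨ *-distribˡ-∑ (suc n) _ (𝐜 n (y * p)) ⟩
    ∑ (suc n) (λ l → (s * (ρ * i ^ n)) * 𝐜 n (y * p) l)
      ≈⟨ ∑-cong (suc n) (λ l → begin
           (s * (ρ * i ^ n)) * 𝐜 n (y * p) l      ≈⟨ *-congˡ (𝐜-scale n y p l) ⟩
           (s * (ρ * i ^ n)) * (y ^ l * 𝐜 n p l)
             ≈⟨ solve 4 (λ s j y e → (s :* j) :* (y :* e) := (j :* e) :* (s :* y)) refl s (ρ * i ^ n) (y ^ l) (𝐜 n p l) ⟩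
           (ρ * i ^ n * 𝐜 n p l) * (s * y ^ l)
             ≈⟨ *-congˡ (*-congˡ (trans (^-*-swap q k l) (sym (^-assocʳ q l k)))) ⟩
           (ρ * i ^ n * 𝐜 n p l) * (s * (q ^ l) ^ k)
             ≈⟨ *-congˡ (^-neg (q ^ l) k) ⟨
           (ρ * i ^ n * 𝐜 n p l) * (- (q ^ l)) ^ k ∎) ⟩
    ∑ (suc n) (λ l → (ρ * i ^ n * 𝐜 n p l) * (- (q ^ l)) ^ k) ∎
    where
    s y : Carrier
    s = (- 1#) ^ k
    y = q ^ k

  -- The closed form of the q-Euler polynomials: b = [2]_q, i = 1 / (1 - q),
  -- p = q^x and v l = 1 / (1 + qˡ).
  closedForm : (b i p : Carrier) (v : ℕ → Carrier) (r n : ℕ) → Carrier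
  closedForm b i p v r n = b ^ r * (i ^ n * ∑ (suc n) (λ l → 𝐜 n p l * v l ^ r))

  closedForm-congᵖ : ∀ b i {p p′} v r n → p ≈ p′ → closedForm b i p v r n ≈ closedForm b i p′ v r n
  closedForm-congᵖ b i v r n p≈p′ = *-congˡ (*-congˡ (∑-cong (suc n)
    {λ l → 𝐜 n _ l * v l ^ r} {λ l → 𝐜 n _ l * v l ^ r} λ l →
    *-congʳ (*-congˡ (^-congˡ l (-‿cong p≈p′)))))

  closedForm-scaled : ∀ ρ b i p v r n →
    b ^ r * ∑ (suc n) (λ l → (ρ * i ^ n * 𝐜 n p l) * v l ^ r) ≈ ρ * closedForm b i p v r n
  closedForm-scaled ρ b i p v r n = begin
    b ^ r * ∑ (suc n) (λ l → (ρ * i ^ n * 𝐜 n p l) * v l ^ r)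
      ≈⟨ *-congˡ (∑-cong (suc n) λ l → *-assoc (ρ * i ^ n) (𝐜 n p l) (v l ^ r)) ⟩
    b ^ r * ∑ (suc n) (λ l → (ρ * i ^ n) * (𝐜 n p l * v l ^ r))
      ≈⟨ *-congˡ (*-distribˡ-∑ (suc n) (ρ * i ^ n) λ l → 𝐜 n p l * v l ^ r) ⟨
    b ^ r * ((ρ * i ^ n) * ∑ (suc n) (λ l → 𝐜 n p l * v l ^ r))
      ≈⟨ solve 4 (λ b ρ j t → b :* ((ρ :* j) :* t) := ρ :* (b :* (j :* t))) refl (b ^ r) ρ (i ^ n) _ ⟩
    ρ * closedForm b i p v r n ∎

  -- 1 / (1 + qˡ) is the alternating geometric sum over 1 + q^{lf}, as f is odd.
  distribute : ∀ {q f l v w} → Odd f → (1# + q ^ l) * v ≈ 1# → (1# + q ^ (l ℕ.* f)) * w ≈ 1# → ∀ r →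
    v ^ r ≈ ∑ʳ r f (λ a → (- 1#) ^ Vec.sum a * q ^ (l ℕ.* Vec.sum a) * w ^ r)
  distribute {q} {f} {l} {v} {w} odd invˡ invˡᶠ r = begin
    v ^ r                                       ≈⟨ ^-congˡ r v≈wg ⟩
    (w * g) ^ r                                 ≈⟨ ^-distrib-* w g r ⟩
    w ^ r * g ^ r                               ≈⟨ *-congˡ (∑ʳ-power r f _) ⟨
    w ^ r * ∑ʳ r f (λ a → (- (q ^ l)) ^ Vec.sum a)  ≈⟨ *-distribˡ-∑ʳ r f _ _ ⟩
    ∑ʳ r f (λ a → w ^ r * (- (q ^ l)) ^ Vec.sum a)
      ≈⟨ ∑ʳ-cong r f (λ a → trans (*-comm _ _) (*-congʳ
           (trans (^-neg (q ^ l) (Vec.sum a)) (*-congˡ (^-assocʳ q l (Vec.sum a)))))) ⟩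
    ∑ʳ r f (λ a → (- 1#) ^ Vec.sum a * q ^ (l ℕ.* Vec.sum a) * w ^ r) ∎
    where
    g : Carrier
    g = ∑ f ((- (q ^ l)) ^_)
    v≈wg : v ≈ w * g
    v≈wg = inverse-unique refl invˡ (begin
      (1# + q ^ l) * (w * g)        ≈⟨ solve 3 (λ y w g → y :* (w :* g) := (y :* g) :* w) refl (1# + q ^ l) w g ⟩
      ((1# + q ^ l) * g) * w        ≈⟨ *-congʳ (∑-alternating (q ^ l) f odd) ⟩
      (1# + (q ^ l) ^ f) * w        ≈⟨ *-congʳ (+-congˡ (^-assocʳ q l f)) ⟩
      (1# + q ^ (l ℕ.* f)) * w      ≈⟨ invˡᶠ ⟩
      1#                            ∎)

  closedForm-distribute : ∀ {q f} b i p (v w : ℕ → Carrier) r n → Odd f →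
    (∀ l → (1# + q ^ l) * v l ≈ 1#) → (∀ l → (1# + q ^ (l ℕ.* f)) * w l ≈ 1#) →
    closedForm b i p v r n ≈ b ^ r * i ^ n *
      ∑ (suc n) (λ l → 𝐜 n p l * ∑ʳ r f (λ a → (- 1#) ^ Vec.sum a * q ^ (l ℕ.* Vec.sum a) * w l ^ r))
  closedForm-distribute {q} {f} b i p v w r n odd inv inv′ = trans (sym (*-assoc (b ^ r) (i ^ n) _))
    (*-congˡ (∑-cong (suc n) λ l → *-congˡ {x = 𝐜 n p l} (distribute {q} {f} {l} odd (inv l) (inv′ l) r)))

  -- Replacing p by q^k p multiplies the weight `𝐜 n p l` by q^(l k), and exchanging the sums over a
  -- and l gives the right side. In the prefactor, [2]_{q^f} cancels, and [f]_q / (1 - q^f) is 1 /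
  -- (1 - q).
  closedForm-multiplication : ∀ {q f b i bᶠ 1/bᶠ iᶠ} p (v w : ℕ → Carrier) r n →
    bᶠ * 1/bᶠ ≈ 1# → (1# - q ^ f) * iᶠ ≈ 1# →
    (∀ l → (1# + (q ^ f) ^ l) * v l ≈ 1#) → (∀ l → (1# + q ^ (l ℕ.* f)) * w l ≈ 1#) →
    (b * 1/bᶠ) ^ r * ((1# - q ^ f) * i) ^ n *
      ∑ʳ r f (λ a → (- 1#) ^ Vec.sum a * closedForm bᶠ iᶠ (q ^ Vec.sum a * p) v r n) ≈
    b ^ r * i ^ n *
      ∑ (suc n) (λ l → 𝐜 n p l * ∑ʳ r f (λ a → (- 1#) ^ Vec.sum a * q ^ (l ℕ.* Vec.sum a) * w l ^ r))
  closedForm-multiplication {q} {f} {b} {i} {bᶠ} {1/bᶠ} {iᶠ} p v w r n b-inv i-inv v-inv w-inv = begin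
    h * ∑ʳ r f (λ a → s a * (bᶠ ^ r * (iᶠ ^ n * X a)))
      ≈⟨ *-congˡ (∑ʳ-cong r f λ a →
           solve 4 (λ s b i x → s :* (b :* (i :* x)) := (b :* i) :* (s :* x)) refl (s a) (bᶠ ^ r) (iᶠ ^ n) (X a)) ⟩
    h * ∑ʳ r f (λ a → (bᶠ ^ r * iᶠ ^ n) * (s a * X a))
      ≈⟨ *-congˡ (*-distribˡ-∑ʳ r f _ _) ⟨
    h * ((bᶠ ^ r * iᶠ ^ n) * ∑ʳ r f (λ a → s a * X a))
      ≈⟨ trans (sym (*-assoc h _ _)) (*-congʳ cancel) ⟩
    b ^ r * i ^ n * ∑ʳ r f (λ a → s a * X a)
      ≈⟨ *-congˡ (∑ʳ-cong r f λ a → trans (*-distribˡ-∑ (suc n) (s a) λ l → 𝐜 n (q ^ Vec.sum a * p) l * v l ^ r)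
           (∑-cong (suc n) {a = λ l → s a * (𝐜 n (q ^ Vec.sum a * p) l * v l ^ r)} (λ l → term l a))) ⟩
    b ^ r * i ^ n * ∑ʳ r f (λ a → ∑ (suc n) λ l → 𝐜 n p l * (s a * q ^ (l ℕ.* Vec.sum a) * w l ^ r))
      ≈⟨ *-congˡ (∑ʳ-swap r f (suc n) λ l a → 𝐜 n p l * (s a * q ^ (l ℕ.* Vec.sum a) * w l ^ r)) ⟩
    b ^ r * i ^ n * ∑ (suc n) (λ l → ∑ʳ r f λ a → 𝐜 n p l * (s a * q ^ (l ℕ.* Vec.sum a) * w l ^ r))
      ≈⟨ *-congˡ (∑-cong (suc n) λ l → *-distribˡ-∑ʳ r f (𝐜 n p l) λ a → s a * q ^ (l ℕ.* Vec.sum a) * w l ^ r) ⟨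
    b ^ r * i ^ n * ∑ (suc n) (λ l → 𝐜 n p l * ∑ʳ r f (λ a → s a * q ^ (l ℕ.* Vec.sum a) * w l ^ r)) ∎
    where
    h : Carrier
    h = (b * 1/bᶠ) ^ r * ((1# - q ^ f) * i) ^ n
    s : Vec ℕ r → Carrier
    s a = (- 1#) ^ Vec.sum a
    X : Vec ℕ r → Carrier
    X a = ∑ (suc n) λ l → 𝐜 n (q ^ Vec.sum a * p) l * v l ^ r
    cancel : h * (bᶠ ^ r * iᶠ ^ n) ≈ b ^ r * i ^ n
    cancel = begin
      (b * 1/bᶠ) ^ r * ((1# - q ^ f) * i) ^ n * (bᶠ ^ r * iᶠ ^ n)
        ≈⟨ solve 4 (λ x y z u → x :* y :* (z :* u) := (x :* z) :* (y :* u)) refl _ _ (bᶠ ^ r) (iᶠ ^ n) ⟩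
      ((b * 1/bᶠ) ^ r * bᶠ ^ r) * (((1# - q ^ f) * i) ^ n * iᶠ ^ n)
        ≈⟨ *-cong (^-distrib-* _ bᶠ r) (^-distrib-* _ iᶠ n) ⟨
      (b * 1/bᶠ * bᶠ) ^ r * ((1# - q ^ f) * i * iᶠ) ^ n
        ≈⟨ *-cong (^-congˡ r (trans (*-assoc b _ _) (trans (*-congˡ (trans (*-comm _ _) b-inv)) (*-identityʳ b))))
             (^-congˡ n (trans (solve 3 (λ y i j → y :* i :* j := i :* (y :* j)) refl (1# - q ^ f) i iᶠ)
               (trans (*-congˡ i-inv) (*-identityʳ i)))) ⟩
      b ^ r * i ^ n ∎
    term : ∀ l a → s a * (𝐜 n (q ^ Vec.sum a * p) l * v l ^ r) ≈ 𝐜 n p l * (s a * q ^ (l ℕ.* Vec.sum a) * w l ^ r)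
    term l a = begin
      s a * (𝐜 n (q ^ k * p) l * v l ^ r)
        -- `v l` and `w l` invert 1 + (q^f)^l and 1 + q^(l f); these denominators agree up to `≈`,
        -- hence so do the inverses.
        ≈⟨ *-congˡ (*-cong (trans (𝐜-scale n (q ^ k) p l) (*-congʳ (^-*-swap q k l)))
             (^-congˡ r (inverse-unique (+-congˡ (^-*-swap q f l)) (v-inv l) (w-inv l)))) ⟩
      s a * (q ^ (l ℕ.* k) * 𝐜 n p l * w l ^ r)
        ≈⟨ solve 4 (λ s y e w → s :* (y :* e :* w) := e :* (s :* y :* w)) refl (s a) (q ^ (l ℕ.* k)) (𝐜 n p l) (w l ^ r) ⟩
      𝐜 n p l * (s a * q ^ (l ℕ.* k) * w l ^ r) ∎
      where
      k : ℕ
      k = Vec.sum a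

-- Nonstrict bounds and the decay of powers

module Estimates {c ℓ₁ ℓ₂ : Level} (R : RealNumbers c ℓ₁ ℓ₂) where
  open RealNumbers R
  open OrderedField R
  open import Relation.Binary.Reasoning.Setoid (CommutativeRing.setoid commutativeRing)

  infix 4 0≤_
  -- A negation rather than a disjunction of `<` and `≈`, which could not be decided constructively.
  0≤_ : Carrier → Set ℓ₂
  0≤ x = ¬ (x < 0#)

  0≤-resp : ∀ {x y} → x ≈ y → 0≤ x → 0≤ y
  0≤-resp x≈y 0≤x y<0 = 0≤x (<-respˡ-≈ (sym x≈y) y<0)

  0≤0 : 0≤ 0#
  0≤0 = <-irrefl refl

  0<⇒0≤ : ∀ {x} → 0# < x → 0≤ x
  0<⇒0≤ 0<x x<0 = <-irrefl refl (<-trans 0<x x<0)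

  -- A negative product is invertible, hence so is x, which thereby acquires a sign: x < 0 is
  -- excluded, and a positive x can be cancelled.
  0≤-* : ∀ {x y} → 0≤ x → 0≤ y → 0≤ (x * y)
  0≤-* {x} {y} 0≤x 0≤y xy<0 with #⇒<⊎> (unitˡ⇒#0 {x} (trans (sym (*-assoc _ _ _)) (*-inverseʳ (<⇒# xy<0))))
  ... | inj₁ x<0 = 0≤x x<0
  ... | inj₂ 0<x = *-nonneg-pos 0≤y 0<x (<-respˡ-≈ (*-comm x y) xy<0)

  0≤x+x⇒0≤x : ∀ {x} → 0≤ (x + x) → 0≤ x
  0≤x+x⇒0≤x 0≤x+x x<0 = 0≤x+x (<-respʳ-≈ (+-identityˡ 0#) (+-mono-< x<0 x<0))

  0≤y-x∧y<z⇒x<z : ∀ {x y z} → 0≤ (y - x) → y < z → x < z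
  0≤y-x∧y<z⇒x<z {x} {y} {z} 0≤y-x y<z = 0<y-x⇒x<y (<-respʳ-≈
    (solve 3 (λ x y z → z :- y :+ (y :- x) := z :- x) refl x y z)
    (+-pos-nonneg (x<y⇒0<y-x y<z) 0≤y-x))

  -- Cotransitivity at y - x leaves either the claim or 0 < x; in the latter case y + x is positive
  -- and cancels from (y + x)(y - x).
  square-cancel-< : ∀ {x y} → 0# < y → x * x < y * y → x < y
  square-cancel-< {x} {y} 0<y x²<y² with <-cotrans 0<y (y - x)
  ... | inj₁ 0<y-x = 0<y-x⇒x<y 0<y-x
  ... | inj₂ y-x<y = 0<y-x⇒x<y (0<xy⇒0<x⇒0<y
    (<-respʳ-≈ (solve 2 (λ x y → y :* y :- x :* x := (y :+ x) :* (y :- x)) refl x y) (x<y⇒0<y-x x²<y²))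
    (+-pos 0<y (<-respʳ-≈ (solve 2 (λ x y → y :- (y :- x) := x) refl x y) (x<y⇒0<y-x y-x<y))))

  -- The nonstrict companion of `Bounded`: it allows the bound 0, needed for empty sums, and lets a
  -- nonnegative number bound itself.
  Within : Carrier → Carrier → Set ℓ₂
  Within t x = 0≤ (t - x) × 0≤ (t + x)

  Within-resp : ∀ {s t x y} → s ≈ t → x ≈ y → Within s x → Within t y
  Within-resp s≈t x≈y (p , q) =
    0≤-resp (+-cong s≈t (-‿cong x≈y)) p , 0≤-resp (+-cong s≈t x≈y) q

  Within-+ : ∀ {s t x y} → Within s x → Within t y → Within (s + t) (x + y)
  Within-+ {s} {t} {x} {y} (p , p′) (q , q′) =
    0≤-resp (solve 4 (λ s t x y → s :- x :+ (t :- y) := s :+ t :- (x :+ y)) refl s t x y) (+-nonneg p q) ,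
    0≤-resp (solve 4 (λ s t x y → s :+ x :+ (t :+ y) := s :+ t :+ (x :+ y)) refl s t x y) (+-nonneg p′ q′)

  Within-neg : ∀ {t x} → Within t x → Within t (- x)
  Within-neg {t} {x} (p , p′) = 0≤-resp (solve 2 (λ t x → t :+ x := t :- (:- x)) refl t x) p′ , p

  -- Twice each of s t - x y and s t + x y is a sum of two products of nonnegative factors.
  Within-* : ∀ {s t x y} → Within s x → Within t y → Within (s * t) (x * y)
  Within-* {s} {t} {x} {y} (p , p′) (q , q′) =
    0≤x+x⇒0≤x (0≤-resp (solve 4 (λ s t x y → (s :- x) :* (t :+ y) :+ (s :+ x) :* (t :- y)
        := s :* t :- x :* y :+ (s :* t :- x :* y)) refl s t x y)
      (+-nonneg (0≤-* p q′) (0≤-* p′ q))) ,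
    0≤x+x⇒0≤x (0≤-resp (solve 4 (λ s t x y → (s :- x) :* (t :- y) :+ (s :+ x) :* (t :+ y)
        := s :* t :+ x :* y :+ (s :* t :+ x :* y)) refl s t x y)
      (+-nonneg (0≤-* p q) (0≤-* p′ q′)))

  Within-0 : ∀ {t} → 0≤ t → Within t 0#
  Within-0 {t} 0≤t = 0≤-resp (sym (x-0≈x t)) 0≤t , 0≤-resp (sym (+-identityʳ t)) 0≤t

  Within-self : ∀ {t} → 0≤ t → Within t t
  Within-self 0≤t = 0≤-resp (sym (-‿inverseʳ _)) 0≤0 , +-nonneg 0≤t 0≤t

  Within⇒Bounded : ∀ {t x y} → Within t x → t < y → Bounded y x
  Within⇒Bounded {t} {x} (p , p′) t<y = 0≤y-x∧y<z⇒x<z p t<y ,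
    0≤y-x∧y<z⇒x<z (0≤-resp (solve 2 (λ t x → t :+ x := t :- (:- x)) refl t x) p′) t<y

  Bounded⇒Within : ∀ {t x} → Bounded t x → Within t x
  Bounded⇒Within {t} {x} (p , p′) = 0<⇒0≤ (x<y⇒0<y-x p) ,
    0<⇒0≤ (<-respʳ-≈ (solve 2 (λ t x → t :- (:- x) := t :+ x) refl t x) (x<y⇒0<y-x p′))

  Bounded⇒0< : ∀ {t x} → Bounded t x → 0# < t
  Bounded⇒0< {t} {x} (p , p′) = 0<x+x⇒0<x (<-respˡ-≈ (-‿inverseʳ x) (+-mono-< p p′))

  -- Bernoulli's inequality for 1 / x in the form xⁿ · (1 + n (1 - x)) ≤ 1.
  bernoulli : ∀ {x} → 0≤ x → x < 1# → ∀ n → 0≤ (1# - x ^ n * (1# + fromℕ n * (1# - x)))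
  bernoulli {x} 0≤x x<1 zero = 0≤-resp (sym (trans (+-congˡ (-‿cong (trans (*-identityˡ _)
    (trans (+-congˡ (zeroˡ _)) (+-identityʳ 1#))))) (-‿inverseʳ 1#))) 0≤0
  bernoulli {x} 0≤x x<1 (suc n) = 0≤-resp eq
    (+-nonneg (bernoulli 0≤x x<1 n) (0≤-* (0≤-^ n) (0≤-* 0≤1+N (0≤-* 0≤y 0≤y))))
    where
    y N w : Carrier
    y = 1# - x
    N = fromℕ n
    w = x ^ n
    0≤-^ : ∀ n → 0≤ (x ^ n)
    0≤-^ zero    = 0<⇒0≤ 0<1
    0≤-^ (suc n) = 0≤-* 0≤x (0≤-^ n)
    0≤y : 0≤ y
    0≤y = 0<⇒0≤ (x<y⇒0<y-x x<1)
    0≤1+N : 0≤ (1# + N)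
    0≤1+N = 0<⇒0≤ (fromℕ-pos n)
    *-1+ : ∀ a b → a * (1# + b) ≈ a + a * b
    *-1+ a b = trans (distribˡ a 1# b) (+-congʳ (*-identityʳ a))
    1+-* : ∀ a b → (1# + a) * b ≈ b + a * b
    1+-* a b = trans (distribʳ b 1# a) (+-congʳ (*-identityˡ b))
    xw≈w-yw : x * w ≈ w - y * w
    xw≈w-yw = sym (trans (+-congˡ (-‿cong (trans (distribʳ w 1# (- x)) (+-congʳ (*-identityˡ w)))))
      (solve 2 (λ x w → w :- (w :+ :- x :* w) := x :* w) refl x w))
    eq : 1# - w * (1# + N * y) + w * ((1# + N) * (y * y)) ≈ 1# - (x * w) * (1# + (1# + N) * y)
    eq = begin
      1# - w * (1# + N * y) + w * ((1# + N) * (y * y))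
        ≈⟨ +-cong (+-congˡ (-‿cong (*-1+ w (N * y)))) (*-congˡ (1+-* N (y * y))) ⟩
      1# - (w + w * (N * y)) + w * (y * y + N * (y * y))
        ≈⟨ solve 4 (λ e w y N → e :- (w :+ w :* (N :* y)) :+ w :* (y :* y :+ N :* (y :* y))
             := e :- ((w :- y :* w) :+ (w :- y :* w) :* (y :+ N :* y))) refl 1# w y N ⟩
      1# - ((w - y * w) + (w - y * w) * (y + N * y))
        ≈⟨ +-congˡ (-‿cong (+-cong xw≈w-yw (*-cong xw≈w-yw (1+-* N y)))) ⟨
      1# - (x * w + (x * w) * ((1# + N) * y))
        ≈⟨ +-congˡ (-‿cong (*-1+ (x * w) _)) ⟨
      1# - (x * w) * (1# + (1# + N) * y) ∎

  -- From xⁿ (1 + n y) ≤ 1 < ε n y, where y = 1 - x.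
  powers-vanish : ∀ {x} → 0≤ x → x < 1# → ∀ ε → 0# < ε → ∃ λ N → ∀ n → N ℕ.≤ n → x ^ n < ε
  powers-vanish {x} 0≤x x<1 ε 0<ε = proj₁ arch , small
    where
    y 1/εy : Carrier
    y = 1# - x
    0<y : 0# < y
    0<y = x<y⇒0<y-x x<1
    0<εy : 0# < ε * y
    0<εy = *-pos 0<ε 0<y
    1/εy = (ε * y) ⁻¹[ 0<x⇒x#0 0<εy ]
    arch : ∃ λ n → 1/εy < fromℕ n
    arch = archimedean 1/εy
    small : ∀ n → proj₁ arch ℕ.≤ n → x ^ n < ε
    small n N≤n = *-cancelʳ-< (+-pos 0<1 (*-pos 0<N 0<y))
      (0≤y-x∧y<z⇒x<z (bernoulli 0≤x x<1 n) (<-trans 1<εny (0<y-x⇒x<y (<-respʳ-≈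
        (trans (sym (+-identityʳ ε)) (trans (+-congˡ (sym (-‿inverseʳ (ε * ny))))
          (trans (sym (+-assoc _ _ _)) (+-congʳ (sym (trans (distribˡ ε 1# ny) (+-congʳ (*-identityʳ ε))))))))
        0<ε))))
      where
      ny : Carrier
      ny = fromℕ n * y
      0<N : 0# < fromℕ n
      0<N = <-trans (⁻¹-pos 0<εy) (<-fromℕ-mono N≤n (proj₂ arch))
      1<εny : 1# < ε * ny
      1<εny = <-resp (trans (*-comm _ _) (*-inverseʳ _))
        (solve 3 (λ n ε y → n :* (ε :* y) := ε :* (n :* y)) refl (fromℕ n) ε y)
        (*-monoˡ-<-pos 0<εy (<-fromℕ-mono N≤n (proj₂ arch)))

-- Limits along a filter

-- Covers both n tending to infinity and s tending to 1 from the left. `witness` says that the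
-- filter is proper, which is what makes limits unique.
record Filter {i} (I : Set i) (p e : Level) : Set (i ⊔ lsuc (p ⊔ e)) where
  field
    Eventually : (I → Set p) → Set e
    map        : ∀ {P Q} → (∀ i → P i → Q i) → Eventually P → Eventually Q
    zip        : ∀ {P Q} → Eventually P → Eventually Q → Eventually λ i → P i × Q i
    always     : ∀ {P} → (∀ i → P i) → Eventually P
    witness    : ∀ {P} → Eventually P → ∃ P

module Limits {c ℓ₁ ℓ₂ : Level} (R : RealNumbers c ℓ₁ ℓ₂) {i e : Level} {I : Set i} (F : Filter I ℓ₂ e) where
  open RealNumbers R
  open OrderedField R
  open Estimates R
  open Filter F

  infix 4 _⇝_
  _⇝_ : (I → Carrier) → Carrier → Set (c ⊔ ℓ₂ ⊔ e)
  s ⇝ x = ∀ ε → 0# < ε → Eventually λ i → Bounded ε (s i - x)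

  -- Lets an estimate lose a constant factor M, by applying it at ε / M.
  ⇝-rescale : ∀ {s x} M → 0# < M →
    (∀ ε → 0# < ε → Eventually λ i → Bounded (M * ε) (s i - x)) → s ⇝ x
  ⇝-rescale M 0<M H ε 0<ε = map (λ _ → Bounded-resp Mδ≈ε refl) (H (ε * M⁻¹) (*-pos 0<ε (⁻¹-pos 0<M)))
    where
    M⁻¹ : Carrier
    M⁻¹ = M ⁻¹[ 0<x⇒x#0 0<M ]
    Mδ≈ε : M * (ε * M⁻¹) ≈ ε
    Mδ≈ε = trans (solve 3 (λ M ε D → M :* (ε :* D) := M :* D :* ε) refl M ε M⁻¹)
      (trans (*-congʳ (*-inverseʳ _)) (*-identityˡ ε))

  ⇝-cong : ∀ {s t x y} → (∀ i → s i ≈ t i) → x ≈ y → s ⇝ x → t ⇝ y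
  ⇝-cong s≈t x≈y s⇝x ε 0<ε =
    map (λ i → Bounded-resp refl (+-cong (s≈t i) (-‿cong x≈y))) (s⇝x ε 0<ε)

  ⇝-const : ∀ x → (λ _ → x) ⇝ x
  ⇝-const x ε 0<ε = always λ _ → Within⇒Bounded (Within-resp refl (sym (-‿inverseʳ x)) (Within-0 0≤0)) 0<ε

  ⇝-+ : ∀ {s t x y} → s ⇝ x → t ⇝ y → (λ i → s i + t i) ⇝ x + y
  ⇝-+ {s} {t} {x} {y} s⇝x t⇝y = ⇝-rescale (1# + 1#) (+-pos 0<1 0<1) λ ε 0<ε →
    map (λ i (p , q) → Bounded-resp (sym (trans (distribʳ ε 1# 1#) (+-cong (*-identityˡ ε) (*-identityˡ ε))))
        (solve 4 (λ s t x y → s :- x :+ (t :- y) := s :+ t :- (x :+ y)) refl (s i) (t i) x y)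
        (Bounded-+ p q))
      (zip (s⇝x ε 0<ε) (t⇝y ε 0<ε))

  ⇝-neg : ∀ {s x} → s ⇝ x → (λ i → - s i) ⇝ - x
  ⇝-neg {s} {x} s⇝x ε 0<ε = map (λ i p → Bounded-resp refl
    (solve 2 (λ s x → :- (s :- x) := :- s :- (:- x)) refl (s i) x) (Bounded-neg p)) (s⇝x ε 0<ε)

  -- The error s t - x y is (s - x)(t - y) + x (t - y) + y (s - x). With s - x bounded by 1, x by K
  -- and y by L, it is bounded by (1 + K + L) ε.
  ⇝-* : ∀ {s t x y} → s ⇝ x → t ⇝ y → (λ i → s i * t i) ⇝ x * y
  ⇝-* {s} {t} {x} {y} s⇝x t⇝y = ⇝-rescale (1# + K + L) (+-pos (+-pos 0<1 (Bounded⇒0< x<K)) (Bounded⇒0< y<L))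
    λ ε 0<ε → map (λ i (p₁ , p , q) → Bounded-resp
        (sym (trans (distribʳ ε (1# + K) L) (+-congʳ (distribʳ ε 1# K))))
        (solve 4 (λ s t x y → (s :- x) :* (t :- y) :+ x :* (t :- y) :+ y :* (s :- x) := s :* t :- x :* y)
          refl (s i) (t i) x y)
        (Bounded-+ (Bounded-+ (Bounded-* p₁ q) (Bounded-* x<K q)) (Bounded-* y<L p)))
      (zip (s⇝x 1# 0<1) (zip (s⇝x ε 0<ε) (t⇝y ε 0<ε)))
    where
    K L : Carrier
    K = fromℕ (proj₁ (bound x))
    L = fromℕ (proj₁ (bound y))
    x<K : Bounded K x
    x<K = proj₂ (bound x)
    y<L : Bounded L y
    y<L = proj₂ (bound y)

  -- By tightness it suffices to refute `x # y`. If x and y were strictly ordered, their distance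
  -- could serve as an ε, and the constant 0, which converges to x - y, would have to come closer
  -- than that distance.
  ⇝-unique : ∀ {s x y} → s ⇝ x → s ⇝ y → x ≈ y
  ⇝-unique {s} {x} {y} s⇝x s⇝y = proj₁ (tight x y) λ x#y → [ x≮y , y≮x ]′ (#⇒<⊎> x#y)
    where
    d : Carrier
    d = x - y
    0⇝d : (λ _ → 0#) ⇝ d
    0⇝d = ⇝-cong (λ i → -‿inverseʳ (s i)) refl (⇝-+ s⇝x (⇝-neg s⇝y))
    y≮x : ¬ (y < x)
    y≮x y<x = <-irrefl refl (<-respˡ-≈ (solve 1 (λ d → :- (con (pos 0) :- d) := d) refl d)
      (proj₂ (proj₂ (witness (0⇝d d (x<y⇒0<y-x y<x))))))
    x≮y : ¬ (x < y)
    x≮y x<y = <-irrefl refl (<-respˡ-≈ (solve 2 (λ x y → con (pos 0) :- (x :- y) := y :- x) refl x y)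
      (proj₁ (proj₂ (witness (0⇝d (y - x) (x<y⇒0<y-x x<y))))))

  -- Once x / 2 < s, the inverse of s is below 2 / x.
  ⇝-⁻¹ : ∀ {s x} (s#0 : ∀ i → s i # 0#) (x#0 : x # 0#) → 0# < x → s ⇝ x →
    (λ i → s i ⁻¹[ s#0 i ]) ⇝ x ⁻¹[ x#0 ]
  ⇝-⁻¹ {s} {x} s#0 x#0 0<x s⇝x = ⇝-rescale (2v * 2v) (*-pos 0<2v 0<2v) λ ε 0<ε →
    map (λ i (near , p) → Bounded-resp (*-comm ε (2v * 2v))
        (difference (s i) (s i ⁻¹[ s#0 i ]) (*-inverseʳ _))
        (Bounded-* (Bounded-neg p) (Bounded-* v<2v (inverse-bound (s#0 i) near))))
      (zip (s⇝x h 0<h) (s⇝x ε 0<ε))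
    where
    v 2v h : Carrier
    v = x ⁻¹[ x#0 ]
    2v = v + v
    h = recip 2 * x
    0<v : 0# < v
    0<v = 0<xy⇒0<x⇒0<y (<-respʳ-≈ (sym (*-inverseʳ x#0)) 0<1) 0<x
    0<2v : 0# < 2v
    0<2v = +-pos 0<v 0<v
    0<h : 0# < h
    0<h = *-pos (recip-pos 2) 0<x
    h+h≈x : h + h ≈ x
    h+h≈x = trans (solve 2 (λ r x → r :* x :+ r :* x := con (pos 2) :* r :* x) refl (recip 2) x)
      (trans (*-congʳ (recip-inverse 2)) (*-identityˡ x))
    2vh≈1 : 2v * h ≈ 1#
    2vh≈1 = trans (solve 2 (λ v h → (v :+ v) :* h := (h :+ h) :* v) refl v h)
      (trans (*-congʳ h+h≈x) (*-inverseʳ x#0))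
    v<2v : Bounded 2v v
    v<2v = Within⇒Bounded (Within-self (0<⇒0≤ 0<v))
      (0<y-x⇒x<y (<-respʳ-≈ (solve 1 (λ v → v := v :+ v :- v) refl v) 0<v))
    difference : ∀ a b → a * b ≈ 1# → - (a - x) * (v * b) ≈ b - v
    difference a b ab≈1 = trans
      (solve 4 (λ a b x v → :- (a :- x) :* (v :* b) := x :* v :* b :- a :* b :* v) refl a b x v)
      (+-cong (trans (*-congʳ (*-inverseʳ x#0)) (*-identityˡ b)) (-‿cong (trans (*-congʳ ab≈1) (*-identityˡ v))))
    inverse-bound : ∀ {a} (a#0 : a # 0#) → Bounded h (a - x) → Bounded 2v (a ⁻¹[ a#0 ])
    inverse-bound {a} a#0 (_ , x-a<h) = Within⇒Bounded (Within-self (0<⇒0≤ 0<b))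
      (*-cancelʳ-< 0<h (<-resp (*-comm h b) (trans (trans (*-comm a b) ba≈1) (sym 2vh≈1)) (*-monoˡ-<-pos 0<b h<a)))
      where
      b : Carrier
      b = a ⁻¹[ a#0 ]
      ba≈1 : b * a ≈ 1#
      ba≈1 = trans (*-comm b a) (*-inverseʳ a#0)
      h<a : h < a
      h<a = 0<y-x⇒x<y (<-respʳ-≈ (trans
        (solve 3 (λ h a x → h :- :- (a :- x) := a :- (x :- h)) refl h a x)
        (+-congˡ (-‿cong (trans (+-congʳ (sym h+h≈x)) (solve 1 (λ h → h :+ h :- h := h) refl h)))))
        (x<y⇒0<y-x x-a<h))
      0<b : 0# < b
      0<b = 0<xy⇒0<x⇒0<y (<-respʳ-≈ (sym (*-inverseʳ a#0)) 0<1) (<-trans 0<h h<a)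

-- The ring of complex numbers

module ComplexRing {c ℓ₁ ℓ₂ : Level} (R : RealNumbers c ℓ₁ ℓ₂) where
  open RealNumbers R
  open OrderedField R
  open Complex R

  ℂ-commutativeRing : CommutativeRing c ℓ₁
  ℂ-commutativeRing = record
    { Carrier = ℂ ; _≈_ = _≈ᶜ_ ; _+_ = _+ᶜ_ ; _*_ = _*ᶜ_ ; -_ = -ᶜ_ ; 0# = 0ᶜ ; 1# = 1ᶜ
    ; isCommutativeRing = record
      { isRing = record
        { +-isAbelianGroup = record
          { isGroup = record
            { isMonoid = record
              { isSemigroup = record
                { isMagma = record
                  { isEquivalence = record
                    { refl  = refl , refl
                    ; sym   = λ (p , q) → sym p , sym q
                    ; trans = λ (p , q) (p′ , q′) → trans p p′ , trans q q′
                    }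
                  ; ∙-cong = λ (p , q) (p′ , q′) → +-cong p p′ , +-cong q q′
                  }
                ; assoc = λ _ _ _ → +-assoc _ _ _ , +-assoc _ _ _
                }
              ; identity = (λ _ → +-identityˡ _ , +-identityˡ _) , (λ _ → +-identityʳ _ , +-identityʳ _)
              }
            ; inverse = (λ _ → -‿inverseˡ _ , -‿inverseˡ _) , (λ _ → -‿inverseʳ _ , -‿inverseʳ _)
            ; ⁻¹-cong = λ (p , q) → -‿cong p , -‿cong q
            }
          ; comm = λ _ _ → +-comm _ _ , +-comm _ _
          }
        ; *-cong = λ (p , q) (p′ , q′) →
            +-cong (*-cong p p′) (-‿cong (*-cong q q′)) , +-cong (*-cong p q′) (*-cong q p′)
        ; *-assoc = λ z w v → *ᶜ-assoc (re z) (im z) (re w) (im w) (re v) (im v)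
        ; *-identity = (λ z → *ᶜ-identityˡ z) ,
            (λ z → trans (*ᶜ-comm₁ _ _ _ _) (proj₁ (*ᶜ-identityˡ z)) , trans (*ᶜ-comm₂ _ _ _ _) (proj₂ (*ᶜ-identityˡ z)))
        ; distrib = (λ z w v → *ᶜ-distribˡ (re z) (im z) (re w) (im w) (re v) (im v)) ,
            (λ z w v → trans (*ᶜ-comm₁ _ _ _ _) (trans (proj₁ (*ᶜ-distribˡ (re z) (im z) (re w) (im w) (re v) (im v)))
                (+-cong (*ᶜ-comm₁ _ _ _ _) (*ᶜ-comm₁ _ _ _ _))) ,
              trans (*ᶜ-comm₂ _ _ _ _) (trans (proj₂ (*ᶜ-distribˡ (re z) (im z) (re w) (im w) (re v) (im v)))
                (+-cong (*ᶜ-comm₂ _ _ _ _) (*ᶜ-comm₂ _ _ _ _))))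
        }
      ; *-comm = λ z w → *ᶜ-comm₁ _ _ _ _ , *ᶜ-comm₂ _ _ _ _
      }
    }
    where
    *ᶜ-comm₁ : ∀ a b x y → a * x - b * y ≈ x * a - y * b
    *ᶜ-comm₁ = solve 4 (λ a b x y → a :* x :- b :* y := x :* a :- y :* b) refl
    *ᶜ-comm₂ : ∀ a b x y → a * y + b * x ≈ x * b + y * a
    *ᶜ-comm₂ = solve 4 (λ a b x y → a :* y :+ b :* x := x :* b :+ y :* a) refl
    *ᶜ-assoc : ∀ a b x y u v →
      ((a * x - b * y) * u - (a * y + b * x) * v ≈ a * (x * u - y * v) - b * (x * v + y * u)) ×
      ((a * x - b * y) * v + (a * y + b * x) * u ≈ a * (x * v + y * u) + b * (x * u - y * v))
    *ᶜ-assoc a b x y u v =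
      solve 6 (λ a b x y u v → (a :* x :- b :* y) :* u :- (a :* y :+ b :* x) :* v
        := a :* (x :* u :- y :* v) :- b :* (x :* v :+ y :* u)) refl a b x y u v ,
      solve 6 (λ a b x y u v → (a :* x :- b :* y) :* v :+ (a :* y :+ b :* x) :* u
        := a :* (x :* v :+ y :* u) :+ b :* (x :* u :- y :* v)) refl a b x y u v
    *ᶜ-distribˡ : ∀ a b x y u v →
      (a * (x + u) - b * (y + v) ≈ (a * x - b * y) + (a * u - b * v)) ×
      (a * (y + v) + b * (x + u) ≈ (a * y + b * x) + (a * v + b * u))
    *ᶜ-distribˡ a b x y u v =
      solve 6 (λ a b x y u v → a :* (x :+ u) :- b :* (y :+ v)
        := (a :* x :- b :* y) :+ (a :* u :- b :* v)) refl a b x y u v ,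
      solve 6 (λ a b x y u v → a :* (y :+ v) :+ b :* (x :+ u)
        := (a :* y :+ b :* x) :+ (a :* v :+ b :* u)) refl a b x y u v
    *ᶜ-identityˡ : ∀ z → 1ᶜ *ᶜ z ≈ᶜ z
    *ᶜ-identityˡ z =
      trans (+-cong (*-identityˡ _) (-‿cong (zeroˡ _))) (x-0≈x _) ,
      trans (+-cong (*-identityˡ _) (zeroˡ _)) (+-identityʳ _)

  open CommutativeRing ℂ-commutativeRing public using () renaming
    ( refl to ≈ᶜ-refl; sym to ≈ᶜ-sym; trans to ≈ᶜ-trans; setoid to ≈ᶜ-setoid
    ; semiring to ℂ-semiring; commutativeSemiring to ℂ-commutativeSemiring
    ; +-congˡ to +ᶜ-congˡ; +-congʳ to +ᶜ-congʳ; -‿cong to -ᶜ-cong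
    ; -‿inverseʳ to -ᶜ-inverseʳ
    ; *-cong to *ᶜ-cong; *-congˡ to *ᶜ-congˡ; *-congʳ to *ᶜ-congʳ
    ; *-assoc to *ᶜ-assoc; *-comm to *ᶜ-comm; *-identityˡ to *ᶜ-identityˡ; *-identityʳ to *ᶜ-identityʳ)

  module ℂ-Sums = FiniteSums ℂ-commutativeRing

  ∙ᶜ≈ofℝ-* : ∀ x z → x ∙ᶜ z ≈ᶜ ofℝ x *ᶜ z
  ∙ᶜ≈ofℝ-* x z = sym (trans (+-congˡ (-‿cong (zeroˡ _))) (x-0≈x _)) , sym (trans (+-congˡ (zeroˡ _)) (+-identityʳ _))

  ofℝ-cong : ∀ {x y} → x ≈ y → ofℝ x ≈ᶜ ofℝ y
  ofℝ-cong x≈y = x≈y , refl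

  ofℝ-* : ∀ x y → ofℝ (x * y) ≈ᶜ ofℝ x *ᶜ ofℝ y
  ofℝ-* x y = solve 2 (λ x y → x :* y := x :* y :- con (pos 0) :* con (pos 0)) refl x y ,
    solve 2 (λ x y → con (pos 0) := x :* con (pos 0) :+ con (pos 0) :* y) refl x y

  ofℝ-^ : ∀ x n → ofℝ (x ^ n) ≈ᶜ ofℝ x ^ᶜ n
  ofℝ-^ x zero    = ≈ᶜ-refl
  ofℝ-^ x (suc n) = ≈ᶜ-trans (ofℝ-* x (x ^ n)) (*ᶜ-congˡ (ofℝ-^ x n))

  open import Algebra.Properties.Semiring.Exp ℂ-semiring public using () renaming (^-congˡ to ^ᶜ-congˡ)
  open import Algebra.Properties.Semiring.Mult ℂ-semiring public using () renaming (_×_ to _·ᶜ_)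

  fromℕᶜ≈·1 : ∀ n → fromℕᶜ n ≈ᶜ n ·ᶜ 1ᶜ
  fromℕᶜ≈·1 zero    = ≈ᶜ-refl
  fromℕᶜ≈·1 (suc n) = +-congˡ (proj₁ (fromℕᶜ≈·1 n)) , trans (sym (+-identityˡ 0#)) (+-congˡ (proj₂ (fromℕᶜ≈·1 n)))

  ∑<≈∑ : ∀ n a → ∑< n a ≈ᶜ ℂ-Sums.∑ n a
  ∑<≈∑ zero    a = ≈ᶜ-refl
  ∑<≈∑ (suc n) a = ≈ᶜ-trans (+ᶜ-congʳ (∑<≈∑ n a)) (≈ᶜ-sym (ℂ-Sums.∑-last n a))

  normSq-cong : ∀ {z w} → z ≈ᶜ w → normSq z ≈ normSq w
  normSq-cong (p , q) = +-cong (*-cong p p) (*-cong q q)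

  normSq-* : ∀ z w → normSq (z *ᶜ w) ≈ normSq z * normSq w
  normSq-* z w = solve 4 (λ a b x y →
    (a :* x :- b :* y) :* (a :* x :- b :* y) :+ (a :* y :+ b :* x) :* (a :* y :+ b :* x)
    := (a :* a :+ b :* b) :* (x :* x :+ y :* y)) refl (re z) (im z) (re w) (im w)

  normSq-1 : normSq 1ᶜ ≈ 1#
  normSq-1 = trans (+-cong (*-identityˡ 1#) (zeroˡ 0#)) (+-identityʳ 1#)

  normSq-^ : ∀ z n → normSq (z ^ᶜ n) ≈ normSq z ^ n
  normSq-^ z zero    = normSq-1
  normSq-^ z (suc n) = trans (normSq-* z (z ^ᶜ n)) (*-congˡ (normSq-^ z n))

  *ᶜ-inverseʳ : ∀ z (z#0 : z #ᶜ0) → z *ᶜ z ⁻¹ᶜ[ z#0 ] ≈ᶜ 1ᶜ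
  *ᶜ-inverseʳ z z#0 =
    trans (solve 3 (λ x y n → x :* (n :* x) :- y :* (n :* :- y) := (x :* x :+ y :* y) :* n) refl (re z) (im z) n)
      (*-inverseʳ z#0) ,
    solve 3 (λ x y n → x :* (n :* :- y) :+ y :* (n :* x) := con (pos 0)) refl (re z) (im z) n
    where
    n : Carrier
    n = normSq z ⁻¹[ z#0 ]

-- Limits of complex-valued functions

module ComplexLimits {c ℓ₁ ℓ₂ : Level} (R : RealNumbers c ℓ₁ ℓ₂) {i e : Level} {I : Set i} (F : Filter I ℓ₂ e) where
  open RealNumbers R
  open OrderedField R
  open Estimates R
  open Complex R
  open ComplexRing R
  open Filter F
  open Limits R F

  infix 4 _⇝ᶜ_
  -- Convergence by coordinates, so that the limit laws are inherited from the real ones; `∣∣<⇒⇝ᶜ`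
  -- and `⇝ᶜ⇒∣∣<` translate from and to the modulus.
  record _⇝ᶜ_ (s : I → ℂ) (z : ℂ) : Set (c ⊔ ℓ₂ ⊔ e) where
    constructor coordinates
    field
      re-⇝ : (λ i → re (s i)) ⇝ re z
      im-⇝ : (λ i → im (s i)) ⇝ im z

  ⇝ᶜ-cong : ∀ {s t z w} → (∀ i → s i ≈ᶜ t i) → z ≈ᶜ w → s ⇝ᶜ z → t ⇝ᶜ w
  ⇝ᶜ-cong s≈t (p , q) (coordinates h k) =
    coordinates (⇝-cong (λ i → proj₁ (s≈t i)) p h) (⇝-cong (λ i → proj₂ (s≈t i)) q k)

  ⇝ᶜ-congˡ : ∀ {s t z} → (∀ i → s i ≈ᶜ t i) → s ⇝ᶜ z → t ⇝ᶜ z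
  ⇝ᶜ-congˡ s≈t = ⇝ᶜ-cong s≈t ≈ᶜ-refl

  ⇝ᶜ-const : ∀ z → (λ _ → z) ⇝ᶜ z
  ⇝ᶜ-const z = coordinates (⇝-const (re z)) (⇝-const (im z))

  ⇝ᶜ-+ : ∀ {s t z w} → s ⇝ᶜ z → t ⇝ᶜ w → (λ i → s i +ᶜ t i) ⇝ᶜ z +ᶜ w
  ⇝ᶜ-+ (coordinates h k) (coordinates h′ k′) = coordinates (⇝-+ h h′) (⇝-+ k k′)

  ⇝ᶜ-- : ∀ {s t z w} → s ⇝ᶜ z → t ⇝ᶜ w → (λ i → s i -ᶜ t i) ⇝ᶜ z -ᶜ w
  ⇝ᶜ-- (coordinates h k) (coordinates h′ k′) = coordinates (⇝-+ h (⇝-neg h′)) (⇝-+ k (⇝-neg k′))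

  ⇝ᶜ-* : ∀ {s t z w} → s ⇝ᶜ z → t ⇝ᶜ w → (λ i → s i *ᶜ t i) ⇝ᶜ z *ᶜ w
  ⇝ᶜ-* (coordinates h k) (coordinates h′ k′) =
    coordinates (⇝-+ (⇝-* h h′) (⇝-neg (⇝-* k k′))) (⇝-+ (⇝-* h k′) (⇝-* k h′))

  ⇝ᶜ-^ : ∀ {s z} n → s ⇝ᶜ z → (λ i → s i ^ᶜ n) ⇝ᶜ z ^ᶜ n
  ⇝ᶜ-^ zero    h = ⇝ᶜ-const 1ᶜ
  ⇝ᶜ-^ (suc n) h = ⇝ᶜ-* h (⇝ᶜ-^ n h)

  ⇝ᶜ-∑ : ∀ n {s : I → ℕ → ℂ} {z : ℕ → ℂ} → (∀ l → (λ i → s i l) ⇝ᶜ z l) →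
    (λ i → ℂ-Sums.∑ n (s i)) ⇝ᶜ ℂ-Sums.∑ n z
  ⇝ᶜ-∑ zero    h = ⇝ᶜ-const 0ᶜ
  ⇝ᶜ-∑ (suc n) h = ⇝ᶜ-+ (h 0) (⇝ᶜ-∑ n λ l → h (suc l))

  ⇝ᶜ-unique : ∀ {s z w} → s ⇝ᶜ z → s ⇝ᶜ w → z ≈ᶜ w
  ⇝ᶜ-unique (coordinates h k) (coordinates h′ k′) = ⇝-unique h h′ , ⇝-unique k k′

  -- The inverse is the conjugate divided by `normSq`, which is nonnegative and so positive once
  -- apart from 0; the real law for positive limits then applies.
  ⇝ᶜ-⁻¹ : ∀ {s z} (s#0 : ∀ i → s i #ᶜ0) (z#0 : z #ᶜ0) → s ⇝ᶜ z →
    (λ i → s i ⁻¹ᶜ[ s#0 i ]) ⇝ᶜ z ⁻¹ᶜ[ z#0 ]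
  ⇝ᶜ-⁻¹ {s} {z} s#0 z#0 (coordinates h k) = coordinates (⇝-* inv h) (⇝-* inv (⇝-neg k))
    where
    0<normSq : 0# < normSq z
    0<normSq = [ (λ n<0 → ⊥-elim (+-nonneg (x²≮0 (re z)) (x²≮0 (im z)) n<0)) , (λ p → p) ]′ (#⇒<⊎> z#0)
    inv : (λ i → normSq (s i) ⁻¹[ s#0 i ]) ⇝ normSq z ⁻¹[ z#0 ]
    inv = ⇝-⁻¹ s#0 z#0 0<normSq (⇝-+ (⇝-* h h) (⇝-* k k))

  ∣∣<⇒⇝ᶜ : ∀ {s z} → (∀ ε → 0# < ε → Eventually λ i → ∣ s i -ᶜ z ∣< ε) → s ⇝ᶜ z
  ∣∣<⇒⇝ᶜ h = coordinates (λ ε 0<ε → map (λ _ → re-bounded) (h ε 0<ε)) (λ ε 0<ε → map (λ _ → im-bounded) (h ε 0<ε))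
    where
    bounded : ∀ {x y ε} → 0# < ε → x * x + y * y < ε * ε → Bounded ε x
    bounded {x} {y} {ε} 0<ε p = square-cancel-< 0<ε x²<ε² , square-cancel-< 0<ε
      (<-respˡ-≈ (solve 1 (λ x → x :* x := :- x :* :- x) refl x) x²<ε²)
      where
      x²<ε² : x * x < ε * ε
      x²<ε² = 0≤y-x∧y<z⇒x<z
        (0≤-resp (solve 2 (λ x y → y :* y := x :* x :+ y :* y :- x :* x) refl x y) (x²≮0 y)) p
    re-bounded : ∀ {w ε} → ∣ w ∣< ε → Bounded ε (re w)
    re-bounded (0<ε , p) = bounded 0<ε p
    im-bounded : ∀ {w ε} → ∣ w ∣< ε → Bounded ε (im w)
    im-bounded (0<ε , p) = bounded 0<ε (<-respˡ-≈ (+-comm _ _) p)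

  ⇝ᶜ⇒∣∣< : ∀ {s z} → s ⇝ᶜ z → ∀ ε → 0# < ε → Eventually λ i → ∣ s i -ᶜ z ∣< ε
  ⇝ᶜ⇒∣∣< (coordinates h k) ε 0<ε = map (λ _ (p , q) → 0<ε , close p q) (zip (h η 0<η) (k η 0<η))
    where
    -- Half of ε: coordinates bounded by η give x² + y² < 2 η² < 4 η² = ε².
    η : Carrier
    η = recip 2 * ε
    0<η : 0# < η
    0<η = *-pos (recip-pos 2) 0<ε
    η+η≈ε : η + η ≈ ε
    η+η≈ε = trans (solve 2 (λ r x → r :* x :+ r :* x := con (pos 2) :* r :* x) refl (recip 2) ε)
      (trans (*-congʳ (recip-inverse 2)) (*-identityˡ ε))
    close : ∀ {x y} → Bounded η x → Bounded η y → x * x + y * y < ε * ε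
    close p q = <-trans (+-mono-< (proj₁ (Bounded-* p p)) (proj₁ (Bounded-* q q)))
      (<-respʳ-≈ (*-cong η+η≈ε η+η≈ε) (0<y-x⇒x<y (<-respʳ-≈
        (solve 1 (λ η → η :* η :+ η :* η := (η :+ η) :* (η :+ η) :- (η :* η :+ η :* η)) refl η)
        (+-pos (*-pos 0<η 0<η) (*-pos 0<η 0<η)))))

atTop : ∀ {p} → Filter ℕ p p
atTop = record
  { Eventually = λ P → ∃ λ N → ∀ n → N ℕ.≤ n → P n
  ; map        = λ P⇒Q (N , h) → N , λ n N≤n → P⇒Q n (h n N≤n)
  ; zip        = λ (M , h) (N , k) → M ℕ.+ N , λ n M+N≤n →
      h n (ℕₚ.≤-trans (ℕₚ.m≤m+n M N) M+N≤n) , k n (ℕₚ.≤-trans (ℕₚ.m≤n+m N M) M+N≤n)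
  ; always     = λ h → 0 , λ n _ → h n
  ; witness    = λ (N , h) → N , h N ℕₚ.≤-refl
  }

-- The functional equation of the exponential

module Exponential {c ℓ₁ ℓ₂ : Level} (R : RealNumbers c ℓ₁ ℓ₂) where
  open RealNumbers R
  open OrderedField R
  open Estimates R
  open Complex R
  open ComplexRing R
  open Limits R (atTop {ℓ₂})
  open ComplexLimits R (atTop {ℓ₂})
  module ℝ-Sums = FiniteSums commutativeRing
  module ℂ-Ring = CommutativeRing ℂ-commutativeRing

  -- A bound on both coordinates avoids square roots; the price is the factor 2 in `Dominated-*`.
  Dominated : Carrier → ℂ → Set ℓ₂
  Dominated t z = Within t (re z) × Within t (im z)

  Dominated-+ : ∀ {s t z w} → Dominated s z → Dominated t w → Dominated (s + t) (z +ᶜ w)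
  Dominated-+ (p , q) (p′ , q′) = Within-+ p p′ , Within-+ q q′

  Dominated-* : ∀ {s t z w} → Dominated s z → Dominated t w → Dominated (s * t + s * t) (z *ᶜ w)
  Dominated-* (p , q) (p′ , q′) =
    Within-+ (Within-* p p′) (Within-neg (Within-* q q′)) , Within-+ (Within-* p q′) (Within-* q p′)

  Dominated-resp : ∀ {s t z w} → s ≈ t → z ≈ᶜ w → Dominated s z → Dominated t w
  Dominated-resp e (f , g) (p , q) = Within-resp e f p , Within-resp e g q

  Dominated⇒0≤ : ∀ {t z} → Dominated t z → 0≤ t
  Dominated⇒0≤ {t} {z} ((p , q) , _) = 0≤x+x⇒0≤x (0≤-resp
    (solve 2 (λ t x → t :- x :+ (t :+ x) := t :+ t) refl t (re z)) (+-nonneg p q))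

  Dominated-0 : Dominated 0# 0ᶜ
  Dominated-0 = Within-0 0≤0 , Within-0 0≤0

  Dominated-tail : ∀ {B b} → (∀ i → Dominated (B i) (b i)) → ∀ k n →
    Dominated (ℝ-Sums.∑ (k ℕ.+ n) B - ℝ-Sums.∑ n B) (ℂ-Sums.∑ (k ℕ.+ n) b -ᶜ ℂ-Sums.∑ n b)
  Dominated-tail {B} {b} b≤B zero    n =
    Dominated-resp (sym (-‿inverseʳ _)) (≈ᶜ-sym (-ᶜ-inverseʳ (ℂ-Sums.∑ n b))) Dominated-0
  Dominated-tail {B} {b} b≤B (suc k) n = Dominated-resp
    (trans (swap _ _ _) (+-congʳ (sym (ℝ-Sums.∑-last (k ℕ.+ n) B))))
    (≈ᶜ-trans (swap _ _ _ , swap _ _ _) (+ᶜ-congʳ {x = -ᶜ ℂ-Sums.∑ n b} (≈ᶜ-sym (ℂ-Sums.∑-last (k ℕ.+ n) b))))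
    (Dominated-+ (Dominated-tail b≤B k n) (b≤B (k ℕ.+ n)))
    where
    swap : ∀ x y z → (x - y) + z ≈ (x + z) - y
    swap = solve 3 (λ x y z → (x :- y) :+ z := (x :+ z) :- y) refl

  -- The terms outside the triangle are the a i b j with n ≤ i + j, each dominated by twice A i B j,
  -- whence the doubled gap. Removing a row lowers n but keeps the number k + n of columns, so the
  -- induction has to let k grow.
  Dominated-rectangle : ∀ {A B a b} → (∀ i → Dominated (A i) (a i)) → (∀ i → Dominated (B i) (b i)) →
    ∀ n k → let gap = ℝ-Sums.∑ n A * ℝ-Sums.∑ (k ℕ.+ n) B - ℝ-Sums.triangle A B n in
    Dominated (gap + gap) (ℂ-Sums.∑ n a *ᶜ ℂ-Sums.∑ (k ℕ.+ n) b -ᶜ ℂ-Sums.triangle a b n)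
  Dominated-rectangle {A} {B} {a} {b} a≤A b≤B zero k = Dominated-resp
    (solve 1 (λ s → con (pos 0) := (con (pos 0) :* s :- con (pos 0)) :+ (con (pos 0) :* s :- con (pos 0))) refl
      (ℝ-Sums.∑ (k ℕ.+ 0) B))
    (≈ᶜ-sym (≈ᶜ-trans (+ᶜ-congʳ {x = -ᶜ 0ᶜ} (ℂ-Ring.zeroˡ (ℂ-Sums.∑ (k ℕ.+ 0) b))) (-ᶜ-inverseʳ 0ᶜ)))
    Dominated-0
  Dominated-rectangle {A} {B} {a} {b} a≤A b≤B (suc n) k = Dominated-resp
    (trans (solve 2 (λ x y → x :+ x :+ (y :+ y) := (x :+ y) :+ (x :+ y)) refl _ _)
      (sym (+-cong rect rect)))
    (≈ᶜ-sym (ℂ-Sums.rectangle-triangle-suc a b n (k ℕ.+ suc n)))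
    (Dominated-+ (Dominated-* (a≤A 0) (Dominated-tail b≤B k (suc n)))
      (≡.subst (λ m → Dominated
          (gap m + gap m)
          (ℂ-Sums.∑ n (λ i → a (suc i)) *ᶜ ℂ-Sums.∑ m b -ᶜ ℂ-Sums.triangle (λ i → a (suc i)) b n))
        (≡.sym (ℕₚ.+-suc k n)) (Dominated-rectangle (λ i → a≤A (suc i)) b≤B n (suc k))))
    where
    gap : ℕ → Carrier
    gap m = ℝ-Sums.∑ n (λ i → A (suc i)) * ℝ-Sums.∑ m B - ℝ-Sums.triangle (λ i → A (suc i)) B n
    rect : ℝ-Sums.∑ (suc n) A * ℝ-Sums.∑ (k ℕ.+ suc n) B - ℝ-Sums.triangle A B (suc n)
         ≈ A 0 * (ℝ-Sums.∑ (k ℕ.+ suc n) B - ℝ-Sums.∑ (suc n) B) + gap (k ℕ.+ suc n)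
    rect = ℝ-Sums.rectangle-triangle-suc A B n (k ℕ.+ suc n)

  0≤-∑ : ∀ n {A} → (∀ i → 0≤ A i) → 0≤ ℝ-Sums.∑ n A
  0≤-∑ zero    0≤A = 0≤0
  0≤-∑ (suc n) 0≤A = +-nonneg (0≤A 0) (0≤-∑ n λ i → 0≤A (suc i))

  0≤-triangle : ∀ {A B} → (∀ i → 0≤ A i) → (∀ i → 0≤ B i) → ∀ n → 0≤ ℝ-Sums.triangle A B n
  0≤-triangle 0≤A 0≤B zero    = 0≤0
  0≤-triangle 0≤A 0≤B (suc n) =
    +-nonneg (0≤-* (0≤A 0) (0≤-∑ (suc n) 0≤B)) (0≤-triangle (λ i → 0≤A (suc i)) 0≤B n)

  0≤-tail : ∀ {B} → (∀ i → 0≤ B i) → ∀ k n → 0≤ (ℝ-Sums.∑ (k ℕ.+ n) B - ℝ-Sums.∑ n B)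
  0≤-tail 0≤B k n = Dominated⇒0≤ (Dominated-tail {b = λ _ → 0ᶜ} (λ i → Within-0 (0≤B i) , Within-0 (0≤B i)) k n)

  -- Indices i < n and j < m satisfy i + j < n + m, and the further terms of the triangle are
  -- nonnegative.
  rectangle≤triangle : ∀ {A B} → (∀ i → 0≤ A i) → (∀ i → 0≤ B i) → ∀ n m →
    0≤ (ℝ-Sums.triangle A B (n ℕ.+ m) - ℝ-Sums.∑ n A * ℝ-Sums.∑ m B)
  rectangle≤triangle {A} {B} 0≤A 0≤B zero m = 0≤-resp
    (solve 2 (λ t s → t := t :- con (pos 0) :* s) refl (ℝ-Sums.triangle A B m) (ℝ-Sums.∑ m B))
    (0≤-triangle 0≤A 0≤B m)
  rectangle≤triangle {A} {B} 0≤A 0≤B (suc n) m = 0≤-resp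
    (solve 5 (λ a x s s′ t → a :* (s :- s′) :+ (t :- x :* s′) := a :* s :+ t :- (a :+ x) :* s′) refl
      (A 0) (ℝ-Sums.∑ n λ i → A (suc i)) (ℝ-Sums.∑ (suc n ℕ.+ m) B) (ℝ-Sums.∑ m B)
      (ℝ-Sums.triangle (λ i → A (suc i)) B (n ℕ.+ m)))
    (+-nonneg (0≤-* (0≤A 0) (0≤-tail 0≤B (suc n) m)) (rectangle≤triangle (λ i → 0≤A (suc i)) 0≤B n m))

  1/! : ℕ → Carrier
  1/! k = recip (k !) {{ℕₚ._!≢0 k}}

  0<1/! : ∀ k → 0# < 1/! k
  0<1/! k = recip-pos (k !) {{ℕₚ._!≢0 k}}

  1/0!≈1 : 1/! 0 ≈ 1#
  1/0!≈1 = trans (sym (trans (*-congʳ (+-identityʳ 1#)) (*-identityˡ _))) (recip-inverse 1)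

  realTerm : Carrier → ℕ → Carrier
  realTerm x k = 1/! k * x ^ k

  realTerm-step : ∀ x k → fromℕ (suc k) * realTerm x (suc k) ≈ x * realTerm x k
  realTerm-step x k = trans
    (solve 4 (λ n r x y → n :* (r :* (x :* y)) := x :* (r :* n :* y)) refl (fromℕ (suc k)) (1/! (suc k)) x (x ^ k))
    (*-congˡ (*-congʳ (recip-! k)))

  realTerm-exponential : ∀ x → ℝ-Sums.ExponentialOf x (realTerm x)
  realTerm-exponential x = record
    { head = trans (*-identityʳ _) 1/0!≈1
    ; step = realTerm-step x
    }

  expTerm-exponential : ∀ z → ℂ-Sums.ExponentialOf z (expTerm z)
  expTerm-exponential z = record
    { head = trans (*-identityʳ _) 1/0!≈1 , zeroʳ _
    ; step = λ k → ≈ᶜ-trans (*ᶜ-congʳ {x = expTerm z (suc k)} (≈ᶜ-sym (fromℕᶜ≈·1 (suc k))))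
        (step (fromℕ (suc k)) (1/! (suc k)) (1/! k) (recip-! k) (re z) (im z) (re (z ^ᶜ k)) (im (z ^ᶜ k)))
    }
    where
    step : ∀ n r′ r → r′ * n ≈ r → ∀ a b x y →
      (n * (r′ * (a * x - b * y)) - 0# * (r′ * (a * y + b * x)) ≈ a * (r * x) - b * (r * y)) ×
      (n * (r′ * (a * y + b * x)) + 0# * (r′ * (a * x - b * y)) ≈ a * (r * y) + b * (r * x))
    step n r′ r e a b x y =
      trans (solve 6 (λ n r a b x y → n :* (r :* (a :* x :- b :* y)) :- con (pos 0) :* (r :* (a :* y :+ b :* x))
          := a :* (r :* n :* x) :- b :* (r :* n :* y)) refl n r′ a b x y)
        (+-cong (*-congˡ (*-congʳ e)) (-‿cong (*-congˡ (*-congʳ e)))) ,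
      trans (solve 6 (λ n r a b x y → n :* (r :* (a :* y :+ b :* x)) :+ con (pos 0) :* (r :* (a :* x :- b :* y))
          := a :* (r :* n :* y) :+ b :* (r :* n :* x)) refl n r′ a b x y)
        (+-cong (*-congˡ (*-congʳ e)) (*-congˡ (*-congʳ e)))

  -- Twice a natural number bounding both coordinates of z, since
  -- |re (z w)| , |im (z w)| ≤ 2 m t for coordinates bounded by m and t.
  size : ℂ → ℕ
  size z = m ℕ.+ m
    where
    m : ℕ
    m = suc (proj₁ (bound (re z)) ℕ.+ proj₁ (bound (im z)))

  expTerm-dominated : ∀ z k → Dominated (realTerm (fromℕ (size z)) k) (expTerm z k)
  expTerm-dominated z k = Within-* (Within-self (0<⇒0≤ (0<1/! k))) (proj₁ (powers k)) ,
    Within-* (Within-self (0<⇒0≤ (0<1/! k))) (proj₂ (powers k))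
    where
    m p q : ℕ
    p = proj₁ (bound (re z))
    q = proj₁ (bound (im z))
    m = suc (p ℕ.+ q)
    weaken : ∀ {x k} → k ℕ.≤ m → Bounded (fromℕ k) x → Within (fromℕ m) x
    weaken k≤m (h , h′) = Bounded⇒Within (<-fromℕ-mono k≤m h , <-fromℕ-mono k≤m h′)
    z≤m : Dominated (fromℕ m) z
    z≤m = weaken (ℕₚ.m≤n⇒m≤1+n (ℕₚ.m≤m+n p q)) (proj₂ (bound (re z))) ,
      weaken (ℕₚ.m≤n⇒m≤1+n (ℕₚ.m≤n+m q p)) (proj₂ (bound (im z)))
    powers : ∀ k → Dominated (fromℕ (size z) ^ k) (z ^ᶜ k)
    powers zero    = Within-self (0<⇒0≤ 0<1) , Within-0 (0<⇒0≤ 0<1)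
    powers (suc k) = Dominated-resp
      (sym (trans (*-congʳ (×-homo-+ 1# m m)) (distribʳ _ _ _))) ≈ᶜ-refl
      (Dominated-* z≤m (powers k))

  ∑realTerm-cauchy : ∀ m .{{_ : NonZero m}} → Cauchy λ n → ℝ-Sums.∑ n (realTerm (fromℕ m))
  -- The majorant is doubled because `Bounded` is strict while each increment equals `D k`.
  ∑realTerm-cauchy m@(suc m′) = exponential⇒cauchy _ (λ k → D k + D k) m
    (λ k → +-pos (0<D k) (0<D k))
    (λ k → trans (solve 2 (λ d n → (d :+ d) :* n := n :* d :+ n :* d) refl (D (suc k)) (fromℕ (suc k)))
      (trans (+-cong (realTerm-step _ k) (realTerm-step _ k))
        (solve 2 (λ x d → x :* d :+ x :* d := (d :+ d) :* x) refl (fromℕ m) (D k))))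
    (λ k → Within⇒Bounded
      (Within-resp refl (trans (solve 2 (λ s d → d := s :+ d :- s) refl (ℝ-Sums.∑ k D) (D k))
        (+-congʳ (sym (ℝ-Sums.∑-last k D)))) (Within-self (0<⇒0≤ (0<D k))))
      (0<y-x⇒x<y (<-respʳ-≈ (solve 1 (λ d → d := d :+ d :- d) refl (D k)) (0<D k))))
    where
    D : ℕ → Carrier
    D = realTerm (fromℕ m)
    0<D : ∀ k → 0# < D k
    0<D k = *-pos (0<1/! k) (go k)
      where
      go : ∀ k → 0# < fromℕ m ^ k
      go zero    = 0<1
      go (suc k) = *-pos (fromℕ-pos m′) (go k)

  expSum⇝exp : ∀ z → expSum z ⇝ᶜ exp z
  expSum⇝exp z = coordinates
    (limit (proj₂ (complete _ (expSum-re-cauchy z)))) (limit (proj₂ (complete _ (expSum-im-cauchy z))))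
    where
    limit : ∀ {s x} → s ⟶ x → s ⇝ x
    limit {s} {x} h ε 0<ε = proj₁ (h ε 0<ε) , λ n N≤n → proj₁ (proj₂ (h ε 0<ε) n N≤n) ,
      <-respˡ-≈ (solve 2 (λ s x → x :- s := :- (s :- x)) refl (s n) x) (proj₂ (proj₂ (h ε 0<ε) n N≤n))

  ∑expTerm⇝exp : ∀ z → (λ n → ℂ-Sums.∑ n (expTerm z)) ⇝ᶜ exp z
  ∑expTerm⇝exp z = ⇝ᶜ-congˡ (λ n → ∑<≈∑ n (expTerm z)) (expSum⇝exp z)

  -- `complete` chooses a limit from a sequence and is not assumed to respect `≈`; the two choices
  -- agree because limits are unique.
  exp-cong : ∀ {z w} → z ≈ᶜ w → exp z ≈ᶜ exp w
  exp-cong {z} {w} z≈w = ⇝ᶜ-unique (∑expTerm⇝exp z)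
    (⇝ᶜ-congˡ (λ n → ℂ-Sums.∑-cong n λ k →
      ∙ᶜ-congˡ (^ᶜ-congˡ k (≈ᶜ-sym z≈w))) (∑expTerm⇝exp w))
    where
    ∙ᶜ-congˡ : ∀ {x z w} → z ≈ᶜ w → x ∙ᶜ z ≈ᶜ x ∙ᶜ w
    ∙ᶜ-congˡ (p , q) = *-congˡ p , *-congˡ q

  -- The products of partial sums exceed the triangular sums by terms that
  -- are dominated by a section of the real exponential series.
  gap⇝0 : ∀ z w → (λ n → ℂ-Sums.∑ n (expTerm z) *ᶜ ℂ-Sums.∑ n (expTerm w)
    -ᶜ ℂ-Sums.triangle (expTerm z) (expTerm w) n) ⇝ᶜ 0ᶜ
  gap⇝0 z w = coordinates (coordinate (λ n → proj₁ (gap-dominated n))) (coordinate (λ n → proj₂ (gap-dominated n)))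
    where
    a b : ℕ → ℂ
    a = expTerm z
    b = expTerm w
    A B : ℕ → Carrier
    A = realTerm (fromℕ (size z))
    B = realTerm (fromℕ (size w))
    M : ℕ
    M = size z ℕ.+ size w
    gap : ℕ → ℂ
    gap n = ℂ-Sums.∑ n a *ᶜ ℂ-Sums.∑ n b -ᶜ ℂ-Sums.triangle a b n
    D : ℕ → Carrier
    D = realTerm (fromℕ M)
    0≤A : ∀ i → 0≤ A i
    0≤A i = Dominated⇒0≤ {z = a i} (expTerm-dominated z i)
    0≤B : ∀ i → 0≤ B i
    0≤B i = Dominated⇒0≤ {z = b i} (expTerm-dominated w i)
    real-triangle : ∀ n → ℝ-Sums.triangle A B n ≈ ℝ-Sums.∑ n D
    real-triangle = ℝ-Sums.triangle-exponential (λ k → recip (suc k)) (λ k → recip-inverse (suc k))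
      (realTerm-exponential _) (realTerm-exponential _) (record
        { head = ℝ-Sums.ExponentialOf.head (realTerm-exponential (fromℕ M))
        ; step = λ k → trans (realTerm-step (fromℕ M) k) (*-congʳ (×-homo-+ 1# (size z) (size w)))
        })
    real-gap : ℕ → Carrier
    real-gap n = ℝ-Sums.∑ n A * ℝ-Sums.∑ n B - ℝ-Sums.triangle A B n
    -- The n by n square lies in the triangle of size n + n, so its excess over the triangle of size
    -- n is at most the section from n to n + n of the exponential series at M.
    real-gap≤ : ∀ n → 0≤ ((ℝ-Sums.∑ (n ℕ.+ n) D - ℝ-Sums.∑ n D) - real-gap n)
    real-gap≤ n = 0≤-resp (trans
      (solve 3 (λ t r s → t :- r := t :- s :- (r :- s)) refl
        (ℝ-Sums.triangle A B (n ℕ.+ n)) (ℝ-Sums.∑ n A * ℝ-Sums.∑ n B) (ℝ-Sums.triangle A B n))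
      (+-congʳ (+-cong (real-triangle (n ℕ.+ n)) (-‿cong (real-triangle n)))))
      (rectangle≤triangle 0≤A 0≤B n n)
    gap-dominated : ∀ n → Dominated (real-gap n + real-gap n) (gap n)
    gap-dominated n = Dominated-rectangle (expTerm-dominated z) (expTerm-dominated w) n 0
    small : ∀ ε → 0# < ε → ∃ λ N → ∀ n → N ℕ.≤ n → real-gap n + real-gap n < (1# + 1#) * ε
    small ε 0<ε = proj₁ cauchy , λ n N≤n → <-respʳ-≈
      (sym (trans (distribʳ ε 1# 1#) (+-cong (*-identityˡ ε) (*-identityˡ ε))))
      (+-mono-< (below n N≤n) (below n N≤n))
      where
      cauchy : ∃ λ N → ∀ m n → N ℕ.≤ m → N ℕ.≤ n → ℝ-Sums.∑ m D - ℝ-Sums.∑ n D < ε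
      cauchy = ∑realTerm-cauchy M ε 0<ε
      below : ∀ n → proj₁ cauchy ℕ.≤ n → real-gap n < ε
      below n N≤n = 0≤y-x∧y<z⇒x<z (real-gap≤ n)
        (proj₂ cauchy (n ℕ.+ n) n (ℕₚ.≤-trans N≤n (ℕₚ.m≤m+n n n)) N≤n)
    coordinate : ∀ {s} → (∀ n → Within (real-gap n + real-gap n) (s n)) → s ⇝ 0#
    coordinate {s} h = ⇝-rescale (1# + 1#) (+-pos 0<1 0<1) λ ε 0<ε →
      proj₁ (small ε 0<ε) , λ n N≤n →
        Bounded-resp refl (sym (x-0≈x (s n))) (Within⇒Bounded (h n) (proj₂ (small ε 0<ε) n N≤n))

  triangle-expTerm : ∀ {u} z w → u ≈ᶜ z +ᶜ w → ∀ n →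
    ℂ-Sums.triangle (expTerm z) (expTerm w) n ≈ᶜ ℂ-Sums.∑ n (expTerm u)
  triangle-expTerm {u} z w u≈z+w = ℂ-Sums.triangle-exponential (λ k → ofℝ (recip (suc k))) inverse
    (expTerm-exponential z) (expTerm-exponential w) (record
      { head = ℂ-Sums.ExponentialOf.head (expTerm-exponential u)
      ; step = λ k → ≈ᶜ-trans (ℂ-Sums.ExponentialOf.step (expTerm-exponential u) k) (*ᶜ-congʳ {x = expTerm u k} u≈z+w)
      })
    where
    inverse : ∀ k → (suc k ·ᶜ 1ᶜ) *ᶜ ofℝ (recip (suc k)) ≈ᶜ 1ᶜ
    inverse k = ≈ᶜ-trans (*ᶜ-congʳ {x = ofℝ (recip (suc k))} (≈ᶜ-sym (fromℕᶜ≈·1 (suc k))))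
      (≈ᶜ-trans (≈ᶜ-sym (ofℝ-* _ _)) (ofℝ-cong (recip-inverse (suc k))))

  ⇝-product : ∀ {s t u x y v} → s ⇝ᶜ x → t ⇝ᶜ y → u ⇝ᶜ v →
    (λ n → s n *ᶜ t n -ᶜ u n) ⇝ᶜ 0ᶜ → v ≈ᶜ x *ᶜ y
  ⇝-product {s} {t} {u} {x} {y} {v} s⇝x t⇝y u⇝v gap = ≈ᶜ-sym (x-y≈0⇒x≈y (x *ᶜ y) v (⇝ᶜ-unique
      (⇝ᶜ-- {s = λ n → s n *ᶜ t n} {t = u} {z = x *ᶜ y} {w = v}
        (⇝ᶜ-* {s = s} {t = t} {z = x} {w = y} s⇝x t⇝y) u⇝v)
      gap))
    where
    open import Algebra.Properties.Ring (CommutativeRing.ring ℂ-commutativeRing)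
      using () renaming (x∙y⁻¹≈ε⇒x≈y to x-y≈0⇒x≈y)

  -- Stated for any u equal to z + w up to `≈ᶜ`, because it is applied to real multiples of a
  -- logarithm, which become sums only after distributing.
  exp-+ : ∀ {u} z w → u ≈ᶜ z +ᶜ w → exp u ≈ᶜ exp z *ᶜ exp w
  exp-+ {u} z w u≈z+w = ⇝-product (∑expTerm⇝exp z) (∑expTerm⇝exp w)
    (⇝ᶜ-congˡ (λ n → ≈ᶜ-sym (triangle-expTerm z w u≈z+w n)) (∑expTerm⇝exp u)) (gap⇝0 z w)

-- Real powers of q and of q^f

module RealPowers {c ℓ₁ ℓ₂ : Level} (R : RealNumbers c ℓ₁ ℓ₂) where
  open RealNumbers R
  open OrderedField R
  open Complex R
  open QEuler R
  open ComplexRing R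
  open Exponential R

  exp-shift : ∀ {q} w → exp w ≈ᶜ q → ∀ m {u z} → u ≈ᶜ fromℕ m ∙ᶜ w +ᶜ z → exp u ≈ᶜ q ^ᶜ m *ᶜ exp z
  exp-shift {q} w hw zero    {u} {z} u≈z = ≈ᶜ-trans {exp u} {exp z} (exp-cong {u} {z} (≈ᶜ-trans u≈z (0+ (re w) (re z) , 0+ (im w) (im z))))
    (≈ᶜ-sym (*ᶜ-identityˡ (exp z)))
    where
    0+ : ∀ a b → 0# * a + b ≈ b
    0+ a b = trans (+-congʳ (zeroˡ a)) (+-identityˡ b)
  exp-shift {q} w hw (suc m) {u} {z} u≈ = go ((fromℕ m ∙ᶜ w) +ᶜ z) ≈ᶜ-refl
    where
    split : ∀ n a b → (1# + n) * a + b ≈ a + (n * a + b)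
    split n a b = trans (+-congʳ (trans (distribʳ a 1# n) (+-congʳ (*-identityˡ a)))) (+-assoc a (n * a) b)
    go : ∀ v → v ≈ᶜ (fromℕ m ∙ᶜ w) +ᶜ z → exp u ≈ᶜ (q *ᶜ q ^ᶜ m) *ᶜ exp z
    go v v≈ = ≈ᶜ-trans {exp u} {exp w *ᶜ exp v}
      (exp-+ {u} w v (≈ᶜ-trans u≈ (≈ᶜ-trans (split (fromℕ m) (re w) (re z) , split (fromℕ m) (im w) (im z))
        (+ᶜ-congˡ {x = w} (≈ᶜ-sym v≈)))))
      (≈ᶜ-trans (*ᶜ-cong {exp w} {q} {exp v} {q ^ᶜ m *ᶜ exp z} hw (exp-shift w hw m {v} {z} v≈))
        (≈ᶜ-sym (*ᶜ-assoc q (q ^ᶜ m) (exp z))))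

  -- Shifting n times, down to `exp w` instead of exp 0, ends at the given value q.
  exp-multiple : ∀ {q} w → exp w ≈ᶜ q → ∀ n {u} → u ≈ᶜ fromℕ (suc n) ∙ᶜ w → exp u ≈ᶜ q ^ᶜ suc n
  exp-multiple {q} w hw n {u} u≈ = ≈ᶜ-trans {exp u} {q ^ᶜ n *ᶜ exp w}
    (exp-shift w hw n {u} {w} (≈ᶜ-trans u≈ (split (re w) , split (im w))))
    (≈ᶜ-trans {q ^ᶜ n *ᶜ exp w} {q ^ᶜ n *ᶜ q} (*ᶜ-congˡ {x = q ^ᶜ n} hw) (*ᶜ-comm (q ^ᶜ n) q))
    where
    split : ∀ a → (1# + fromℕ n) * a ≈ fromℕ n * a + a
    split a = trans (distribʳ a 1# (fromℕ n)) (trans (+-congʳ (*-identityˡ a)) (+-comm a (fromℕ n * a)))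

  pow-shift : ∀ {q} b → b isBranchOf q → ∀ {u x} m → u ≈ fromℕ m + x → pow b u ≈ᶜ q ^ᶜ m *ᶜ pow b x
  pow-shift (logarithm w) hw {u} {x} m u≈ = exp-shift w hw m {u ∙ᶜ w} {x ∙ᶜ w} (coordinate (re w) , coordinate (im w))
    where
    coordinate : ∀ a → u * a ≈ fromℕ m * a + x * a
    coordinate a = trans (*-congʳ u≈) (distribʳ a (fromℕ m) x)
  pow-shift {q} vanishing     hq m u≈ = ≈ᶜ-sym (ℂ-Ring.zeroʳ (q ^ᶜ m))

  -- (y / f)(f w) = y w: with the logarithm f w of q^f, the power (q^f)^(y/f) is q^y exactly, and no
  -- period of the exponential intervenes.
  pow-branch^ : ∀ b f .{{_ : NonZero f}} {u y} → u ≈ y * recip f → pow (branch^ f b) u ≈ᶜ pow b y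
  pow-branch^ (logarithm w) f {u} {y} u≈ = exp-cong {u ∙ᶜ (fromℕ f ∙ᶜ w)} {y ∙ᶜ w} (coordinate (re w) , coordinate (im w))
    where
    coordinate : ∀ a → u * (fromℕ f * a) ≈ y * a
    coordinate a = trans (*-congʳ u≈) (trans
      (solve 4 (λ y r n a → y :* r :* (n :* a) := n :* r :* (y :* a)) refl y (recip f) (fromℕ f) a)
      (trans (*-congʳ (recip-inverse f)) (*-identityˡ _)))
  pow-branch^ vanishing     f u≈ = ≈ᶜ-refl

  branch^-isBranchOf : ∀ {q} b → b isBranchOf q → ∀ f .{{_ : NonZero f}} → branch^ f b isBranchOf (q ^ᶜ f)
  branch^-isBranchOf {q} (logarithm w) hw (suc f) = exp-multiple w hw f {fromℕ (suc f) ∙ᶜ w} ≈ᶜ-refl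
  branch^-isBranchOf {q} vanishing     hq (suc f′) = ≈ᶜ-trans (*ᶜ-congʳ {x = q ^ᶜ f′} hq) (ℂ-Ring.zeroˡ (q ^ᶜ f′))

  admissible-quotient : ∀ b f .{{_ : NonZero f}} {x} k → Admissible b x →
    Admissible (branch^ f b) ((fromℕ k + x) * recip f)
  admissible-quotient (logarithm w) f k h = _
  admissible-quotient vanishing     f {x} k 0<x = *-pos (0<k+x k) (recip-pos f)
    where
    0<k+x : ∀ k → 0# < fromℕ k + x
    0<k+x zero    = <-respʳ-≈ (sym (+-identityˡ x)) 0<x
    0<k+x (suc k) = +-pos (fromℕ-pos k) 0<x

-- The left neighbourhoods of 1

module LeftOfOne {c ℓ₁ ℓ₂ : Level} (R : RealNumbers c ℓ₁ ℓ₂) where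
  open RealNumbers R
  open OrderedField R
  open Estimates R

  Interval : Set (c ⊔ ℓ₂)
  Interval = Σ Carrier λ s → 0# < s × s < 1#

  -- Replaces a minimum, which would require deciding the order: cotransitivity of x / 2 < x at y
  -- tells which of x / 2 and y / 2 to take.
  common-lower : ∀ {x y} → 0# < x → 0# < y → ∃ λ z → 0# < z × z < x × z < y
  common-lower {x} {y} 0<x 0<y = [ (λ h<y → h , 0<h , h<x , h<y) , (λ y<x → k , 0<k , <-trans k<y y<x , k<y) ]′
    (<-cotrans h<x y)
    where
    h k : Carrier
    h = recip 2 * x
    k = recip 2 * y
    0<h : 0# < h
    0<h = *-pos (recip-pos 2) 0<x
    0<k : 0# < k
    0<k = *-pos (recip-pos 2) 0<y
    half< : ∀ {x} → 0# < recip 2 * x → recip 2 * x < x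
    half< {x} 0<h = 0<y-x⇒x<y (<-respʳ-≈ (trans
      (solve 2 (λ r x → r :* x := con (pos 2) :* r :* x :- r :* x) refl (recip 2) x)
      (+-congʳ (trans (*-congʳ (recip-inverse 2)) (*-identityˡ x)))) 0<h)
    h<x : h < x
    h<x = half< 0<h
    k<y : k < y
    k<y = half< 0<k

  minus-antitone : ∀ {x y} → x < y → 1# - y < 1# - x
  minus-antitone {x} {y} x<y = 0<y-x⇒x<y (<-respʳ-≈
    (solve 3 (λ e x y → y :- x := e :- x :- (e :- y)) refl 1# x y) (x<y⇒0<y-x x<y))

  leftOf1 : Filter Interval ℓ₂ (c ⊔ ℓ₂)
  leftOf1 = record
    { Eventually = λ P → ∃ λ δ → 0# < δ × (∀ i → 1# - δ < proj₁ i → P i)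
    ; map        = λ P⇒Q (δ , 0<δ , h) → δ , 0<δ , λ i near → P⇒Q i (h i near)
    ; zip        = λ (δ , 0<δ , h) (δ′ , 0<δ′ , h′) → both h h′ (common-lower 0<δ 0<δ′)
    ; always     = λ h → 1# , 0<1 , λ i _ → h i
    ; witness    = λ (δ , 0<δ , h) → point h (common-lower 0<δ 0<1)
    }
    where
    both : ∀ {P Q : Interval → Set ℓ₂} {δ δ′} → (∀ i → 1# - δ < proj₁ i → P i) → (∀ i → 1# - δ′ < proj₁ i → Q i) →
      (∃ λ η → 0# < η × η < δ × η < δ′) → ∃ λ η → 0# < η × (∀ i → 1# - η < proj₁ i → P i × Q i)
    both h h′ (η , 0<η , η<δ , η<δ′) = η , 0<η , λ i near →
      h i (<-trans (minus-antitone η<δ) near) , h′ i (<-trans (minus-antitone η<δ′) near)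
    point : ∀ {P : Interval → Set ℓ₂} {δ} → (∀ i → 1# - δ < proj₁ i → P i) →
      (∃ λ η → 0# < η × η < δ × η < 1#) → ∃ P
    point h (η , 0<η , η<δ , η<1) = i , h i (minus-antitone η<δ)
      where
      i : Interval
      i = 1# - η , x<y⇒0<y-x η<1 , <-respʳ-≈ (x-0≈x 1#) (minus-antitone 0<η)

-- Abel sums of combinations of powers

module AbelSums {c ℓ₁ ℓ₂ : Level} (R : RealNumbers c ℓ₁ ℓ₂) where
  open RealNumbers R
  open OrderedField R
  open Estimates R
  open Complex R
  open QEuler R
  open ComplexRing R
  open LeftOfOne R
  module ℂ-Ring = CommutativeRing ℂ-commutativeRing
  module ℂ-Algebra = QAlgebra ℂ-commutativeRing
  module Seq = ComplexLimits R (atTop {ℓ₂})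
  module Abel = ComplexLimits R leftOf1
  open import Algebra.Properties.CommutativeSemiring.Exp ℂ-commutativeSemiring
    using () renaming (^-distrib-* to ^ᶜ-distrib-*)
  open import Algebra.Properties.Ring ℂ-Ring.ring using () renaming (-‿distribʳ-* to -ᶜ-distribʳ-*)

  ∑ᵗ≈∑ʳ : ∀ r N a → ∑ᵗ r N a ≈ᶜ ℂ-Sums.∑ʳ r N a
  ∑ᵗ≈∑ʳ zero    N a = ≈ᶜ-refl
  ∑ᵗ≈∑ʳ (suc r) N a = ≈ᶜ-trans (∑<≈∑ N _) (ℂ-Sums.∑-cong N λ m → ∑ᵗ≈∑ʳ r N λ ms → a (m ∷ ms))

  hasSum-unique : ∀ {r} {a : Vec ℕ r → ℂ} {S T} → HasSum a S → HasSum a T → S ≈ᶜ T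
  hasSum-unique {r} {a} {S} {T} h k = Seq.⇝ᶜ-unique (hasSum⇒⇝ S h) (hasSum⇒⇝ T k)
    where
    hasSum⇒⇝ : ∀ S → HasSum a S → (λ N → ∑ᵗ r N a) Seq.⇝ᶜ S
    hasSum⇒⇝ S = Seq.∣∣<⇒⇝ᶜ {s = λ N → ∑ᵗ r N a} {z = S}

  module _ {r : ℕ} (a : Vec ℕ r → ℂ) (V : Interval → ℂ)
    (hasSum : ∀ i → HasSum (λ m → (proj₁ i ^ Vec.sum m) ∙ᶜ a m) (V i)) where

    hasAbelSum : ∀ {S} → V Abel.⇝ᶜ S → HasAbelSum a S
    hasAbelSum {S} V⇝S ε 0<ε = proj₁ close , proj₁ (proj₂ close) , λ s 0<s s<1 near →
      V (s , 0<s , s<1) , hasSum (s , 0<s , s<1) , proj₂ (proj₂ close) (s , 0<s , s<1) near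
      where
      close : ∃ λ δ → 0# < δ × (∀ i → 1# - δ < proj₁ i → ∣ V i -ᶜ S ∣< ε)
      close = Abel.⇝ᶜ⇒∣∣< {s = V} {z = S} V⇝S ε 0<ε

    -- `HasAbelSum` brings its own damped sum for each s; uniqueness of sums identifies it with `V`.
    hasAbelSum⇒⇝ : ∀ {S} → HasAbelSum a S → V Abel.⇝ᶜ S
    hasAbelSum⇒⇝ {S} H = Abel.∣∣<⇒⇝ᶜ {s = V} {z = S} λ ε 0<ε →
      proj₁ (H ε 0<ε) , proj₁ (proj₂ (H ε 0<ε)) , λ i near →
        same i (proj₂ (proj₂ (H ε 0<ε)) (proj₁ i) (proj₁ (proj₂ i)) (proj₂ (proj₂ i)) near)
      where
      same : ∀ i {ε} → (∃ λ V′ → HasSum (λ m → (proj₁ i ^ Vec.sum m) ∙ᶜ a m) V′ × ∣ V′ -ᶜ S ∣< ε) → ∣ V i -ᶜ S ∣< ε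
      same i (V′ , sum′ , 0<ε , close) =
        0<ε , <-respˡ-≈ (normSq-cong {V′ -ᶜ S} {V i -ᶜ S} (+-congʳ (proj₁ V′≈V) , +-congʳ (proj₂ V′≈V))) close
        where
        V′≈V : V′ ≈ᶜ V i
        V′≈V = hasSum-unique {a = λ m → (proj₁ i ^ Vec.sum m) ∙ᶜ a m} {V′} {V i} sum′ (hasSum i)

  -- `normSq` is multiplicative, so it is enough that the real powers of `normSq z` fall below ε².
  1-power-vanishes : ∀ {z} → ∣ z ∣< 1# → (λ n → 1ᶜ -ᶜ z ^ᶜ n) Seq.⇝ᶜ 1ᶜ
  1-power-vanishes {z} (_ , N<1) = Seq.∣∣<⇒⇝ᶜ {s = λ n → 1ᶜ -ᶜ z ^ᶜ n} {z = 1ᶜ} λ ε 0<ε →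
    proj₁ (vanish ε 0<ε) , λ n N≤n → 0<ε , <-respˡ-≈
      (trans (sym (normSq-^ z n))
        (solve 4 (λ e o x y → x :* x :+ y :* y := (e :- x :- e) :* (e :- x :- e) :+ (o :- y :- o) :* (o :- y :- o))
          refl 1# 0# (re (z ^ᶜ n)) (im (z ^ᶜ n))))
      (proj₂ (vanish ε 0<ε) n N≤n)
    where
    vanish : ∀ ε → 0# < ε → ∃ λ N → ∀ n → N ℕ.≤ n → normSq z ^ n < ε * ε
    vanish ε 0<ε = powers-vanish (+-nonneg (x²≮0 (re z)) (x²≮0 (im z)))
      (<-respʳ-≈ (*-identityˡ 1#) N<1) (ε * ε) (*-pos 0<ε 0<ε)

  -- The weight s^(m₁ + ⋯ + m_r) is absorbed into the bases, turning each u l into s u l of modulus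
  -- below 1, so the cube sums are powers of convergent geometric sums. The bound on u l is
  -- nonstrict to admit u 0 = q^0 = 1; at s = 1 it is `1+u#0` that keeps the inverses continuous.
  module PowerSums (r n : ℕ) (γ u : ℕ → ℂ) (a : Vec ℕ r → ℂ)
    (∣u∣≤1 : ∀ l → 0≤ (1# - normSq (u l))) (1+u#0 : ∀ l → (1ᶜ +ᶜ u l) #ᶜ0)
    (a≈ : ∀ m → a m ≈ᶜ ℂ-Sums.∑ n λ l → γ l *ᶜ (-ᶜ u l) ^ᶜ Vec.sum m) where

    private
      su : Interval → ℕ → ℂ
      su (s , _) l = ofℝ s *ᶜ u l

      ∣su∣<1 : ∀ i l → ∣ su i l ∣< 1#
      ∣su∣<1 (s , 0<s , s<1) l = 0<1 , <-resp (sym norm) (sym (*-identityˡ 1#)) s²N<1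
        where
        N s² : Carrier
        N = normSq (u l)
        s² = s * s
        norm : normSq (ofℝ s *ᶜ u l) ≈ s² * N
        norm = trans (normSq-* (ofℝ s) (u l)) (*-congʳ (trans (+-congˡ (zeroˡ 0#)) (+-identityʳ _)))
        s²<1 : s² < 1#
        s²<1 = <-trans (*-monoˡ-<-pos 0<s s<1) (<-respˡ-≈ (sym (*-identityˡ s)) s<1)
        s²N<1 : s² * N < 1#
        s²N<1 = 0≤y-x∧y<z⇒x<z
          (0≤-resp (trans (distribˡ s² 1# (- N)) (+-cong (*-identityʳ s²) (solve 2 (λ s n → s :* :- n := :- (s :* n)) refl s² N)))
            (0≤-* (0<⇒0≤ (*-pos 0<s 0<s)) (∣u∣≤1 l))) s²<1

      v : Interval → ℕ → ℂ
      v i l = (1ᶜ +ᶜ su i l) ⁻¹ᶜ[ ∣z∣<1⇒1+z#0 (∣su∣<1 i l) ]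

      v∞ : ℕ → ℂ
      v∞ l = (1ᶜ +ᶜ u l) ⁻¹ᶜ[ 1+u#0 l ]

      V : Interval → ℂ
      V i = ℂ-Sums.∑ n λ l → γ l *ᶜ v i l ^ᶜ r

      ∣-z∣<1 : ∀ {z} → ∣ z ∣< 1# → ∣ -ᶜ z ∣< 1#
      ∣-z∣<1 {z} (0<1 , p) = 0<1 , <-respˡ-≈
        (solve 2 (λ x y → x :* x :+ y :* y := :- x :* :- x :+ :- y :* :- y) refl (re z) (im z)) p

      geometric : ∀ i l → (λ N → ℂ-Sums.∑ N ((-ᶜ su i l) ^ᶜ_)) Seq.⇝ᶜ v i l
      geometric i l = Seq.⇝ᶜ-cong
        {s = λ N → v i l *ᶜ (1ᶜ -ᶜ (-ᶜ su i l) ^ᶜ N)} {t = λ N → ℂ-Sums.∑ N ((-ᶜ su i l) ^ᶜ_)} {z = v i l *ᶜ 1ᶜ} {w = v i l}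
        (ℂ-Algebra.∑-geometric-inverse (*ᶜ-inverseʳ (1ᶜ +ᶜ su i l) (∣z∣<1⇒1+z#0 (∣su∣<1 i l))))
        (*ᶜ-identityʳ (v i l))
        (Seq.⇝ᶜ-* {s = λ _ → v i l} {t = λ N → 1ᶜ -ᶜ (-ᶜ su i l) ^ᶜ N} {z = v i l} {w = 1ᶜ}
          (Seq.⇝ᶜ-const (v i l)) (1-power-vanishes (∣-z∣<1 (∣su∣<1 i l))))

      damped : ∀ i m → (proj₁ i ^ Vec.sum m) ∙ᶜ a m ≈ᶜ ℂ-Sums.∑ n λ l → γ l *ᶜ (-ᶜ su i l) ^ᶜ Vec.sum m
      damped i@(s , _) m = begin
        (s ^ k) ∙ᶜ a m                                     ≈⟨ ∙ᶜ≈ofℝ-* (s ^ k) (a m) ⟩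
        ofℝ (s ^ k) *ᶜ a m                                 ≈⟨ *ᶜ-cong (ofℝ-^ s k) (a≈ m) ⟩
        ofℝ s ^ᶜ k *ᶜ ℂ-Sums.∑ n (λ l → γ l *ᶜ (-ᶜ u l) ^ᶜ k)  ≈⟨ ℂ-Sums.*-distribˡ-∑ n _ _ ⟩
        ℂ-Sums.∑ n (λ l → ofℝ s ^ᶜ k *ᶜ (γ l *ᶜ (-ᶜ u l) ^ᶜ k)) ≈⟨ ℂ-Sums.∑-cong n term ⟩
        ℂ-Sums.∑ n (λ l → γ l *ᶜ (-ᶜ su i l) ^ᶜ k)         ∎
        where
        open import Relation.Binary.Reasoning.Setoid ≈ᶜ-setoid
        k : ℕ
        k = Vec.sum m
        term : ∀ l → ofℝ s ^ᶜ k *ᶜ (γ l *ᶜ (-ᶜ u l) ^ᶜ k) ≈ᶜ γ l *ᶜ (-ᶜ su i l) ^ᶜ k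
        term l = begin
          ofℝ s ^ᶜ k *ᶜ (γ l *ᶜ (-ᶜ u l) ^ᶜ k)  ≈⟨ *ᶜ-assoc _ _ _ ⟨
          ofℝ s ^ᶜ k *ᶜ γ l *ᶜ (-ᶜ u l) ^ᶜ k    ≈⟨ *ᶜ-congʳ (*ᶜ-comm _ _) ⟩
          γ l *ᶜ ofℝ s ^ᶜ k *ᶜ (-ᶜ u l) ^ᶜ k    ≈⟨ *ᶜ-assoc _ _ _ ⟩
          γ l *ᶜ (ofℝ s ^ᶜ k *ᶜ (-ᶜ u l) ^ᶜ k)  ≈⟨ *ᶜ-congˡ (^ᶜ-distrib-* (ofℝ s) (-ᶜ u l) k) ⟨
          γ l *ᶜ (ofℝ s *ᶜ -ᶜ u l) ^ᶜ k         ≈⟨ *ᶜ-congˡ (^ᶜ-congˡ k (-ᶜ-distribʳ-* (ofℝ s) (u l))) ⟨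
          γ l *ᶜ (-ᶜ su i l) ^ᶜ k               ∎

      hasSum : ∀ i → HasSum (λ m → (proj₁ i ^ Vec.sum m) ∙ᶜ a m) (V i)
      hasSum i = Seq.⇝ᶜ⇒∣∣< {s = λ N → ∑ᵗ r N λ m → (proj₁ i ^ Vec.sum m) ∙ᶜ a m} {z = V i}
        (Seq.⇝ᶜ-congˡ {s = λ N → ℂ-Sums.∑ n λ l → γ l *ᶜ ℂ-Sums.∑ N ((-ᶜ su i l) ^ᶜ_) ^ᶜ r}
          (λ N → ≈ᶜ-sym (≈ᶜ-trans (∑ᵗ≈∑ʳ r N _) (≈ᶜ-trans (ℂ-Sums.∑ʳ-cong r N (damped i))
            (ℂ-Sums.∑ʳ-powers r N n γ λ l → -ᶜ su i l))))
          (Seq.⇝ᶜ-∑ n {s = λ N l → γ l *ᶜ ℂ-Sums.∑ N ((-ᶜ su i l) ^ᶜ_) ^ᶜ r} {z = λ l → γ l *ᶜ v i l ^ᶜ r} λ l →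
            Seq.⇝ᶜ-* {s = λ _ → γ l} {t = λ N → ℂ-Sums.∑ N ((-ᶜ su i l) ^ᶜ_) ^ᶜ r} {z = γ l} {w = v i l ^ᶜ r}
              (Seq.⇝ᶜ-const (γ l)) (Seq.⇝ᶜ-^ r (geometric i l))))

      ofℝ⇝1 : (λ i → ofℝ (proj₁ i)) Abel.⇝ᶜ 1ᶜ
      ofℝ⇝1 = Abel.coordinates
        (λ ε 0<ε → ε , 0<ε , λ (s , 0<s , s<1) near →
          <-trans (<-respʳ-≈ (-‿inverseʳ 1#) (+-monoˡ-< (- 1#) s<1)) 0<ε ,
          0<y-x⇒x<y (<-respʳ-≈ (solve 3 (λ s e d → s :- (e :- d) := d :- :- (s :- e)) refl s 1# ε) (x<y⇒0<y-x near)))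
        (Limits.⇝-const R leftOf1 0#)

      V⇝ : V Abel.⇝ᶜ ℂ-Sums.∑ n λ l → γ l *ᶜ v∞ l ^ᶜ r
      V⇝ = Abel.⇝ᶜ-∑ n {s = λ i l → γ l *ᶜ v i l ^ᶜ r} {z = λ l → γ l *ᶜ v∞ l ^ᶜ r} λ l →
        Abel.⇝ᶜ-* {s = λ _ → γ l} {t = λ i → v i l ^ᶜ r} {z = γ l} {w = v∞ l ^ᶜ r}
          (Abel.⇝ᶜ-const (γ l)) (Abel.⇝ᶜ-^ r (v⇝ l))
        where
        1+su⇝ : ∀ l → (λ i → 1ᶜ +ᶜ su i l) Abel.⇝ᶜ 1ᶜ +ᶜ u l
        1+su⇝ l = Abel.⇝ᶜ-+ {s = λ _ → 1ᶜ} {t = λ i → su i l} {z = 1ᶜ} {w = u l} (Abel.⇝ᶜ-const 1ᶜ)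
          (Abel.⇝ᶜ-cong {s = λ i → su i l} {t = λ i → su i l} {z = 1ᶜ *ᶜ u l} {w = u l} (λ i → ≈ᶜ-refl) (*ᶜ-identityˡ (u l))
            (Abel.⇝ᶜ-* {s = λ i → ofℝ (proj₁ i)} {t = λ _ → u l} {z = 1ᶜ} {w = u l} ofℝ⇝1 (Abel.⇝ᶜ-const (u l))))
        v⇝ : ∀ l → (λ i → v i l) Abel.⇝ᶜ v∞ l
        v⇝ l = Abel.⇝ᶜ-⁻¹ {s = λ i → 1ᶜ +ᶜ su i l} {z = 1ᶜ +ᶜ u l} (λ i → ∣z∣<1⇒1+z#0 (∣su∣<1 i l)) (1+u#0 l) (1+su⇝ l)

    abelSum : HasAbelSum a (ℂ-Sums.∑ n λ l → γ l *ᶜ v∞ l ^ᶜ r)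
    abelSum = hasAbelSum a V hasSum V⇝

    abelSum-unique : ∀ {S} → HasAbelSum a S → S ≈ᶜ ℂ-Sums.∑ n λ l → γ l *ᶜ v∞ l ^ᶜ r
    abelSum-unique H = Abel.⇝ᶜ-unique (hasAbelSum⇒⇝ a V hasSum H) V⇝

-- Existence and uniqueness of the q-Euler polynomials

module QEulerClosedForm {c ℓ₁ ℓ₂ : Level} (R : RealNumbers c ℓ₁ ℓ₂) where
  open RealNumbers R
  open OrderedField R
  open Estimates R
  open Complex R
  open QEuler R
  open ComplexRing R
  open Exponential R using (1/!)
  open RealPowers R
  open AbelSums R
  open ℂ-Algebra using (𝐜; closedForm; closedForm-scaled; alternating-bracket)

  -- IsQEuler freed of the proof of |q| < 1: [2]_q and 1 / (1 - q) become
  -- arbitrary numbers b and i.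
  IsAbelSum : (b i : ℂ) → Branch → ℕ → (ℕ → Carrier → ℂ) → Set (c ⊔ ℓ₁ ⊔ ℓ₂)
  IsAbelSum b i β r E = ∀ x → Admissible β x → ∀ n → ∃ λ S →
    HasAbelSum {r} (λ m → sign (Vec.sum m) *ᶜ
      expTerm ((1ᶜ -ᶜ pow β (fromℕ (Vec.sum m) + x)) *ᶜ i) n) S
    × b ^ᶜ r *ᶜ S ≈ᶜ (E n x /ᶜ (n !)) {{ℕₚ._!≢0 n}}

  module _ (q : ℂ) (∣q∣<1 : ∣ q ∣< 1#) where
    private
      i = 1/[1-q] q ∣q∣<1
      v = 1/[1+q^_] q ∣q∣<1
      b = [2] q ∣q∣<1

    1+q^-inverse : ∀ l → (1ᶜ +ᶜ q ^ᶜ l) *ᶜ v l ≈ᶜ 1ᶜ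
    1+q^-inverse l = *ᶜ-inverseʳ (1ᶜ +ᶜ q ^ᶜ l) (1+z^n#0 {q} ∣q∣<1 l)

    -- Equality occurs at l = 0, the term that converges only after damping.
    ∣q^l∣≤1 : ∀ l → 0≤ (1# - normSq (q ^ᶜ l))
    ∣q^l∣≤1 zero    = 0≤-resp (sym (trans (+-congˡ (-‿cong normSq-1)) (-‿inverseʳ 1#))) 0≤0
    ∣q^l∣≤1 (suc l) = 0<⇒0≤ (x<y⇒0<y-x (<-respʳ-≈ (*-identityˡ 1#) (proj₂ (∣z^n∣<1 ∣q∣<1 (suc l)))))

    -- Here p plays the role of q^x and P k that of q^(k + x), so that only the shift rule `P≈`
    -- enters; b and i stay free, as in `IsAbelSum`.
    module ClosedForm (b i : ℂ) (r n : ℕ) (p : ℂ) (P : ℕ → ℂ) (P≈ : ∀ k → P k ≈ᶜ q ^ᶜ k *ᶜ p) where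
      private
        ρ : ℂ
        ρ = ofℝ (1/! n)

        term : Vec ℕ r → ℂ
        term m = sign (Vec.sum m) *ᶜ expTerm ((1ᶜ -ᶜ P (Vec.sum m)) *ᶜ i) n

        γ : ℕ → ℂ
        γ l = ρ *ᶜ i ^ᶜ n *ᶜ 𝐜 n p l

        term≈ : ∀ m → term m ≈ᶜ ℂ-Sums.∑ (suc n) λ l → γ l *ᶜ (-ᶜ (q ^ᶜ l)) ^ᶜ Vec.sum m
        term≈ m = ≈ᶜ-trans {term m} {sign k *ᶜ (ρ *ᶜ ((1ᶜ -ᶜ q ^ᶜ k *ᶜ p) *ᶜ i) ^ᶜ n)}
          (*ᶜ-congˡ {sign k} {expTerm ((1ᶜ -ᶜ P k) *ᶜ i) n} {ρ *ᶜ ((1ᶜ -ᶜ q ^ᶜ k *ᶜ p) *ᶜ i) ^ᶜ n}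
            (≈ᶜ-trans {expTerm ((1ᶜ -ᶜ P k) *ᶜ i) n} {ρ *ᶜ ((1ᶜ -ᶜ P k) *ᶜ i) ^ᶜ n}
              (∙ᶜ≈ofℝ-* (1/! n) (((1ᶜ -ᶜ P k) *ᶜ i) ^ᶜ n))
              (*ᶜ-congˡ {ρ} {((1ᶜ -ᶜ P k) *ᶜ i) ^ᶜ n} {((1ᶜ -ᶜ q ^ᶜ k *ᶜ p) *ᶜ i) ^ᶜ n} (^ᶜ-congˡ n
                (*ᶜ-congʳ {i} {1ᶜ -ᶜ P k} {1ᶜ -ᶜ q ^ᶜ k *ᶜ p}
                  (+ᶜ-congˡ {1ᶜ} { -ᶜ P k} { -ᶜ (q ^ᶜ k *ᶜ p)} (-ᶜ-cong {P k} {q ^ᶜ k *ᶜ p} (P≈ k))))))))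
          (alternating-bracket ρ i q p n k)
          where
          k : ℕ
          k = Vec.sum m

        module Sums = PowerSums r (suc n) γ (λ l → q ^ᶜ l) term ∣q^l∣≤1 (1+z^n#0 {q} ∣q∣<1) term≈

        S : ℂ
        S = ℂ-Sums.∑ (suc n) λ l → γ l *ᶜ v l ^ᶜ r

        scaled : b ^ᶜ r *ᶜ S ≈ᶜ ρ *ᶜ closedForm b i p v r n
        scaled = closedForm-scaled ρ b i p v r n

      closedForm-isAbelSum : ∃ λ S → HasAbelSum term S ×
        b ^ᶜ r *ᶜ S ≈ᶜ (closedForm b i p v r n /ᶜ (n !)) {{ℕₚ._!≢0 n}}
      closedForm-isAbelSum = S , Sums.abelSum ,
        ≈ᶜ-trans scaled (≈ᶜ-sym (∙ᶜ≈ofℝ-* (1/! n) (closedForm b i p v r n)))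

      closedForm-unique : ∀ {e} → (∃ λ S → HasAbelSum term S × b ^ᶜ r *ᶜ S ≈ᶜ (e /ᶜ (n !)) {{ℕₚ._!≢0 n}}) →
        e ≈ᶜ closedForm b i p v r n
      closedForm-unique {e} (T , abel , bT≈e/n!) = cancel (≈ᶜ-trans (≈ᶜ-sym (∙ᶜ≈ofℝ-* (1/! n) e))
        (≈ᶜ-trans (≈ᶜ-sym bT≈e/n!) (≈ᶜ-trans (*ᶜ-congˡ {x = b ^ᶜ r} (Sums.abelSum-unique abel)) scaled)))
        where
        n!ρ≈1 : fromℕᶜ (n !) *ᶜ ρ ≈ᶜ 1ᶜ
        n!ρ≈1 = ≈ᶜ-trans (≈ᶜ-sym (ofℝ-* (fromℕ (n !)) (1/! n))) (ofℝ-cong (recip-inverse (n !) {{ℕₚ._!≢0 n}}))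
        expand : ∀ z → fromℕᶜ (n !) *ᶜ (ρ *ᶜ z) ≈ᶜ z
        expand z = ≈ᶜ-trans (≈ᶜ-sym (*ᶜ-assoc (fromℕᶜ (n !)) ρ z)) (≈ᶜ-trans (*ᶜ-congʳ {x = z} n!ρ≈1) (*ᶜ-identityˡ z))
        cancel : ∀ {z w} → ρ *ᶜ z ≈ᶜ ρ *ᶜ w → z ≈ᶜ w
        cancel {z} {w} e = ≈ᶜ-trans (≈ᶜ-sym (expand z)) (≈ᶜ-trans (*ᶜ-congˡ {x = fromℕᶜ (n !)} e) (expand w))

    module _ (β : Branch) (isBranch : β isBranchOf q) (r : ℕ) where
      private
        module CF (b i : ℂ) (n : ℕ) (x : Carrier) = ClosedForm b i r n (pow β x) (λ k → pow β (fromℕ k + x))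
          (λ k → pow-shift β isBranch k refl)

      qEuler : ℕ → Carrier → ℂ
      qEuler n x = closedForm b i (pow β x) v r n

      qEuler-isQEuler : IsQEuler q ∣q∣<1 β r qEuler
      qEuler-isQEuler x _ n = CF.closedForm-isAbelSum b i n x

      isAbelSum-unique : ∀ {b i E} → IsAbelSum b i β r E → ∀ n x → Admissible β x →
        E n x ≈ᶜ closedForm b i (pow β x) v r n
      isAbelSum-unique {b} {i} isE n x adm = CF.closedForm-unique b i n x (isE x adm n)

-- The multiplication formula and the expansion

module Distribution {c ℓ₁ ℓ₂ : Level} (R : RealNumbers c ℓ₁ ℓ₂) where
  open RealNumbers R
  open OrderedField R
  open Complex R
  open QEuler R
  open ComplexRing R
  open RealPowers R
  open AbelSums R
  open QEulerClosedForm R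
  open ℂ-Algebra using (𝐜; closedForm; closedForm-congᵖ; closedForm-distribute; closedForm-multiplication)

  module _ (q : ℂ) (∣q∣<1 : ∣ q ∣< 1#) (r f : ℕ) (odd : Odd f) (n : ℕ) (p : ℂ) where
    private
      b = [2] q ∣q∣<1
      i = 1/[1-q] q ∣q∣<1
      v = 1/[1+q^_] q ∣q∣<1

      w : ℕ → ℂ
      w l = v (l *ℕ f)

      inner : ℕ → Vec ℕ r → ℂ
      inner l a = sign (Vec.sum a) *ᶜ q ^ᶜ (l *ℕ Vec.sum a) *ᶜ w l ^ᶜ r

      distributed : ℂ
      distributed = b ^ᶜ r *ᶜ i ^ᶜ n *ᶜ ℂ-Sums.∑ (suc n) λ l → 𝐜 n p l *ᶜ ℂ-Sums.∑ʳ r f (inner l)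

      expanded : ℂ
      expanded = b ^ᶜ r *ᶜ i ^ᶜ n *ᶜ
        ∑< (suc n) (λ l → fromℕᶜ (n C l) *ᶜ (-ᶜ p) ^ᶜ l *ᶜ ∑ᵗ r f (inner l))

      expanded≈distributed : expanded ≈ᶜ distributed
      expanded≈distributed = *ᶜ-congˡ {x = b ^ᶜ r *ᶜ i ^ᶜ n} (≈ᶜ-trans
        (∑<≈∑ (suc n) λ l → fromℕᶜ (n C l) *ᶜ (-ᶜ p) ^ᶜ l *ᶜ ∑ᵗ r f (inner l))
        (ℂ-Sums.∑-cong (suc n) λ l → *ᶜ-cong
          {x = fromℕᶜ (n C l) *ᶜ (-ᶜ p) ^ᶜ l} {y = 𝐜 n p l} {u = ∑ᵗ r f (inner l)} {v = ℂ-Sums.∑ʳ r f (inner l)}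
          (*ᶜ-congʳ {x = (-ᶜ p) ^ᶜ l} (fromℕᶜ≈·1 (n C l))) (∑ᵗ≈∑ʳ r f (inner l))))

      closedForm≈distributed : closedForm b i p v r n ≈ᶜ distributed
      closedForm≈distributed = closedForm-distribute {q} {f} b i p v w r n odd
        (1+q^-inverse q ∣q∣<1) (λ l → 1+q^-inverse q ∣q∣<1 (l *ℕ f))

    closedForm≈expanded : closedForm b i p v r n ≈ᶜ b ^ᶜ r *ᶜ i ^ᶜ n *ᶜ
      ∑< (suc n) (λ l → fromℕᶜ (n C l) *ᶜ (-ᶜ p) ^ᶜ l *ᶜ
        ∑ᵗ r f (λ a → sign (Vec.sum a) *ᶜ q ^ᶜ (l *ℕ Vec.sum a) *ᶜ w l ^ᶜ r))
    closedForm≈expanded = ≈ᶜ-trans {closedForm b i p v r n} {distributed} {expanded}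
      closedForm≈distributed (≈ᶜ-sym {expanded} {distributed} expanded≈distributed)

    -- `e a` stands for the value of the polynomial for q^f at (a₁ + ⋯ + a_r + x) / f, where p = q^x
    -- has been scaled by q^(a₁ + ⋯ + a_r).
    closedForm-multiplied : ∀ Q (∣Q∣<1 : ∣ Q ∣< 1#) → Q ≡ q ^ᶜ f → ∀ bᶠ 1/bᶠ iᶠ →
      bᶠ *ᶜ 1/bᶠ ≈ᶜ 1ᶜ → (1ᶜ -ᶜ q ^ᶜ f) *ᶜ iᶠ ≈ᶜ 1ᶜ → ∀ (e : Vec ℕ r → ℂ) →
      (∀ a → e a ≈ᶜ closedForm bᶠ iᶠ (q ^ᶜ Vec.sum a *ᶜ p) (1/[1+q^_] Q ∣Q∣<1) r n) →
      closedForm b i p v r n ≈ᶜ (b *ᶜ 1/bᶠ) ^ᶜ r *ᶜ bracketℕ q ∣q∣<1 f ^ᶜ n *ᶜ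
        ∑ᵗ r f (λ a → sign (Vec.sum a) *ᶜ e a)
    closedForm-multiplied Q ∣Q∣<1 Q≡q^f bᶠ 1/bᶠ iᶠ b-inv i-inv e e≈ =
      ≈ᶜ-trans {closedForm b i p v r n} {distributed} {h *ᶜ A} closedForm≈distributed
        (≈ᶜ-sym {h *ᶜ A} {distributed} (≈ᶜ-trans {h *ᶜ A} {h *ᶜ B} {distributed} (*ᶜ-congˡ {h} {A} {B} A≈B) multiplied))
      where
      vᶠ : ℕ → ℂ
      vᶠ = 1/[1+q^_] Q ∣Q∣<1
      h A B : ℂ
      h = (b *ᶜ 1/bᶠ) ^ᶜ r *ᶜ bracketℕ q ∣q∣<1 f ^ᶜ n
      A = ∑ᵗ r f λ a → sign (Vec.sum a) *ᶜ e a
      B = ℂ-Sums.∑ʳ r f λ a → sign (Vec.sum a) *ᶜ closedForm bᶠ iᶠ (q ^ᶜ Vec.sum a *ᶜ p) vᶠ r n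
      A≈B : A ≈ᶜ B
      A≈B = ≈ᶜ-trans {A} {ℂ-Sums.∑ʳ r f λ a → sign (Vec.sum a) *ᶜ e a} {B} (∑ᵗ≈∑ʳ r f λ a → sign (Vec.sum a) *ᶜ e a)
        (ℂ-Sums.∑ʳ-cong r f {λ a → sign (Vec.sum a) *ᶜ e a}
          {λ a → sign (Vec.sum a) *ᶜ closedForm bᶠ iᶠ (q ^ᶜ Vec.sum a *ᶜ p) vᶠ r n}
          λ a → *ᶜ-congˡ {sign (Vec.sum a)} {e a} {closedForm bᶠ iᶠ (q ^ᶜ Vec.sum a *ᶜ p) vᶠ r n} (e≈ a))
      multiplied : h *ᶜ B ≈ᶜ distributed
      multiplied = closedForm-multiplication {q} {f} {b} {i} {bᶠ} {1/bᶠ} {iᶠ} p vᶠ w r n b-inv i-inv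
        (λ l → ≡.subst (λ z → (1ᶜ +ᶜ z ^ᶜ l) *ᶜ vᶠ l ≈ᶜ 1ᶜ) Q≡q^f (1+q^-inverse Q ∣Q∣<1 l))
        (λ l → 1+q^-inverse q ∣q∣<1 (l *ℕ f))

  module _ (q : ℂ) (∣q∣<1 : ∣ q ∣< 1#) (β : Branch) (isBranch : β isBranchOf q) (r f : ℕ) (odd : Odd f) where

    isQEuler-expansion : ∀ E → IsQEuler q ∣q∣<1 β r E → ∀ n x → Admissible β x →
      E n x ≈ᶜ [2] q ∣q∣<1 ^ᶜ r *ᶜ 1/[1-q] q ∣q∣<1 ^ᶜ n *ᶜ
        ∑< (suc n) (λ l → fromℕᶜ (n C l) *ᶜ (-ᶜ pow β x) ^ᶜ l *ᶜ
          ∑ᵗ r f (λ a → sign (Vec.sum a) *ᶜ q ^ᶜ (l *ℕ Vec.sum a) *ᶜ 1/[1+q^_] q ∣q∣<1 (l *ℕ f) ^ᶜ r))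
    isQEuler-expansion E isE n x adm = ≈ᶜ-trans {E n x} {qEuler q ∣q∣<1 β isBranch r n x}
      (isAbelSum-unique q ∣q∣<1 β isBranch r {[2] q ∣q∣<1} {1/[1-q] q ∣q∣<1} {E} isE n x adm)
      (closedForm≈expanded q ∣q∣<1 r f odd n (pow β x))

    private
      multiplication : .{{_ : NonZero f}} → ∀ Q (∣Q∣<1 : ∣ Q ∣< 1#) → Q ≡ q ^ᶜ f →
        ∀ βᶠ → βᶠ isBranchOf Q → βᶠ ≡ branch^ f β → ∀ bᶠ 1/bᶠ iᶠ →
        bᶠ *ᶜ 1/bᶠ ≈ᶜ 1ᶜ → (1ᶜ -ᶜ q ^ᶜ f) *ᶜ iᶠ ≈ᶜ 1ᶜ →
        ∀ E Eᶠ → IsQEuler q ∣q∣<1 β r E → IsAbelSum bᶠ iᶠ βᶠ r Eᶠ → ∀ n x → Admissible β x →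
        E n x ≈ᶜ ([2] q ∣q∣<1 *ᶜ 1/bᶠ) ^ᶜ r *ᶜ bracketℕ q ∣q∣<1 f ^ᶜ n *ᶜ
          ∑ᵗ r f (λ a → sign (Vec.sum a) *ᶜ Eᶠ n ((fromℕ (Vec.sum a) + x) * recip f))
      multiplication Q ∣Q∣<1 Q≡q^f βᶠ isBranchᶠ βᶠ≡ bᶠ 1/bᶠ iᶠ b-inv i-inv E Eᶠ isE isEᶠ n x adm =
        ≈ᶜ-trans {E n x} {qEuler q ∣q∣<1 β isBranch r n x}
          (isAbelSum-unique q ∣q∣<1 β isBranch r {[2] q ∣q∣<1} {1/[1-q] q ∣q∣<1} {E} isE n x adm)
          (closedForm-multiplied q ∣q∣<1 r f odd n (pow β x) Q ∣Q∣<1 Q≡q^f bᶠ 1/bᶠ iᶠ b-inv i-inv (λ a → Eᶠ n (y a)) Eᶠ≈)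
        where
        y : Vec ℕ r → Carrier
        y a = (fromℕ (Vec.sum a) + x) * recip f
        -- With k = `Vec.sum a`: (q^f)^((k + x) / f) = q^(k + x) = q^k q^x.
        pow≈ : ∀ a → pow βᶠ (y a) ≈ᶜ q ^ᶜ Vec.sum a *ᶜ pow β x
        pow≈ a = ≈ᶜ-trans {pow βᶠ (y a)} {pow β (fromℕ (Vec.sum a) + x)}
          (≡.subst (λ B → pow B (y a) ≈ᶜ pow β (fromℕ (Vec.sum a) + x)) (≡.sym βᶠ≡) (pow-branch^ β f refl))
          (pow-shift β isBranch (Vec.sum a) refl)
        admᶠ : ∀ a → Admissible βᶠ (y a)
        admᶠ a = ≡.subst (λ B → Admissible B (y a)) (≡.sym βᶠ≡) (admissible-quotient β f (Vec.sum a) adm)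
        Eᶠ≈ : ∀ a → Eᶠ n (y a) ≈ᶜ
          closedForm bᶠ iᶠ (q ^ᶜ Vec.sum a *ᶜ pow β x) (1/[1+q^_] Q ∣Q∣<1) r n
        Eᶠ≈ a = ≈ᶜ-trans {Eᶠ n (y a)} {closedForm bᶠ iᶠ (pow βᶠ (y a)) (1/[1+q^_] Q ∣Q∣<1) r n}
          (isAbelSum-unique Q ∣Q∣<1 βᶠ isBranchᶠ r {bᶠ} {iᶠ} {Eᶠ} isEᶠ n (y a) (admᶠ a))
          (closedForm-congᵖ bᶠ iᶠ {pow βᶠ (y a)} {q ^ᶜ Vec.sum a *ᶜ pow β x}
            (1/[1+q^_] Q ∣Q∣<1) r n (pow≈ a))

    isAbelSum-multiplication : .{{_ : NonZero f}} → ∀ bᶠ 1/bᶠ iᶠ →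
      bᶠ *ᶜ 1/bᶠ ≈ᶜ 1ᶜ → (1ᶜ -ᶜ q ^ᶜ f) *ᶜ iᶠ ≈ᶜ 1ᶜ →
      ∀ E Eᶠ → IsQEuler q ∣q∣<1 β r E → IsAbelSum bᶠ iᶠ (branch^ f β) r Eᶠ → ∀ n x → Admissible β x →
      E n x ≈ᶜ ([2] q ∣q∣<1 *ᶜ 1/bᶠ) ^ᶜ r *ᶜ bracketℕ q ∣q∣<1 f ^ᶜ n *ᶜ
        ∑ᵗ r f (λ a → sign (Vec.sum a) *ᶜ Eᶠ n ((fromℕ (Vec.sum a) + x) * recip f))
    isAbelSum-multiplication =
      multiplication (q ^ᶜ f) (∣z^n∣<1 {q} ∣q∣<1 f) ≡.refl (branch^ f β) (branch^-isBranchOf β isBranch f) ≡.refl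

theorem4 : ∀ {c ℓ₁ ℓ₂ : Level} (R : RealNumbers c ℓ₁ ℓ₂) →
  let open RealNumbers R
      open OrderedField R
      open Complex R
      open QEuler R
  in
  (q : ℂ) (∣q∣<1 : ∣ q ∣< 1#) (b : Branch) → b isBranchOf q →
  (r : ℕ) .{{_ : NonZero r}} (f : ℕ) .{{_ : NonZero f}} → Odd f →
  let q^f     = q ^ᶜ f
      ∣q^f∣<1 = ∣z^n∣<1 ∣q∣<1 f
      b^f     = branch^ f b
  in
  (∃ λ E → IsQEuler q ∣q∣<1 b r E) ×
  (∀ E Eᶠ → IsQEuler q ∣q∣<1 b r E → IsQEuler q^f ∣q^f∣<1 b^f r Eᶠ →
    ∀ (n : ℕ) (x : Carrier) → Admissible b x → (∀ k → ¬ (x ≈ - fromℕ k)) →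
    (E n x ≈ᶜ
      ([2] q ∣q∣<1 *ᶜ 1/[2] q^f ∣q^f∣<1) ^ᶜ r *ᶜ bracketℕ q ∣q∣<1 f ^ᶜ n *ᶜ
      ∑ᵗ r f (λ a → sign (Vec.sum a) *ᶜ
        Eᶠ n ((fromℕ (Vec.sum a) + x) * recip f)))
    ×
    (E n x ≈ᶜ
      [2] q ∣q∣<1 ^ᶜ r *ᶜ 1/[1-q] q ∣q∣<1 ^ᶜ n *ᶜ
      ∑< (suc n) (λ l → fromℕᶜ (n C l) *ᶜ (-ᶜ pow b x) ^ᶜ l *ᶜ
        ∑ᵗ r f (λ a → sign (Vec.sum a) *ᶜ q ^ᶜ (l *ℕ Vec.sum a) *ᶜ
          1/[1+q^_] q ∣q∣<1 (l *ℕ f) ^ᶜ r))))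
theorem4 R q ∣q∣<1 β isBranch r f odd =
  (qEuler q ∣q∣<1 β isBranch r , qEuler-isQEuler q ∣q∣<1 β isBranch r) ,
  λ E Eᶠ isE isEᶠ n x adm _ →
    -- `IsQEuler` for q^f is `IsAbelSum` with the numbers 1 + q^f and 1 / (1 - q^f); the two
    -- inverses left implicit are determined by the proofs passed after them.
    isAbelSum-multiplication q ∣q∣<1 β isBranch r f odd (1ᶜ +ᶜ q ^ᶜ f) _ _
      (*ᶜ-inverseʳ (1ᶜ +ᶜ q ^ᶜ f) _) (*ᶜ-inverseʳ (1ᶜ -ᶜ q ^ᶜ f) _) E Eᶠ isE isEᶠ n x adm ,
    isQEuler-expansion q ∣q∣<1 β isBranch r f odd E isE n x adm
  where
  open RealNumbers R
  open OrderedField R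
  open Complex R
  open QEuler R
  open ComplexRing R
  open RealPowers R
  open QEulerClosedForm R
  open Distribution R
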